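{- Let $n\ge 2k\ge1$ and let $V$ be a set with $|V|=n$. Fix a sequence $x_1,y_1,\ldots,x_k,y_k$ of $2k$ distinct elements of $V$, for $0\le i\le k$ define $\phi_i:V^{(k)}\to\mathbb{R}$ by $\phi_i(A)=(-1)^{|A\cap\{y_1,\ldots,y_i\}|}$ if $|A\cap\{x_j,y_j\}|=1$ for all $j=1,\ldots,i$ and $\phi_i(A)=0$ otherwise, and let $V_i\subseteq\mathbb{R}^{V^{(k)}}$ be the linear span of $\{(\phi_i)_\pi:\pi\in S(V)\}$. Then: (a) For $i\ge1$ and $w:V^{(k)}\to\mathbb{R}$, $\operatorname{disc}(w,\phi_i)=0$ if and only if $w\in V_i^\perp$. (b) If $u\in V_i$ and $w\in V_j$ with $i\ne j$, then $\operatorname{disc}(u,w)=0$. (c) $\mathbb{R}^{V^{(k)}}$ is the direct sum $V_0\oplus\cdots\oplus V_k$. (d) If $u=u_0+\cdots+u_k$ with $u_i\in V_i$ for each $i$, and $(U_0,\ldots,U_k)$ is the $W$-vector of $u$, then for each $i=0,\ldots,k$ we have $U_i=0$ if and only if $u_i=\mathbf 0$. (e) If $w_1,\ldots,w_t:V^{(k)}\to\mathbb{R}$ are nonzero and satisfy $\operatorname{disc}(w_i,w_j)=0$ for all $i\ne j$, then there is a partition $[k]=I_1\cup\cdots\cup I_t$ (into pairwise disjoint, possibly empty, sets) such that $w_i\in V_0\oplus\bigoplus_{h\in I_i}V_h$ for each $i$.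
   Context: $V^{(k)}$ is the family of $k$-subsets of $V$; $S(V)$ is the symmetric group on $V$; $[k]=\{1,\dots,k\}$. Weightings $w:V^{(k)}\to\mathbb{R}$ carry the inner product $\langle w,u\rangle=\sum_{e}w(e)u(e)$ (orthogonal complements $\perp$ are taken with respect to it); $w(V)=\sum_e w(e)$, $d(w)=w(V)/\binom nk$, $w_\pi(e)=w(\pi^{ -1}(e))$, and $\operatorname{disc}(w,u)=\max_{\pi\in S(V)}|\langle w_\pi,u\rangle-d(w)d(u)\binom nk|$. Note $\phi_0$ is the constant function $1$. $W$-vector (defined recursively on $k$): $W_0=|w(V)|/\binom nk$ (for $k=0$, $w$ is a single real number and $W_0=|w|$). For $k\ge1$ and distinct $x,y\in V$, $w^{xy}:(V\setminus\{x,y\})^{(k-1)}\to\mathbb{R}$ is $w^{xy}(e)=w(e\cup\{x\})-w(e\cup\{y\})$; with $(W^{xy}_0,\ldots,W^{xy}_{k-1})$ its $W$-vector, $W_i=\frac{1}{n(n-1)}\sum_{(x,y):\,x\ne y}W^{xy}_{i-1}$ for $1\le i\le k$ (average over ordered pairs of distinct vertices). -}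

module Defs where

open import Data.Bool.Base using (if_then_else_)
open import Data.Fin.Base using (Fin; zero; suc; toℕ)
open import Data.Fin.Permutation as Perm using (Permutation′; _⟨$⟩ʳ_)
import Data.Fin.Properties as Fin
open import Data.Fin.Subset
  using (Subset; inside; outside; _∈_; _∉_; _⊆_; _∪_; _∩_; _─_; ⁅_⁆; ⊤; ⋃; Empty; ∣_∣)
open import Data.Fin.Subset.Properties
  using (_∈?_; _⊆?_; ⊆-max; ∪-identityʳ; x∈p∪q⁻; x∈p∪q⁺; x∈⁅x⁆; x∈⁅y⁆⇒x≡y; p─q⊆p)
import Data.Integer.Base as ℤ
import Data.Irrelevant as Irrelevant
open import Data.List.Base
  using (List; []; _∷_; _++_; map; mapMaybe; concatMap; foldr; filter; allFin; cartesianProduct)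
open import Data.Maybe.Base using (Maybe; just; nothing)
open import Data.Nat.Base as ℕ using (ℕ; zero; suc)
open import Data.Nat.Combinatorics using (_C_)
import Data.Nat.Properties as ℕ
open import Data.Product.Base using (Σ; ∃-syntax; _×_; _,_; proj₁; proj₂)
open import Data.Rational.Base as ℚ using (ℚ; 0ℚ; 1ℚ; ½)
import Data.Rational.Properties as ℚ
open import Data.Rational.Solver using (module +-*-Solver)
open import Data.Refinement using (Refinement; Refinement-syntax; value; _,_)
open import Data.Sum.Base using (inj₁; inj₂)
open import Data.Vec.Base as Vec using ([]; _∷_; tabulate; lookup)
import Data.Vec.Properties as Vec
open import Algebra.Properties.CommutativeMonoid.Sum ℕ.+-0-commutativeMonoid
  using (sum-permute; sum-cong-≗) renaming (sum to sumℕ)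
open import Function.Base using (_∘_)
open import Relation.Binary.PropositionalEquality
  using (_≡_; _≢_; refl; sym; trans; cong; cong₂; subst; module ≡-Reasoning)
open import Relation.Nullary using (¬_; Dec; yes; no; does; contradiction)
open import Relation.Nullary.Decidable using (_×-dec_; _→-dec_; ¬?)

-- Reals are Cauchy sequences of rationals; their equality is _≈_, not _≡_.

IsCauchy : (ℕ → ℚ) → Set
IsCauchy s = ∀ ε → 0ℚ ℚ.< ε →
  ∃[ N ] (∀ m n → N ℕ.≤ m → N ℕ.≤ n → ℚ.∣ s m ℚ.- s n ∣ ℚ.< ε)

record ℝ : Set where
  constructor mkℝ
  field
    seq    : ℕ → ℚ
    cauchy : IsCauchy seq
open ℝ public

infix 4 _≈_
_≈_ : ℝ → ℝ → Set
x ≈ y = ∀ ε → 0ℚ ℚ.< ε →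
  ∃[ N ] (∀ n → N ℕ.≤ n → ℚ.∣ seq x n ℚ.- seq y n ∣ ℚ.< ε)

private
  halve : ∀ ε → 0ℚ ℚ.< ε → 0ℚ ℚ.< ½ ℚ.* ε
  halve ε ε>0 = subst (ℚ._< ½ ℚ.* ε) (ℚ.*-zeroʳ ½) (ℚ.*-monoʳ-<-pos ½ ε>0)

  halves : ∀ ε → ½ ℚ.* ε ℚ.+ ½ ℚ.* ε ≡ ε
  halves ε = trans (sym (ℚ.*-distribʳ-+ ε ½ ½)) (ℚ.*-identityˡ ε)

  p≤∣p∣ : ∀ p → p ℚ.≤ ℚ.∣ p ∣
  p≤∣p∣ p with ℚ.≤-total 0ℚ p
  ... | inj₁ 0≤p = ℚ.≤-reflexive (sym (ℚ.0≤p⇒∣p∣≡p 0≤p))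
  ... | inj₂ p≤0 = ℚ.≤-trans p≤0 (ℚ.0≤∣p∣ p)

  ∣∣-lub : ∀ {p q} → p ℚ.≤ q → ℚ.- p ℚ.≤ q → ℚ.∣ p ∣ ℚ.≤ q
  ∣∣-lub {p} p≤q -p≤q with ℚ.∣p∣≡p∨∣p∣≡-p p
  ... | inj₁ eq = subst (ℚ._≤ _) (sym eq) p≤q
  ... | inj₂ eq = subst (ℚ._≤ _) (sym eq) -p≤q

  ∣∣-swap : ∀ p q → ℚ.∣ p ℚ.- q ∣ ≡ ℚ.∣ q ℚ.- p ∣
  ∣∣-swap p q = trans (cong ℚ.∣_∣ eq) (ℚ.∣-p∣≡∣p∣ (q ℚ.- p))
    where
    open +-*-Solver
    eq : p ℚ.- q ≡ ℚ.- (q ℚ.- p)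
    eq = solve 2 (λ a b → (a :- b) := (:- (b :- a))) refl p q

  ≤+gap : ∀ a c → a ℚ.≤ c ℚ.+ ℚ.∣ a ℚ.- c ∣
  ≤+gap a c = subst (ℚ._≤ c ℚ.+ ℚ.∣ a ℚ.- c ∣) eq (ℚ.+-monoʳ-≤ c (p≤∣p∣ (a ℚ.- c)))
    where
    open +-*-Solver
    eq : c ℚ.+ (a ℚ.- c) ≡ a
    eq = solve 2 (λ a c → (c :+ (a :- c)) := a) refl a c

  ≤-shift : ∀ {a c e} → a ℚ.≤ c ℚ.+ e → a ℚ.- c ℚ.≤ e
  ≤-shift {a} {c} {e} h = subst (a ℚ.- c ℚ.≤_) eq (ℚ.+-monoˡ-≤ (ℚ.- c) h)
    where
    open +-*-Solver
    eq : c ℚ.+ e ℚ.- c ≡ e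
    eq = solve 2 (λ c e → ((c :+ e) :- c) := e) refl c e

  NonExpansive : (ℚ → ℚ → ℚ) → Set
  NonExpansive f = ∀ a b c d →
    ℚ.∣ f a b ℚ.- f c d ∣ ℚ.≤ ℚ.∣ a ℚ.- c ∣ ℚ.+ ℚ.∣ b ℚ.- d ∣

  -- By symmetry one side of the estimate suffices.
  nonExpansive : ∀ f →
    (∀ a b c d → f a b ℚ.≤ f c d ℚ.+ (ℚ.∣ a ℚ.- c ∣ ℚ.+ ℚ.∣ b ℚ.- d ∣)) →
    NonExpansive f
  nonExpansive f h a b c d = ∣∣-lub (≤-shift (h a b c d))
    (subst (ℚ._≤ _) eq (≤-shift
      (subst (λ e → f c d ℚ.≤ f a b ℚ.+ e)
             (cong₂ ℚ._+_ (∣∣-swap c a) (∣∣-swap d b)) (h c d a b))))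
    where
    open +-*-Solver
    eq : f c d ℚ.- f a b ≡ ℚ.- (f a b ℚ.- f c d)
    eq = solve 2 (λ x y → (y :- x) := (:- (x :- y))) refl (f a b) (f c d)

  lift₂ : ∀ f → NonExpansive f → ∀ s t → IsCauchy s → IsCauchy t →
          IsCauchy (λ n → f (s n) (t n))
  lift₂ f ne s t cs ct ε ε>0
    with cs (½ ℚ.* ε) (halve ε ε>0) | ct (½ ℚ.* ε) (halve ε ε>0)
  ... | M , p | N , q = M ℕ.⊔ N , λ m n hm hn →
    ℚ.≤-<-trans (ne (s m) (t m) (s n) (t n))
      (subst (_ ℚ.<_) (halves ε)
        (ℚ.+-mono-< (p m n (ℕ.m⊔n≤o⇒m≤o M N hm) (ℕ.m⊔n≤o⇒m≤o M N hn))
                    (q m n (ℕ.m⊔n≤o⇒n≤o M N hm) (ℕ.m⊔n≤o⇒n≤o M N hn))))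

  +-nonExpansive : NonExpansive ℚ._+_
  +-nonExpansive a b c d = subst (λ z → ℚ.∣ z ∣ ℚ.≤ ℚ.∣ a ℚ.- c ∣ ℚ.+ ℚ.∣ b ℚ.- d ∣) eq
    (ℚ.∣p+q∣≤∣p∣+∣q∣ (a ℚ.- c) (b ℚ.- d))
    where
    open +-*-Solver
    eq : (a ℚ.- c) ℚ.+ (b ℚ.- d) ≡ (a ℚ.+ b) ℚ.- (c ℚ.+ d)
    eq = solve 4 (λ a b c d → ((a :- c) :+ (b :- d)) := ((a :+ b) :- (c :+ d))) refl a b c d

  gap≤ˡ : ∀ e a c b d → e ℚ.+ ℚ.∣ a ℚ.- c ∣ ℚ.≤ e ℚ.+ (ℚ.∣ a ℚ.- c ∣ ℚ.+ ℚ.∣ b ℚ.- d ∣)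
  gap≤ˡ e a c b d = ℚ.+-monoʳ-≤ e
    (subst (ℚ._≤ ℚ.∣ a ℚ.- c ∣ ℚ.+ ℚ.∣ b ℚ.- d ∣) (ℚ.+-identityʳ ℚ.∣ a ℚ.- c ∣)
      (ℚ.+-monoʳ-≤ ℚ.∣ a ℚ.- c ∣ (ℚ.0≤∣p∣ (b ℚ.- d))))

  gap≤ʳ : ∀ e a c b d → e ℚ.+ ℚ.∣ b ℚ.- d ∣ ℚ.≤ e ℚ.+ (ℚ.∣ a ℚ.- c ∣ ℚ.+ ℚ.∣ b ℚ.- d ∣)
  gap≤ʳ e a c b d = ℚ.+-monoʳ-≤ e
    (subst (ℚ._≤ ℚ.∣ a ℚ.- c ∣ ℚ.+ ℚ.∣ b ℚ.- d ∣) (ℚ.+-identityˡ ℚ.∣ b ℚ.- d ∣)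
      (ℚ.+-monoˡ-≤ ℚ.∣ b ℚ.- d ∣ (ℚ.0≤∣p∣ (a ℚ.- c))))

  ⊔-nonExpansive : NonExpansive ℚ._⊔_
  ⊔-nonExpansive = nonExpansive ℚ._⊔_ λ a b c d → ℚ.⊔-lub
    (ℚ.≤-trans (≤+gap a c)
      (ℚ.≤-trans (ℚ.+-monoˡ-≤ ℚ.∣ a ℚ.- c ∣ (ℚ.p≤p⊔q c d)) (gap≤ˡ (c ℚ.⊔ d) a c b d)))
    (ℚ.≤-trans (≤+gap b d)
      (ℚ.≤-trans (ℚ.+-monoˡ-≤ ℚ.∣ b ℚ.- d ∣ (ℚ.p≤q⊔p c d)) (gap≤ʳ (c ℚ.⊔ d) a c b d)))

  neg-cauchy : ∀ s → IsCauchy s → IsCauchy (λ n → ℚ.- s n)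
  neg-cauchy s cs ε ε>0 with cs ε ε>0
  ... | N , p = N , λ m n hm hn →
    subst (ℚ._< ε) (trans (sym (ℚ.∣-p∣≡∣p∣ (s m ℚ.- s n)))
      (cong ℚ.∣_∣ (ℚ.neg-distrib-+ (s m) (ℚ.- s n)))) (p m n hm hn)

  bounded : ∀ s → IsCauchy s →
    ∃[ B ] ∃[ N ] (ℚ.Positive B × (∀ n → N ℕ.≤ n → ℚ.∣ s n ∣ ℚ.≤ B))
  bounded s cs with cs 1ℚ (ℚ.positive⁻¹ 1ℚ)
  ... | N , p = ℚ.∣ s N ∣ ℚ.+ 1ℚ , N , pos , λ n hn →
      ℚ.≤-trans (subst (λ z → ℚ.∣ z ∣ ℚ.≤ ℚ.∣ s N ∣ ℚ.+ ℚ.∣ s n ℚ.- s N ∣) (eq n) (ℚ.∣p+q∣≤∣p∣+∣q∣ (s N) (s n ℚ.- s N)))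
                (ℚ.+-monoʳ-≤ ℚ.∣ s N ∣ (ℚ.<⇒≤ (p n N hn ℕ.≤-refl)))
    where
    pos : ℚ.Positive (ℚ.∣ s N ∣ ℚ.+ 1ℚ)
    pos = ℚ.nonNeg+pos⇒pos ℚ.∣ s N ∣ {{ℚ.∣-∣-nonNeg (s N)}} 1ℚ
    open +-*-Solver
    eq : ∀ n → s N ℚ.+ (s n ℚ.- s N) ≡ s n
    eq n = solve 2 (λ a c → (c :+ (a :- c)) := a) refl (s n) (s N)

  *-split : ∀ a b c d → a ℚ.* (b ℚ.- d) ℚ.+ d ℚ.* (a ℚ.- c) ≡ a ℚ.* b ℚ.- c ℚ.* d
  *-split = solve 4 (λ a b c d →
    ((a :* (b :- d)) :+ (d :* (a :- c))) := ((a :* b) :- (c :* d))) refl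
    where open +-*-Solver

  *-small : ∀ D → ℚ.Positive D → ∀ η → 0ℚ ℚ.< η → ∃[ δ ] (0ℚ ℚ.< δ ×
    (∀ p q → ℚ.∣ p ∣ ℚ.≤ D → ℚ.∣ q ∣ ℚ.< δ → ℚ.∣ p ℚ.* q ∣ ℚ.< η))
  *-small D D>0 η η>0 = 1/D ℚ.* η
    , subst (ℚ._< 1/D ℚ.* η) (ℚ.*-zeroʳ 1/D) (ℚ.*-monoʳ-<-pos 1/D {{ℚ.1/pos⇒pos D}} η>0)
    , λ p q hp hq → ℚ.≤-<-trans
        (subst (ℚ._≤ D ℚ.* ℚ.∣ q ∣) (sym (ℚ.∣p*q∣≡∣p∣*∣q∣ p q))
          (ℚ.*-monoʳ-≤-nonNeg ℚ.∣ q ∣ {{ℚ.∣-∣-nonNeg q}} hp))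
        (subst (D ℚ.* ℚ.∣ q ∣ ℚ.<_) cancel (ℚ.*-monoʳ-<-pos D hq))
    where
    instance
      positive : ℚ.Positive D
      positive = D>0
      nonZero : ℚ.NonZero D
      nonZero = ℚ.pos⇒nonZero D
    1/D = ℚ.1/ D
    cancel : D ℚ.* (1/D ℚ.* η) ≡ η
    cancel = trans (sym (ℚ.*-assoc D 1/D η))
      (trans (cong (ℚ._* η) (ℚ.*-inverseʳ D)) (ℚ.*-identityˡ η))

  *-estimate : ∀ a b c d {η} → ℚ.∣ a ℚ.* (b ℚ.- d) ∣ ℚ.< η → ℚ.∣ d ℚ.* (a ℚ.- c) ∣ ℚ.< η →
               ℚ.∣ a ℚ.* b ℚ.- c ℚ.* d ∣ ℚ.< η ℚ.+ η
  *-estimate a b c d p q = subst (λ z → ℚ.∣ z ∣ ℚ.< _) (*-split a b c d)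
    (ℚ.≤-<-trans (ℚ.∣p+q∣≤∣p∣+∣q∣ (a ℚ.* (b ℚ.- d)) (d ℚ.* (a ℚ.- c))) (ℚ.+-mono-< p q))

  *-cauchy : ∀ s t → IsCauchy s → IsCauchy t → IsCauchy (λ n → s n ℚ.* t n)
  *-cauchy s t cs ct ε ε>0 =
    let A , M₁ , A>0 , hA = bounded s cs
        B , N₁ , B>0 , hB = bounded t ct
        α , α>0 , small-α = *-small A A>0 (½ ℚ.* ε) (halve ε ε>0)
        β , β>0 , small-β = *-small B B>0 (½ ℚ.* ε) (halve ε ε>0)
        M₂ , hM = cs β β>0
        N₂ , hN = ct α α>0
    in (M₁ ℕ.⊔ M₂) ℕ.⊔ (N₁ ℕ.⊔ N₂) , λ m n hm hn →
      let m₁ = ℕ.m⊔n≤o⇒m≤o (M₁ ℕ.⊔ M₂) (N₁ ℕ.⊔ N₂) hm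
          m₂ = ℕ.m⊔n≤o⇒n≤o (M₁ ℕ.⊔ M₂) (N₁ ℕ.⊔ N₂) hm
          n₁ = ℕ.m⊔n≤o⇒m≤o (M₁ ℕ.⊔ M₂) (N₁ ℕ.⊔ N₂) hn
          n₂ = ℕ.m⊔n≤o⇒n≤o (M₁ ℕ.⊔ M₂) (N₁ ℕ.⊔ N₂) hn
      in subst (ℚ.∣ s m ℚ.* t m ℚ.- s n ℚ.* t n ∣ ℚ.<_) (halves ε)
        (*-estimate (s m) (t m) (s n) (t n)
          (small-α (s m) (t m ℚ.- t n) (hA m (ℕ.m⊔n≤o⇒m≤o M₁ M₂ m₁))
            (hN m n (ℕ.m⊔n≤o⇒n≤o N₁ N₂ m₂) (ℕ.m⊔n≤o⇒n≤o N₁ N₂ n₂)))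
          (small-β (t n) (s m ℚ.- s n) (hB n (ℕ.m⊔n≤o⇒m≤o N₁ N₂ n₂))
            (hM m n (ℕ.m⊔n≤o⇒n≤o M₁ M₂ m₁) (ℕ.m⊔n≤o⇒n≤o M₁ M₂ n₁))))

infixl 6 _+_ _-_ _⊔_
infixl 7 _*_ _÷_
infix  8 -_

fromℚ : ℚ → ℝ
fromℚ q = mkℝ (λ _ → q) λ ε ε>0 →
  0 , λ _ _ _ _ → subst (λ z → ℚ.∣ z ∣ ℚ.< ε) (sym (ℚ.+-inverseʳ q)) ε>0

0ℝ 1ℝ : ℝ
0ℝ = fromℚ 0ℚ
1ℝ = fromℚ 1ℚ

fromℕ : ℕ → ℝ
fromℕ m = fromℚ (ℤ.+ m ℚ./ 1)

-_ : ℝ → ℝ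
- x = mkℝ (λ n → ℚ.- seq x n) (neg-cauchy (seq x) (cauchy x))

_+_ _*_ _⊔_ : ℝ → ℝ → ℝ
x + y = mkℝ (λ n → seq x n ℚ.+ seq y n) (lift₂ ℚ._+_ +-nonExpansive (seq x) (seq y) (cauchy x) (cauchy y))
x * y = mkℝ (λ n → seq x n ℚ.* seq y n) (*-cauchy (seq x) (seq y) (cauchy x) (cauchy y))
x ⊔ y = mkℝ (λ n → seq x n ℚ.⊔ seq y n) (lift₂ ℚ._⊔_ ⊔-nonExpansive (seq x) (seq y) (cauchy x) (cauchy y))

_-_ : ℝ → ℝ → ℝ
x - y = x + - y

abs : ℝ → ℝ
abs x = x ⊔ - x

-- Division by a natural number; the divisors used below are nonzero whenever
-- the ground set has at least 2k elements.
_÷_ : ℝ → ℕ → ℝ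
x ÷ zero  = 0ℝ
x ÷ suc m = x * fromℚ (ℤ.+ 1 ℚ./ suc m)

[-1]^_ : ℕ → ℝ
[-1]^ zero  = 1ℝ
[-1]^ suc m = - 1ℝ * [-1]^ m

∑ : {A : Set} → List A → (A → ℝ) → ℝ
∑ xs f = foldr (λ a s → f a + s) 0ℝ xs

select : {A : Set} {P : A → Set} → (∀ a → Dec (P a)) → List A → List [ a ∈ A ∣ P a ]
select {A} {P} P? = mapMaybe check
  where
  check : A → Maybe [ a ∈ A ∣ P a ]
  check a with P? a
  ... | yes p = just (a , Irrelevant.[ p ])
  ... | no  _ = nothing

subsets : ∀ n → List (Subset n)
subsets zero    = [] ∷ []
subsets (suc n) = map (outside ∷_) (subsets n) ++ map (inside ∷_) (subsets n)

-- A permutation of Fin (suc n) is determined by the image j of zero and the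
-- bijection it induces between the remaining points.
permutations : ∀ n → List (Permutation′ n)
permutations zero    = Perm.id ∷ []
permutations (suc n) = concatMap (λ j → map (Perm.insert zero j) (permutations n)) (allFin (suc n))

-- Ground sets are subsets V of some Fin n, so that the ground set V ∖ {x , y} of
-- w^{xy} is again one; the whole set Fin n is ⊤.

private variable
  n k : ℕ

infixl 9 _⁽_⁾
_⁽_⁾ : Subset n → ℕ → Set
_⁽_⁾ {n} V k = [ e ∈ Subset n ∣ e ⊆ V × ∣ e ∣ ≡ k ]

kSubsets : (V : Subset n) (k : ℕ) → List (V ⁽ k ⁾)
kSubsets {n} V k = select (λ e → (e ⊆? V) ×-dec (∣ e ∣ ℕ.≟ k)) (subsets n)

Weighting : Subset n → ℕ → Set
Weighting V k = V ⁽ k ⁾ → ℝ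

module _ {V : Subset n} where

  infix  4 _≋_
  infixl 6 _⊞_

  _≋_ : Weighting V k → Weighting V k → Set
  w ≋ u = ∀ e → w e ≈ u e

  𝟎 : Weighting V k
  𝟎 _ = 0ℝ

  _⊞_ : Weighting V k → Weighting V k → Weighting V k
  (w ⊞ u) e = w e + u e

  _•_ : ℝ → Weighting V k → Weighting V k
  (c • w) e = c * w e

  ⊞-sum : {A : Set} → List A → (A → Weighting V k) → Weighting V k
  ⊞-sum as w = foldr (λ a u → w a ⊞ u) 𝟎 as

  total : Weighting V k → ℝ
  total w = ∑ (kSubsets V _) w

  ⟨_,_⟩ : Weighting V k → Weighting V k → ℝ
  ⟨ w , u ⟩ = ∑ (kSubsets V _) λ e → w e * u e

  density : Weighting V k → ℝ
  density {k} w = total w ÷ (∣ V ∣ C k)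

preimage : Permutation′ n → Subset n → Subset n
preimage π e = tabulate (λ i → lookup e (π ⟨$⟩ʳ i))

private
  indicator : Subset n → Fin n → ℕ
  indicator e i = if lookup e i then 1 else 0

  ∣∣-sum : (e : Subset n) → ∣ e ∣ ≡ sumℕ (indicator e)
  ∣∣-sum []            = refl
  ∣∣-sum (outside ∷ e) = ∣∣-sum e
  ∣∣-sum (inside  ∷ e) = cong suc (∣∣-sum e)

∣preimage∣ : (π : Permutation′ n) (e : Subset n) → ∣ preimage π e ∣ ≡ ∣ e ∣
∣preimage∣ π e = begin
  ∣ preimage π e ∣                       ≡⟨ ∣∣-sum (preimage π e) ⟩
  sumℕ (indicator (preimage π e))        ≡⟨ sum-cong-≗ (λ i → cong (if_then 1 else 0)
                                              (Vec.lookup∘tabulate (λ j → lookup e (π ⟨$⟩ʳ j)) i)) ⟩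
  sumℕ (λ i → indicator e (π ⟨$⟩ʳ i))    ≡⟨ sum-permute (indicator e) π ⟨
  sumℕ (indicator e)                     ≡⟨ ∣∣-sum e ⟨
  ∣ e ∣                                  ∎
  where open ≡-Reasoning

_⁻¹⟨_⟩ : Permutation′ n → ⊤ {n} ⁽ k ⁾ → ⊤ {n} ⁽ k ⁾
π ⁻¹⟨ e , p ⟩ = preimage π e
  , Irrelevant.map (λ q → (λ x∈ → ⊆-max _ x∈) , trans (∣preimage∣ π e) (proj₂ q)) p

permute : Permutation′ n → Weighting (⊤ {n}) k → Weighting (⊤ {n}) k
permute π w e = w (π ⁻¹⟨ e ⟩)

-- The values maximised over are absolute values, so 0 is a neutral seed.
disc : Weighting (⊤ {n}) k → Weighting (⊤ {n}) k → ℝ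
disc {n} {k} w u = foldr _⊔_ 0ℝ (map deviation (permutations n))
  where
  deviation : Permutation′ n → ℝ
  deviation π = abs (⟨ permute π w , u ⟩ - density w * density u * fromℕ (n C k))

OrderedPair : Subset n → Set
OrderedPair {n} V = [ p ∈ Fin n × Fin n ∣ proj₁ p ∈ V × proj₂ p ∈ V × proj₁ p ≢ proj₂ p ]

orderedPairs : (V : Subset n) → List (OrderedPair V)
orderedPairs {n} V = select
  (λ p → (proj₁ p ∈? V) ×-dec (proj₂ p ∈? V) ×-dec ¬? (proj₁ p Fin.≟ proj₂ p))
  (cartesianProduct (allFin n) (allFin n))

_∖_ : (V : Subset n) → OrderedPair V → Subset n
V ∖ ((x , y) , _) = V ─ (⁅ x ⁆ ∪ ⁅ y ⁆)

private
  ∉─ : (p q : Subset n) {x : Fin n} → x ∈ q → x ∉ p ─ q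
  ∉─ (_ ∷ p) (outside ∷ q) (Vec.there x∈q) (Vec.there x∈) = ∉─ p q x∈q x∈
  ∉─ (_ ∷ p) (inside  ∷ q) (Vec.there x∈q) (Vec.there x∈) = ∉─ p q x∈q x∈

  ∣insert∣ : (e : Subset n) (x : Fin n) → x ∉ e → ∣ e ∪ ⁅ x ⁆ ∣ ≡ suc ∣ e ∣
  ∣insert∣ (inside  ∷ e) zero    x∉ = contradiction Vec.here x∉
  ∣insert∣ (outside ∷ e) zero    x∉ = cong (suc ∘ ∣_∣) (∪-identityʳ e)
  ∣insert∣ (inside  ∷ e) (suc x) x∉ = cong suc (∣insert∣ e x (x∉ ∘ Vec.there))
  ∣insert∣ (outside ∷ e) (suc x) x∉ = ∣insert∣ e x (x∉ ∘ Vec.there)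

  insert-valid : ∀ {V q e : Subset n} {x} → x ∈ V → x ∈ q → e ⊆ V ─ q × ∣ e ∣ ≡ k →
                 (e ∪ ⁅ x ⁆ ⊆ V) × ∣ e ∪ ⁅ x ⁆ ∣ ≡ suc k
  insert-valid {V = V} {q} {e} {x} x∈V x∈q (e⊆ , ∣e∣≡k) =
      sub , trans (∣insert∣ e x (λ x∈e → ∉─ V q x∈q (e⊆ x∈e))) (cong suc ∣e∣≡k)
    where
    sub : e ∪ ⁅ x ⁆ ⊆ V
    sub z∈ with x∈p∪q⁻ e ⁅ x ⁆ z∈
    ... | inj₁ z∈e = p─q⊆p V q (e⊆ z∈e)
    ... | inj₂ z∈x = subst (_∈ V) (sym (x∈⁅y⁆⇒x≡y x z∈x)) x∈V

module _ {V : Subset n} where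

  addFst addSnd : (p : OrderedPair V) → (V ∖ p) ⁽ k ⁾ → V ⁽ suc k ⁾
  addFst ((x , y) , h) (e , g) = (e ∪ ⁅ x ⁆) , Irrelevant.zipWith
    (λ r → insert-valid (proj₁ r) (x∈p∪q⁺ (inj₁ (x∈⁅x⁆ x)))) h g
  addSnd ((x , y) , h) (e , g) = (e ∪ ⁅ y ⁆) , Irrelevant.zipWith
    (λ r → insert-valid (proj₁ (proj₂ r)) (x∈p∪q⁺ {p = ⁅ x ⁆} (inj₂ (x∈⁅x⁆ y)))) h g

  difference : Weighting V (suc k) → (p : OrderedPair V) → Weighting (V ∖ p) k
  difference w p e = w (addFst p e) - w (addSnd p e)

-- For k = 0 the only entry is ∣ w ∅ ∣, since ∣ V ∣ C 0 = 1.
W : {V : Subset n} → Weighting V k → Fin (suc k) → ℝ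
W {k = k}     {V} w zero    = abs (total w) ÷ (∣ V ∣ C k)
W {k = suc k} {V} w (suc i) =
  ∑ (orderedPairs V) (λ p → W (difference w p) i) ÷ (∣ V ∣ ℕ.* (∣ V ∣ ℕ.∸ 1))

module _ {n k : ℕ} (x y : Fin k → Fin n) where

  -- Since Fin k indexes x_1 , … , x_k from zero, the index j : Fin k stands for
  -- j + 1, and j + 1 ≤ i reads toℕ j < toℕ i.
  firstYs : Fin (suc k) → Subset n
  firstYs i = ⋃ (map (λ j → ⁅ y j ⁆) (filter (λ j → toℕ j ℕ.<? toℕ i) (allFin k)))

  Splits : Fin (suc k) → Subset n → Set
  Splits i A = ∀ j → toℕ j ℕ.< toℕ i → ∣ A ∩ (⁅ x j ⁆ ∪ ⁅ y j ⁆) ∣ ≡ 1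

  splits? : ∀ i A → Dec (Splits i A)
  splits? i A = Fin.all? λ j → (toℕ j ℕ.<? toℕ i) →-dec (∣ A ∩ (⁅ x j ⁆ ∪ ⁅ y j ⁆) ∣ ℕ.≟ 1)

  φ : Fin (suc k) → Weighting (⊤ {n}) k
  φ i A = if does (splits? i (value A)) then [-1]^ ∣ value A ∩ firstYs i ∣ else 0ℝ

Subspace : Subset n → ℕ → Set₁
Subspace V k = Weighting V k → Set

module _ {V : Subset n} where

  Span : {I : Set} → (I → Weighting V k) → Subspace V k
  Span {I = I} f u = ∃[ cs ] (u ≋ ⊞-sum {A = ℝ × I} cs (λ (c , i) → c • f i))

  _⊥ˢ : Subspace V k → Subspace V k
  (U ⊥ˢ) w = ∀ u → U u → ⟨ w , u ⟩ ≈ 0ℝ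

  ⨁[_] : ∀ {m} → Subset m → (Fin m → Subspace V k) → Subspace V k
  ⨁[_] {k} {m} J U w = Σ (Fin m → Weighting V k) λ v →
    (∀ h → h ∈ J → U h (v h)) × (∀ h → h ∉ J → v h ≋ 𝟎) × w ≋ ⊞-sum (allFin m) v

  IsDirectSum : ∀ {m} → (Fin m → Subspace V k) → Set
  IsDirectSum {k} {m} U =
      (∀ w → Σ (Fin m → Weighting V k) λ v → (∀ h → U h (v h)) × w ≋ ⊞-sum (allFin m) v)
    × (∀ (v v′ : Fin m → Weighting V k) → (∀ h → U h (v h)) → (∀ h → U h (v′ h)) →
         ⊞-sum (allFin m) v ≋ ⊞-sum (allFin m) v′ → ∀ h → v h ≋ v′ h)

𝕍 : (x y : Fin k → Fin n) → Fin (suc k) → Subspace (⊤ {n}) k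
𝕍 x y i = Span (λ π → permute π (φ x y i))

-- The index h : Fin k stands for h + 1, so for I : Subset k the set {0} ∪ I of
-- indices in {0 , … , k} is inside ∷ I.
IsPartition : ∀ {t} → (Fin t → Subset k) → Set
IsPartition I = (∀ h → ∃[ i ] (h ∈ I i)) × (∀ i j → i ≢ j → Empty (I i ∩ I j))

-- As a function of the set A, φᵢ is the product of the differences 1[xⱼ ∈ A] - 1[yⱼ ∈ A], a polynomial
-- of degree i that is antisymmetric in i disjoint pairs, while a monomial of degree less than i leaves
-- some of these pairs untouched; hence the spaces Vᵢ are pairwise orthogonal. They span because, modulo
-- products with one factor less, a factor 1[z ∈ A] is the average of the differences
-- 1[z ∈ A] - 1[y ∈ A] over the unused points y, so that the indicator of a single k-set reduces to
-- conjugates of the φᵢ. The i-th entry of the W-vector is a weighted sum of the numbers |⟨w, (φᵢ)_π⟩|,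
-- so it vanishes exactly when w is orthogonal to Vᵢ. For the last part, antisymmetrise w in i ≥ 1 pairs
-- and average over the permutations of the remaining points: disc(w, w′) = 0 becomes
-- ⟨w, (φᵢ)_π⟩ ⟨w′, (φᵢ)_σ⟩ = 0 for all π and σ, so every Vᵢ with i ≥ 1 is orthogonal to w or to w′.

module Submission where

open import Algebra.Bundles using (CommutativeRing)
import Algebra.Properties.Ring
import Algebra.Properties.Semiring.Mult
import Algebra.Solver.Ring
open import Algebra.Solver.Ring.AlmostCommutativeRing
  using (_-Raw-AlmostCommutative⟶_; fromCommutativeRing)
open import Algebra.Structures using (IsCommutativeRing)
open import Axiom.ExcludedMiddle using (ExcludedMiddle)
open import Data.Bool.Base using (Bool; true; false; not; if_then_else_)
open import Data.Bool.Properties using (not-involutive) renaming (_≟_ to _≟ᵇ_)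
open import Data.Fin.Base as Fin using (Fin; zero; suc; toℕ; punchIn)
open import Data.Fin.Permutation as Perm using (Permutation′; _⟨$⟩ʳ_; _∘ₚ_; flip)
import Data.Fin.Permutation.Components as PC
import Data.Fin.Properties as Fin
open import Data.Fin.Subset
  using (Subset; inside; outside; ∣_∣; ⊤; ⊥; _∈_; _∉_; _⊆_; _∪_; _∩_; _─_; ⁅_⁆; ⋃)
open import Data.Fin.Subset.Properties
  using (_∈?_; _⊆?_; ∈⊤; ∉⊥; ⊆-max; p─q⊆p; x∈p∧x∉q⇒x∈p─q; x∈p∪q⁻; x∈p∪q⁺; x∈p∩q⁻; x∈⁅x⁆; x∈⁅y⁆⇒x≡y;
         ∪-identityˡ; ∪-identityʳ; ∣p∣≤n; ∣⊥∣≡0; ∣⊤∣≡n; ∣⁅x⁆∣≡1; ∣p∩q∣≤∣q∣)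
import Data.Integer.Base as ℤ
import Data.Irrelevant as Irrelevant
open import Data.List.Base
  using (List; []; _∷_; _++_; map; length; filter; foldr; concatMap; tabulate; allFin)
import Data.List.Properties as List
open import Data.List.Membership.Propositional using (lose) renaming (_∈_ to _∈ˡ_)
import Data.List.Membership.Propositional.Properties as ∈ˡ
open import Data.List.Relation.Binary.Permutation.Propositional
  using (_↭_; ↭-refl; ↭-sym; ↭-trans; prep; ↭⇒↭ₛ)
import Data.List.Relation.Binary.Permutation.Propositional.Properties as ↭
import Data.List.Relation.Binary.Permutation.Setoid.Properties as ↭ₛ
open import Data.List.Relation.Unary.All as All using (All; []; _∷_)
import Data.List.Relation.Unary.All.Properties as All
open import Data.List.Relation.Unary.AllPairs using ([]; _∷_)
open import Data.List.Relation.Unary.Any using (here; there)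
open import Data.List.Relation.Unary.Unique.Propositional using (Unique)
import Data.List.Relation.Unary.Unique.Propositional.Properties as Unique
import Data.Maybe.Base as Maybe
open import Data.Nat.Base as ℕ using (ℕ; zero; z≤n; s≤s; _!; _≤_) renaming (_*_ to _*ℕ_)
open import Data.Nat.Combinatorics using (_C_; nCk+nC[k+1]≡[n+1]C[k+1]; nCk≡nC[n∸k]; nCn≡1)
import Data.Nat.Properties as ℕ
open import Data.Product.Base as Product using (Σ; ∃; _×_; _,_; proj₁; proj₂)
open import Data.Rational.Base as ℚ using (ℚ; 0ℚ; 1ℚ; ½)
import Data.Rational.Properties as ℚ
open import Data.Rational.Solver using (module +-*-Solver)
open import Data.Refinement using (Refinement; value; _,_)
open import Data.Sum.Base using (_⊎_; inj₁; inj₂; [_,_])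
open import Data.Vec.Base as Vec using (lookup; removeAt; updateAt; []; _∷_; here; there)
import Data.Vec.Properties as Vec
open import Function.Base using (_∘_; id)
open import Function.Bundles using (_⇔_; mk⇔; Injection)
open import Function.Definitions using (Injective)
open import Function.Properties.Inverse using (↔⇒↣)
open import Level using (0ℓ)
open import Relation.Binary.Definitions using (Tri; tri<; tri≈; tri>)
open import Relation.Binary.PropositionalEquality as ≡
  using (_≡_; _≢_; refl; cong; cong₂; subst)
import Relation.Binary.Reasoning.Setoid
open import Relation.Nullary using (¬_; Dec; yes; no; does; contradiction; contradiction-irr)
open import Relation.Nullary.Decidable
  using (_×-dec_; ¬?; dec-true; dec-false; dec⇒maybe; does-⇔; recompute)

open import Defs using (preimage; ∣preimage∣; permutations)

-- Discrepancies and W-vectors are both reduced to one condition, `Vanishes i w`: every product of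
-- differences over `i` disjoint pairs has zero pairing with `w`. The symmetric group is transitive
-- on such configurations, so this is orthogonality to `𝕍 x y i`, yet it no longer mentions the
-- chosen points. Weightings are extended by zero to all subsets of `Fin n`. Sums then split along
-- coordinates, and once a configuration has been moved to `standard`, a pair is peeled off as the
-- two leading coordinates; the restriction to k-sets survives as a weight depending on the
-- cardinality. The W-vector does not fit this scheme, since its ground sets shrink inside a fixed
-- `Fin n`; there a pair is removed by toggling its points. In part (e) the constant in the
-- discrepancy is unknown. Antisymmetrising in one pair removes it, which is why level 0 is exempt.
-- Equality of Cauchy reals is not decidable, so excluded middle supplies the absence of zero
-- divisors and, at each level, the choice between two weightings.

private variable
  n k : ℕ

-- Permutations and configurations of pairs

preimage-cong : {π ρ : Permutation′ n} → π Perm.≈ ρ → (A : Subset n) → preimage π A ≡ preimage ρ A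
preimage-cong π≈ρ A = Vec.tabulate-cong λ i → cong (lookup A) (π≈ρ i)

lookup-preimage : (π : Permutation′ n) (A : Subset n) (i : Fin n) →
                  lookup (preimage π A) i ≡ lookup A (π ⟨$⟩ʳ i)
lookup-preimage π A i = Vec.lookup∘tabulate _ i

preimage-∘ : (π ρ : Permutation′ n) (A : Subset n) →
             preimage π (preimage ρ A) ≡ preimage (π ∘ₚ ρ) A
preimage-∘ π ρ A = Vec.tabulate-cong λ i → lookup-preimage ρ A (π ⟨$⟩ʳ i)

preimage-id : (π : Permutation′ n) → (∀ i → π ⟨$⟩ʳ i ≡ i) → (A : Subset n) → preimage π A ≡ A
preimage-id π π≈id A =
  ≡.trans (Vec.tabulate-cong λ i → cong (lookup A) (π≈id i)) (Vec.tabulate∘lookup A)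

preimage-flipˡ : (π : Permutation′ n) (A : Subset n) → preimage (flip π) (preimage π A) ≡ A
preimage-flipˡ π A =
  ≡.trans (preimage-∘ (flip π) π A) (preimage-id (flip π ∘ₚ π) (λ _ → Perm.inverseʳ π) A)

preimage-flipʳ : (π : Permutation′ n) (A : Subset n) → preimage π (preimage (flip π) A) ≡ A
preimage-flipʳ π A =
  ≡.trans (preimage-∘ π (flip π) A) (preimage-id (π ∘ₚ flip π) (λ _ → Perm.inverseˡ π) A)

lookup-removeAt : (A : Subset (ℕ.suc n)) (j : Fin (ℕ.suc n)) (i : Fin n) →
                  lookup (removeAt A j) i ≡ lookup A (punchIn j i)
lookup-removeAt A j i = ≡.trans
  (cong (lookup (removeAt A j)) (≡.sym (Fin.punchOut-punchIn j)))
  (Vec.removeAt-punchOut A (Fin.punchInᵢ≢i j i ∘ ≡.sym))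

-- Matches the recursion of `permutations` with that of subsets: the bit of `A` at the image of zero
-- comes first, and a smaller permutation acts on the rest.
preimage-insert : (j : Fin (ℕ.suc n)) (π : Permutation′ n) (A : Subset (ℕ.suc n)) →
                  preimage (Perm.insert zero j π) A ≡ lookup A j ∷ preimage π (removeAt A j)
preimage-insert j π A = cong (lookup A j ∷_) (Vec.tabulate-cong λ i →
  ≡.sym (lookup-removeAt A j (π ⟨$⟩ʳ i)))

∣removeAt∣ : (A : Subset (ℕ.suc n)) (j : Fin (ℕ.suc n)) →
             ∣ A ∣ ≡ ∣ lookup A j ∷ removeAt A j ∣
∣removeAt∣ (a ∷ A) zero = refl
∣removeAt∣ (outside ∷ A@(_ ∷ _)) (Fin.suc j) with lookup A j | ∣removeAt∣ A j
... | outside | eq = eq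
... | inside  | eq = eq
∣removeAt∣ (inside ∷ A@(_ ∷ _)) (Fin.suc j) with lookup A j | ∣removeAt∣ A j
... | outside | eq = cong ℕ.suc eq
... | inside  | eq = cong ℕ.suc eq

-- Permutations are records of functions, so the enumeration is complete only up to pointwise
-- equality; `preimage` does not see the difference.
permutations-complete : (π : Permutation′ n) → ∃ λ ρ → ρ ∈ˡ permutations n × ρ Perm.≈ π
permutations-complete {zero}     π = Perm.id , here refl , λ ()
permutations-complete {ℕ.suc n} π =
  let ρ , ρ∈ , ρ≈ = permutations-complete (Perm.remove zero π)
      j = π ⟨$⟩ʳ zero
  in Perm.insert zero j ρ
   , ∈ˡ.∈-concatMap⁺ (λ j → map (Perm.insert zero j) (permutations n))
       (lose (∈ˡ.∈-allFin j) (∈ˡ.∈-map⁺ (Perm.insert zero j) ρ∈))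
   , λ { zero        → Perm.insert-remove zero π zero
       ; (Fin.suc i) → ≡.trans (cong (punchIn j) (ρ≈ i)) (Perm.insert-remove zero π (Fin.suc i)) }

transpose-minimal : {i j k : Fin n} → k ≢ i → k ≢ j → PC.transpose i j k ≡ k
transpose-minimal {i = i} {j} {k} k≢i k≢j
  rewrite dec-false (k Fin.≟ i) k≢i | dec-false (k Fin.≟ j) k≢j = refl

transpose-left : (i j : Fin n) → PC.transpose i j i ≡ j
transpose-left i j rewrite dec-true (i Fin.≟ i) refl = refl

extend-to-permutation : (xs ys : List (Fin n)) → length xs ≡ length ys → Unique xs → Unique ys →
                        ∃ λ (π : Permutation′ n) → map (π ⟨$⟩ʳ_) xs ≡ ys
extend-to-permutation [] [] _ _ _ = Perm.id , refl
extend-to-permutation (x ∷ xs) (y ∷ ys) eq (x∉xs ∷ xs!) (y∉ys ∷ ys!)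
  with ρ , refl ← extend-to-permutation xs ys (ℕ.suc-injective eq) xs! ys! =
    -- `ρ` already matches the tails. The transposition corrects the head and moves no image of the
    -- tail, since neither `ρ ⟨$⟩ʳ x` nor `y` occurs there.
    ρ ∘ₚ Perm.transpose (ρ ⟨$⟩ʳ x) y
  , cong₂ _∷_ (transpose-left (ρ ⟨$⟩ʳ x) y)
      (List.map-cong-local (All.zipWith
        (λ (x≢ , y≢) → transpose-minimal (x≢ ∘ ≡.sym ∘ Injection.injective (↔⇒↣ ρ)) (y≢ ∘ ≡.sym))
        (x∉xs , All.map⁻ y∉ys)))

Unique-resp-↭ : {xs ys : List (Fin n)} → xs ↭ ys → Unique xs → Unique ys
Unique-resp-↭ xs↭ys = ↭ₛ.Unique-resp-↭ (≡.setoid _) (↭⇒↭ₛ xs↭ys)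

complement : (xs zs : List (Fin n)) → Unique xs → All (_∈ˡ zs) xs → ∃ λ ys → xs ++ ys ↭ zs
complement [] zs _ _ = zs , ↭-refl
complement (x ∷ xs) zs (x∉xs ∷ xs!) (x∈zs ∷ xs⊆zs)
  with us , vs , refl ← ∈ˡ.∈-∃++ x∈zs =
  let ys , xs++ys↭ = complement xs (us ++ vs) xs! (All.zipWith (λ (x≢ , z∈) → drop-≢ x≢ z∈) (x∉xs , xs⊆zs))
  in ys , ↭-trans (prep x xs++ys↭) (↭-sym (↭.shift x us vs))
  where
  drop-≢ : ∀ {z} → x ≢ z → z ∈ˡ us ++ x ∷ vs → z ∈ˡ us ++ vs
  drop-≢ x≢z z∈ with ∈ˡ.∈-++⁻ us z∈
  ... | inj₁ z∈us         = ∈ˡ.∈-++⁺ˡ z∈us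
  ... | inj₂ (here z≡x)   = contradiction (≡.sym z≡x) x≢z
  ... | inj₂ (there z∈vs) = ∈ˡ.∈-++⁺ʳ us z∈vs

complement-allFin : (xs : List (Fin n)) → Unique xs → ∃ λ ys → xs ++ ys ↭ allFin n
complement-allFin xs xs! = complement xs _ xs! (All.tabulate λ {x} _ → ∈ˡ.∈-allFin x)

Unique⇒length≤ : (xs : List (Fin n)) → Unique xs → length xs ℕ.≤ n
Unique⇒length≤ {n} xs xs! with ys , xs++ys↭ ← complement-allFin xs xs! =
  subst (length xs ℕ.≤_)
    (≡.trans (≡.sym (List.length-++ xs)) (≡.trans (↭.↭-length xs++ys↭) (List.length-tabulate {n = n} id)))
    (ℕ.m≤m+n (length xs) (length ys))

Pairs : ℕ → Set
Pairs n = List (Fin n × Fin n)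

points : Pairs n → List (Fin n)
points []            = []
points ((x , y) ∷ L) = x ∷ y ∷ points L

mapPairs : ∀ {m} → (Fin n → Fin m) → Pairs n → Pairs m
mapPairs f = map (Product.map f f)

length-points : (L : Pairs n) → length (points L) ≡ length L ℕ.* 2
length-points []      = refl
length-points (_ ∷ L) = cong (ℕ.suc ∘ ℕ.suc) (length-points L)

points-map : ∀ {m} (f : Fin n → Fin m) (L : Pairs n) → points (mapPairs f L) ≡ map f (points L)
points-map f []            = refl
points-map f ((x , y) ∷ L) = cong (λ zs → f x ∷ f y ∷ zs) (points-map f L)

points-injective : (L L′ : Pairs n) → points L ≡ points L′ → L ≡ L′
points-injective []            []              eq = refl
points-injective ((x , y) ∷ L) ((x′ , y′) ∷ L′) eq =
  cong₂ _∷_ (cong₂ _,_ (List.∷-injectiveˡ eq) (List.∷-injectiveˡ (List.∷-injectiveʳ eq)))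
    (points-injective L L′ (List.∷-injectiveʳ (List.∷-injectiveʳ eq)))

-- This makes the spans independent of the chosen points and allows any configuration to be replaced
-- by `standard`. It suffices to match the flattened lists of points, as the pairs are recovered by
-- position.
transitive : (L L′ : Pairs n) → length L ≡ length L′ → Unique (points L) → Unique (points L′) →
             ∃ λ (π : Permutation′ n) → mapPairs (π ⟨$⟩ʳ_) L ≡ L′
transitive L L′ eq L! L′! =
  let π , πL≡L′ = extend-to-permutation (points L) (points L′)
        (≡.trans (length-points L) (≡.trans (cong (ℕ._* 2) eq) (≡.sym (length-points L′)))) L! L′!
  in π , points-injective _ L′ (≡.trans (points-map (π ⟨$⟩ʳ_) L) πL≡L′)

Unique-mapPairs : ∀ {m} {f : Fin n → Fin m} → (∀ {i j} → f i ≡ f j → i ≡ j) →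
                  (L : Pairs n) → Unique (points L) → Unique (points (mapPairs f L))
Unique-mapPairs {f = f} f-inj L L! =
  subst Unique (≡.sym (points-map f L)) (Unique.map⁺ f-inj L!)

-- The ground set of the standard configuration: the j pairs {0,1}, {2,3}, … and m further points.
twice_plus_ : ℕ → ℕ → ℕ
twice zero    plus m = m
twice ℕ.suc j plus m = ℕ.suc (ℕ.suc (twice j plus m))

standard : ∀ j m → Pairs (twice j plus m)
standard zero      m = []
standard (ℕ.suc j) m = (zero , Fin.suc zero) ∷ mapPairs (Fin.suc ∘ Fin.suc) (standard j m)

length-standard : ∀ j m → length (standard j m) ≡ j
length-standard zero      m = refl
length-standard (ℕ.suc j) m = cong ℕ.suc (≡.trans (List.length-map _ (standard j m)) (length-standard j m))

standard-Unique : ∀ j m → Unique (points (standard j m))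
standard-Unique zero      m = []
standard-Unique (ℕ.suc j) m
  rewrite points-map (Fin.suc ∘ Fin.suc) (standard j m) =
    ((λ ()) ∷ All.map⁺ (All.universal (λ _ ()) _))
  ∷ All.map⁺ (All.universal (λ _ ()) _)
  ∷ Unique.map⁺ (Fin.suc-injective ∘ Fin.suc-injective) (standard-Unique j m)

twice-plus : ∀ j {n} → j ℕ.* 2 ℕ.≤ n → ∃ λ m → n ≡ twice j plus m
twice-plus zero      {n} _ = n , refl
twice-plus (ℕ.suc j) (s≤s (s≤s 2j≤n)) with m , refl ← twice-plus j 2j≤n = m , refl

elements : Subset n → List (Fin n)
elements []            = []
elements (outside ∷ A) = map Fin.suc (elements A)
elements (inside  ∷ A) = zero ∷ map Fin.suc (elements A)

elements-Unique : (A : Subset n) → Unique (elements A)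
elements-Unique []            = []
elements-Unique (outside ∷ A) = Unique.map⁺ Fin.suc-injective (elements-Unique A)
elements-Unique (inside  ∷ A) =
  All.map⁺ (All.universal (λ _ ()) _) ∷ Unique.map⁺ Fin.suc-injective (elements-Unique A)

length-elements : (A : Subset n) → length (elements A) ≡ ∣ A ∣
length-elements []            = refl
length-elements (outside ∷ A) = ≡.trans (List.length-map Fin.suc (elements A)) (length-elements A)
length-elements (inside  ∷ A) =
  cong ℕ.suc (≡.trans (List.length-map Fin.suc (elements A)) (length-elements A))

toggle : Fin n → Subset n → Subset n
toggle x A = updateAt A x not

toggle-involutive : (x : Fin n) (A : Subset n) → toggle x (toggle x A) ≡ A
toggle-involutive x A =
  ≡.trans (Vec.updateAt-updateAt x A) (Vec.updateAt-id-local x A (not-involutive _))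

-- Sums over all subsets

module SubsetSums (R : CommutativeRing 0ℓ 0ℓ)
  (ι : ℚ.+-*-rawRing -Raw-AlmostCommutative⟶ fromCommutativeRing R) where

  open CommutativeRing R hiding (zero)
    renaming (refl to ≈-refl; sym to ≈-sym; trans to ≈-trans; reflexive to ≈-reflexive)
  open _-Raw-AlmostCommutative⟶_ ι using (⟦_⟧)
  open Algebra.Properties.Semiring.Mult semiring
    using (×-congʳ; ×-assoc-*; ×-assocˡ) renaming (_×_ to _⋆_)
  open Algebra.Solver.Ring ℚ.+-*-rawRing (fromCommutativeRing R) ι
    (λ p q → Maybe.map (λ p≡q → ≈-reflexive (cong ⟦_⟧ p≡q)) (dec⇒maybe (p ℚ.≟ q)))
    using (solve; con; _:+_; _:*_; _:-_; :-_; _:=_)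
  open Algebra.Properties.Ring ring using (-0#≈0#)
  open Relation.Binary.Reasoning.Setoid setoid

  sum : {X : Set} → List X → (X → Carrier) → Carrier
  sum xs f = foldr (λ x s → f x + s) 0# xs

  sum-cong : {X : Set} (xs : List X) {f g : X → Carrier} → (∀ x → f x ≈ g x) → sum xs f ≈ sum xs g
  sum-cong []       f≈g = ≈-refl
  sum-cong (x ∷ xs) f≈g = +-cong (f≈g x) (sum-cong xs f≈g)

  sum-0 : {X : Set} (xs : List X) {f : X → Carrier} → (∀ x → f x ≈ 0#) → sum xs f ≈ 0#
  sum-0 []       f≈0 = ≈-refl
  sum-0 (x ∷ xs) f≈0 = ≈-trans (+-cong (f≈0 x) (sum-0 xs f≈0)) (+-identityˡ 0#)

  sum-++ : {X : Set} (xs ys : List X) (f : X → Carrier) → sum (xs ++ ys) f ≈ sum xs f + sum ys f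
  sum-++ []       ys f = ≈-sym (+-identityˡ _)
  sum-++ (x ∷ xs) ys f = ≈-trans (+-congˡ (sum-++ xs ys f)) (≈-sym (+-assoc _ _ _))

  sum-map : {X Y : Set} (h : X → Y) (xs : List X) (f : Y → Carrier) → sum (map h xs) f ≈ sum xs (f ∘ h)
  sum-map h []       f = ≈-refl
  sum-map h (x ∷ xs) f = +-congˡ (sum-map h xs f)

  sum-concatMap : {X Y : Set} (h : X → List Y) (xs : List X) (f : Y → Carrier) →
                  sum (concatMap h xs) f ≈ sum xs (λ x → sum (h x) f)
  sum-concatMap h []       f = ≈-refl
  sum-concatMap h (x ∷ xs) f = ≈-trans (sum-++ (h x) _ f) (+-congˡ (sum-concatMap h xs f))

  interchange : ∀ a b c d → (a + b) + (c + d) ≈ (a + c) + (b + d)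
  interchange = solve 4 (λ a b c d → (a :+ b) :+ (c :+ d) := (a :+ c) :+ (b :+ d)) ≈-refl

  sum-+ : {X : Set} (xs : List X) (f g : X → Carrier) →
          sum xs (λ x → f x + g x) ≈ sum xs f + sum xs g
  sum-+ []       f g = ≈-sym (+-identityˡ 0#)
  sum-+ (x ∷ xs) f g = ≈-trans (+-congˡ (sum-+ xs f g)) (interchange _ _ _ _)

  sum-* : {X : Set} (xs : List X) (c : Carrier) (f : X → Carrier) →
          sum xs (λ x → c * f x) ≈ c * sum xs f
  sum-* []       c f = ≈-sym (zeroʳ c)
  sum-* (x ∷ xs) c f = ≈-trans (+-congˡ (sum-* xs c f)) (≈-sym (distribˡ c _ _))

  sum-↭ : {X : Set} {xs ys : List X} → xs ↭ ys → (f : X → Carrier) → sum xs f ≈ sum ys f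
  sum-↭ _↭_.refl              f = ≈-refl
  sum-↭ (prep x xs↭ys)      f = +-congˡ (sum-↭ xs↭ys f)
  sum-↭ (_↭_.swap x y xs↭ys) f = ≈-trans (+-congˡ (+-congˡ (sum-↭ xs↭ys f)))
    (solve 3 (λ a b c → a :+ (b :+ c) := b :+ (a :+ c)) ≈-refl (f x) (f y) _)
  sum-↭ (_↭_.trans p q)     f = ≈-trans (sum-↭ p f) (sum-↭ q f)

  sum-single : {X : Set} {m : ℕ} (f : Fin m → X) (g : X → Carrier) (i : Fin m) →
               (∀ j → j ≢ i → g (f j) ≈ 0#) → sum (tabulate f) g ≈ g (f i)
  sum-single f g zero g≈0 = ≈-trans (+-congˡ (sum-tabulate-0 (f ∘ Fin.suc) (λ j → g≈0 (Fin.suc j) λ ())))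
    (+-identityʳ (g (f zero)))
    where
    sum-tabulate-0 : ∀ {m} (f : Fin m → _) → (∀ j → g (f j) ≈ 0#) → sum (tabulate f) g ≈ 0#
    sum-tabulate-0 {zero}    f g≈0 = ≈-refl
    sum-tabulate-0 {ℕ.suc m} f g≈0 =
      ≈-trans (+-cong (g≈0 zero) (sum-tabulate-0 (f ∘ Fin.suc) (g≈0 ∘ Fin.suc))) (+-identityˡ 0#)
  sum-single f g (Fin.suc i) g≈0 = ≈-trans (+-congʳ (g≈0 zero λ ()))
    (≈-trans (+-identityˡ _) (sum-single (f ∘ Fin.suc) g i λ j j≢i → g≈0 (Fin.suc j) (j≢i ∘ Fin.suc-injective)))

  -- Recursive rather than a sum over a list: on `twice ℕ.suc j plus m` it unfolds to four blocks,
  -- one for each way a set can meet the leading pair.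
  S : (Subset n → Carrier) → Carrier
  S {zero}    F = F []
  S {ℕ.suc n} F = S (F ∘ (outside ∷_)) + S (F ∘ (inside ∷_))

  S-cong : {F G : Subset n → Carrier} → (∀ A → F A ≈ G A) → S F ≈ S G
  S-cong {zero}    F≈G = F≈G []
  S-cong {ℕ.suc n} F≈G = +-cong (S-cong (F≈G ∘ (outside ∷_))) (S-cong (F≈G ∘ (inside ∷_)))

  S-+ : (F G : Subset n → Carrier) → S (λ A → F A + G A) ≈ S F + S G
  S-+ {zero}    F G = ≈-refl
  S-+ {ℕ.suc n} F G = ≈-trans (+-cong (S-+ {n} _ _) (S-+ {n} _ _)) (interchange _ _ _ _)

  S-* : (c : Carrier) (F : Subset n → Carrier) → S (λ A → c * F A) ≈ c * S F
  S-* {zero}    c F = ≈-refl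
  S-* {ℕ.suc n} c F = ≈-trans (+-cong (S-* {n} c _) (S-* {n} c _)) (≈-sym (distribˡ c _ _))

  S-0 : {F : Subset n → Carrier} → (∀ A → F A ≈ 0#) → S F ≈ 0#
  S-0 {zero}    F≈0 = F≈0 []
  S-0 {ℕ.suc n} F≈0 = ≈-trans (+-cong (S-0 (F≈0 ∘ (outside ∷_))) (S-0 (F≈0 ∘ (inside ∷_)))) (+-identityˡ 0#)

  S-minus : (F G : Subset n → Carrier) → S (λ A → F A - G A) ≈ S F - S G
  S-minus F G = begin
    S (λ A → F A - G A)                ≈⟨ S-cong (λ A → lemma (F A) (G A)) ⟩
    S (λ A → F A + - 1# * G A)         ≈⟨ S-+ F (λ A → - 1# * G A) ⟩
    S F + S (λ A → - 1# * G A)         ≈⟨ +-congˡ (S-* (- 1#) G) ⟩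
    S F + - 1# * S G                   ≈⟨ lemma (S F) (S G) ⟨
    S F - S G                          ∎
    where
    lemma : ∀ a b → a - b ≈ a + - 1# * b
    lemma a b = ≈-trans (solve 2 (λ a b → a :- b := a :+ (:- con 1ℚ) :* b) ≈-refl a b)
      (+-congˡ (*-congʳ (-‿cong (_-Raw-AlmostCommutative⟶_.1-homo ι))))

  S-swap : ∀ {m n} (F : Subset m → Subset n → Carrier) →
           S (λ A → S (λ B → F A B)) ≈ S (λ B → S (λ A → F A B))
  S-swap {zero}    F = ≈-refl
  S-swap {ℕ.suc m} F = ≈-trans (+-cong (S-swap (F ∘ (outside ∷_))) (S-swap (F ∘ (inside ∷_))))
    (≈-sym (S-+ (λ B → S (λ A → F (outside ∷ A) B)) _))

  S-sum : {X : Set} (xs : List X) (F : X → Subset n → Carrier) →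
          sum xs (λ x → S (F x)) ≈ S (λ A → sum xs (λ x → F x A))
  S-sum {n} []       F = ≈-sym (S-0 {n} {λ _ → 0#} (λ _ → ≈-refl))
  S-sum (x ∷ xs) F = ≈-trans (+-congˡ (S-sum xs F)) (≈-sym (S-+ (F x) _))

  𝟙 : Bool → Carrier
  𝟙 true  = 1#
  𝟙 false = 0#

  𝟙-idem : ∀ a → 𝟙 a * 𝟙 a ≈ 𝟙 a
  𝟙-idem true  = *-identityˡ _
  𝟙-idem false = zeroˡ _

  δ : Subset n → Subset n → Carrier
  δ A B = 𝟙 (does (Vec.≡-dec _≟ᵇ_ A B))

  S-δ : (A : Subset n) (F : Subset n → Carrier) → S (λ B → δ A B * F B) ≈ F A
  S-δ []            F = *-identityˡ _
  S-δ (outside ∷ A) F = ≈-trans (+-cong (S-δ A _) (S-0 {F = λ B → 0# * F (inside ∷ B)} (λ _ → zeroˡ _))) (+-identityʳ _)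
  S-δ (inside ∷ A)  F = ≈-trans (+-cong (S-0 {F = λ B → 0# * F (outside ∷ B)} (λ _ → zeroˡ _)) (S-δ A _)) (+-identityˡ _)

  -- Inserting the Kronecker delta turns reindexing into an exchange of two sums, since `f A` is `B`
  -- exactly when `g B` is `A`.
  S-bijection : (f g : Subset n → Subset n) → (∀ A → g (f A) ≡ A) → (∀ B → f (g B) ≡ B) →
                (F : Subset n → Carrier) → S (F ∘ f) ≈ S F
  S-bijection f g gf fg F = begin
    S (λ A → F (f A))                        ≈⟨ S-cong (λ A → S-δ (f A) F) ⟨
    S (λ A → S (λ B → δ (f A) B * F B))      ≈⟨ S-swap (λ A B → δ (f A) B * F B) ⟩
    S (λ B → S (λ A → δ (f A) B * F B))      ≈⟨ S-cong (λ B → S-cong (λ A → *-congʳ (≈-reflexive (δ-adjoint A B)))) ⟩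
    S (λ B → S (λ A → δ (g B) A * F B))      ≈⟨ S-cong (λ B → S-δ (g B) (λ _ → F B)) ⟩
    S F                                      ∎
    where
    δ-adjoint : ∀ A B → δ (f A) B ≡ δ (g B) A
    δ-adjoint A B = cong 𝟙 (does-⇔
      (mk⇔ (λ { refl → gf A }) (λ { refl → fg B })) (Vec.≡-dec _≟ᵇ_ (f A) B) (Vec.≡-dec _≟ᵇ_ (g B) A))

  S-preimage : (π : Permutation′ n) (F : Subset n → Carrier) → S (F ∘ preimage π) ≈ S F
  S-preimage π = S-bijection (preimage π) (preimage (flip π)) (preimage-flipˡ π) (preimage-flipʳ π)

  S-toggle : (x : Fin n) (F : Subset n → Carrier) → S (F ∘ toggle x) ≈ S F
  S-toggle x = S-bijection (toggle x) (toggle x) (toggle-involutive x) (toggle-involutive x)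

  -- D ((x₁ , y₁) ∷ … ∷ (xᵢ , yᵢ) ∷ []) is φᵢ, written as the product of the differences 1_{xⱼ} - 1_{yⱼ}.
  D : Pairs n → Subset n → Carrier
  D []            A = 1#
  D ((x , y) ∷ L) A = (𝟙 (lookup A x) - 𝟙 (lookup A y)) * D L A

  M : List (Fin n) → Subset n → Carrier
  M []       A = 1#
  M (z ∷ zs) A = 𝟙 (lookup A z) * M zs A

  D-local : (L : Pairs n) {A B : Subset n} → All (λ z → lookup A z ≡ lookup B z) (points L) → D L A ≡ D L B
  D-local []            []              = refl
  D-local ((x , y) ∷ L) (eqx ∷ eqy ∷ eqs) =
    cong₂ _*_ (cong₂ (λ a b → 𝟙 a - 𝟙 b) eqx eqy) (D-local L eqs)

  D-preimage : (π : Permutation′ n) (L : Pairs n) (A : Subset n) →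
               D L (preimage π A) ≡ D (mapPairs (π ⟨$⟩ʳ_) L) A
  D-preimage π []            A = refl
  D-preimage π ((x , y) ∷ L) A = cong₂ _*_
    (cong₂ (λ a b → 𝟙 a - 𝟙 b) (lookup-preimage π A x) (lookup-preimage π A y)) (D-preimage π L A)

  D-suc² : (L : Pairs n) (a b : Bool) (A : Subset n) →
           D (mapPairs (Fin.suc ∘ Fin.suc) L) (a ∷ b ∷ A) ≡ D L A
  D-suc² []            a b A = refl
  D-suc² ((x , y) ∷ L) a b A = cong (_ *_) (D-suc² L a b A)

  M-suc : (zs : List (Fin n)) (a : Bool) (A : Subset n) → M (map Fin.suc zs) (a ∷ A) ≡ M zs A
  M-suc []       a A = refl
  M-suc (z ∷ zs) a A = cong (_ *_) (M-suc zs a A)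

  -- Monomials, and the orthogonality of products of differences to lower degrees

  contains : Subset n → Subset n → Carrier
  contains []            []      = 1#
  contains (outside ∷ B) (a ∷ A) = contains B A
  contains (inside ∷ B)  (a ∷ A) = 𝟙 a * contains B A

  insert : Fin n → Subset n → Subset n
  insert x B = B Vec.[ x ]≔ inside

  -- Coordinates are idempotent, so multiplying by one keeps the monomial squarefree and raises its
  -- degree by at most one.
  contains-insert : (x : Fin n) (B A : Subset n) →
                    𝟙 (lookup A x) * contains B A ≈ contains (insert x B) A
  contains-insert zero        (outside ∷ B) (a ∷ A) = ≈-refl
  contains-insert zero        (inside ∷ B)  (a ∷ A) =
    ≈-trans (≈-sym (*-assoc _ _ _)) (*-congʳ (𝟙-idem a))
  contains-insert (Fin.suc x) (outside ∷ B) (a ∷ A) = contains-insert x B A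
  contains-insert (Fin.suc x) (inside ∷ B)  (a ∷ A) = begin
    𝟙 (lookup A x) * (𝟙 a * contains B A)  ≈⟨ solve 3 (λ x y z → x :* (y :* z) := y :* (x :* z)) ≈-refl _ _ _ ⟩
    𝟙 a * (𝟙 (lookup A x) * contains B A)  ≈⟨ *-congˡ (contains-insert x B A) ⟩
    𝟙 a * contains (insert x B) A          ∎

  ∣insert∣≤ : (x : Fin n) (B : Subset n) → ∣ insert x B ∣ ℕ.≤ ℕ.suc ∣ B ∣
  ∣insert∣≤ zero        (outside ∷ B) = ℕ.≤-refl
  ∣insert∣≤ zero        (inside ∷ B)  = ℕ.n≤1+n _
  ∣insert∣≤ (Fin.suc x) (outside ∷ B) = ∣insert∣≤ x B
  ∣insert∣≤ (Fin.suc x) (inside ∷ B)  = s≤s (∣insert∣≤ x B)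

  contains-elements : (B A : Subset n) → contains B A ≈ M (elements B) A
  contains-elements []            []      = ≈-refl
  contains-elements (outside ∷ B) (a ∷ A) =
    ≈-trans (contains-elements B A) (≈-sym (≈-reflexive (M-suc (elements B) a A)))
  contains-elements (inside ∷ B)  (a ∷ A) =
    *-congˡ (≈-trans (contains-elements B A) (≈-sym (≈-reflexive (M-suc (elements B) a A))))

  -- A set no larger than `B` can contain `B` only by being equal to it; so among k-sets the
  -- monomial of a k-set is its indicator function.
  contains-δ : (B A : Subset n) → ∣ A ∣ ℕ.≤ ∣ B ∣ → contains B A ≈ δ A B
  contains-δ []            []            _     = ≈-refl
  contains-δ (outside ∷ B) (outside ∷ A) A≤B   = contains-δ B A A≤B
  contains-δ (outside ∷ B) (inside ∷ A)  A<B   =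
    ≈-trans (contains-δ B A (ℕ.<⇒≤ A<B))
      (≈-reflexive (cong 𝟙 (dec-false (Vec.≡-dec _≟ᵇ_ A B) λ { refl → ℕ.<-irrefl refl A<B })))
  contains-δ (inside ∷ B)  (outside ∷ A) _     = zeroˡ _
  contains-δ (inside ∷ B)  (inside ∷ A)  (s≤s A≤B) = ≈-trans (*-identityˡ _) (contains-δ B A A≤B)

  contains-⊥ : (A : Subset n) → contains ⊥ A ≈ 1#
  contains-⊥ []      = ≈-refl
  contains-⊥ (a ∷ A) = contains-⊥ A

  factor : Bool → Bool → Carrier
  factor outside a = 1#
  factor inside  a = 𝟙 a

  contains-∷ : (b a : Bool) (B A : Subset n) → contains (b ∷ B) (a ∷ A) ≈ factor b a * contains B A
  contains-∷ outside a B A = ≈-sym (*-identityˡ _)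
  contains-∷ inside  a B A = ≈-refl

  -- The contribution of the leading pair: `a` and `b` tell which of its points lie in the set, `s`
  -- and `t` which of them occur in the monomial.
  coefficient : Bool → Bool → Bool → Bool → Carrier
  coefficient s t a b = (𝟙 a - 𝟙 b) * (factor s a * factor t b)

  pair-sum : Bool → Bool → (ℕ → Carrier) → Carrier
  pair-sum s t X =
    (coefficient s t outside outside * X 0 + coefficient s t outside inside * X 1)
    + (coefficient s t inside outside * X 1 + coefficient s t inside inside * X 2)

  -- The mixed blocks carry the same `X 1`, because the weight sees only the cardinality, and enter
  -- with opposite signs; the other two have coefficient zero.
  pair-sum-cancels : ∀ X → pair-sum outside outside X ≈ 0#
  pair-sum-cancels X = ≈-trans
    (solve 5 (λ z u x y w → (((z :- z) :* (u :* u)) :* x :+ ((z :- u) :* (u :* u)) :* y)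
                         :+ (((u :- z) :* (u :* u)) :* y :+ ((u :- u) :* (u :* u)) :* w) := z :- z)
      ≈-refl 0# 1# (X 0) (X 1) (X 2))
    (-‿inverseʳ 0#)

  pair-sum-0 : ∀ s t {X} → (∀ i → X i ≈ 0#) → pair-sum s t X ≈ 0#
  pair-sum-0 s t {X} X≈0 = ≈-trans (+-cong (zeros _ _ 0 1) (zeros _ _ 1 2)) (+-identityˡ 0#)
    where
    zeros : ∀ c d i j → c * X i + d * X j ≈ 0#
    zeros c d i j = ≈-trans
      (+-cong (≈-trans (*-congˡ (X≈0 i)) (zeroʳ c)) (≈-trans (*-congˡ (X≈0 j)) (zeroʳ d)))
      (+-identityˡ 0#)

  -- If the monomial misses the leading pair, exchanging its two points changes the sign and the
  -- blocks cancel. Otherwise fewer than `j` points are left for the remaining `j` pairs, and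
  -- induction applies. The weight `g` is arbitrary so that it can encode the restriction to one
  -- cardinality and absorb the shift by the points peeled off.
  orthogonal-contains : ∀ j m (g : ℕ → Carrier) (B : Subset (twice j plus m)) → ∣ B ∣ ℕ.< j →
                        S (λ A → g ∣ A ∣ * (D (standard j m) A * contains B A)) ≈ 0#
  orthogonal-contains (ℕ.suc j) m g (s ∷ t ∷ B) B<j = ≈-trans
    (+-cong (+-cong (part outside outside 0 λ _ → refl) (part outside inside 1 λ _ → refl))
            (+-cong (part inside outside 1 λ _ → refl) (part inside inside 2 λ _ → refl)))
    (cancel s t B<j)
    where
    X : ℕ → Carrier
    X i = S (λ A → g (i ℕ.+ ∣ A ∣) * (D (standard j m) A * contains B A))

    part : ∀ a b i → (∀ (A : Subset (twice j plus m)) → ∣ a ∷ b ∷ A ∣ ≡ i ℕ.+ ∣ A ∣) →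
           S (λ A → g ∣ a ∷ b ∷ A ∣ * (D (standard (ℕ.suc j) m) (a ∷ b ∷ A) * contains (s ∷ t ∷ B) (a ∷ b ∷ A)))
           ≈ coefficient s t a b * X i
    part a b i size = ≈-trans
      (S-cong {twice j plus m} λ A → begin
        g ∣ a ∷ b ∷ A ∣ * (((𝟙 a - 𝟙 b) * D (mapPairs (Fin.suc ∘ Fin.suc) (standard j m)) (a ∷ b ∷ A))
          * contains (s ∷ t ∷ B) (a ∷ b ∷ A))
          ≈⟨ *-cong (≈-reflexive (cong g (size A)))
               (*-cong (*-congˡ (≈-reflexive (D-suc² (standard j m) a b A)))
                 (≈-trans (contains-∷ s a (t ∷ B) (b ∷ A)) (*-congˡ (contains-∷ t b B A)))) ⟩
        g (i ℕ.+ ∣ A ∣) * (((𝟙 a - 𝟙 b) * D (standard j m) A) * (factor s a * (factor t b * contains B A)))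
          ≈⟨ solve 6 (λ g d D f f′ c → g :* ((d :* D) :* (f :* (f′ :* c))) := (d :* (f :* f′)) :* (g :* (D :* c)))
               ≈-refl _ _ _ _ _ _ ⟩
        coefficient s t a b * (g (i ℕ.+ ∣ A ∣) * (D (standard j m) A * contains B A)) ∎)
      (S-* {twice j plus m} (coefficient s t a b) _)

    X≈0 : ∣ B ∣ ℕ.< j → ∀ i → X i ≈ 0#
    X≈0 B<j i = orthogonal-contains j m (λ r → g (i ℕ.+ r)) B B<j

    cancel : ∀ s t → ∣ s ∷ t ∷ B ∣ ℕ.< ℕ.suc j → pair-sum s t X ≈ 0#
    cancel outside outside _         = pair-sum-cancels X
    cancel inside  outside (s≤s B<j) = pair-sum-0 inside outside (X≈0 B<j)
    cancel outside inside  (s≤s B<j) = pair-sum-0 outside inside (X≈0 B<j)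
    cancel inside  inside  (s≤s B<j) = pair-sum-0 inside inside (X≈0 (ℕ.<⇒≤ B<j))

  -- Expands `D P` factor by factor into monomials. Each factor becomes at most one further point of
  -- `B`, so the sum of `∣ B ∣` and `length P` never grows and stays below `j`.
  orthogonal-standard : ∀ j m (g : ℕ → Carrier) (P : Pairs (twice j plus m)) (B : Subset (twice j plus m)) →
    ∣ B ∣ ℕ.+ length P ℕ.< j →
    S (λ A → g ∣ A ∣ * (D (standard j m) A * (contains B A * D P A))) ≈ 0#
  orthogonal-standard j m g [] B small = ≈-trans
    (S-cong {twice j plus m} λ A → *-congˡ (*-congˡ (*-identityʳ _)))
    (orthogonal-contains j m g B (subst (ℕ._< j) (ℕ.+-identityʳ ∣ B ∣) small))
  orthogonal-standard j m g ((x , y) ∷ P) B small = begin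
    S (λ A → g ∣ A ∣ * (D (standard j m) A * (contains B A * ((𝟙 (lookup A x) - 𝟙 (lookup A y)) * D P A))))
      ≈⟨ S-cong {twice j plus m} (λ A → begin
        g ∣ A ∣ * (D (standard j m) A * (contains B A * ((𝟙 (lookup A x) - 𝟙 (lookup A y)) * D P A)))
          ≈⟨ solve 6 (λ g D c a b d → g :* (D :* (c :* ((a :- b) :* d)))
                       := g :* (D :* ((a :* c) :* d)) :- g :* (D :* ((b :* c) :* d))) ≈-refl _ _ _ _ _ _ ⟩
        term (λ A → 𝟙 (lookup A x) * contains B A) A - term (λ A → 𝟙 (lookup A y) * contains B A) A
          ≈⟨ +-cong (term-cong (contains-insert x B) A) (-‿cong (term-cong (contains-insert y B) A)) ⟩
        term (contains (insert x B)) A - term (contains (insert y B)) A ∎) ⟩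
    S (λ A → term (contains (insert x B)) A - term (contains (insert y B)) A)
      ≈⟨ S-minus {twice j plus m} (term (contains (insert x B))) (term (contains (insert y B))) ⟩
    S (term (contains (insert x B))) - S (term (contains (insert y B)))
      ≈⟨ +-cong (step x) (-‿cong (step y)) ⟩
    0# - 0#
      ≈⟨ -‿inverseʳ 0# ⟩
    0# ∎
    where
    term : (Subset (twice j plus m) → Carrier) → Subset (twice j plus m) → Carrier
    term c A = g ∣ A ∣ * (D (standard j m) A * (c A * D P A))

    term-cong : ∀ {c c′} → (∀ A → c A ≈ c′ A) → ∀ A → term c A ≈ term c′ A
    term-cong c≈c′ A = *-congˡ (*-congˡ (*-congʳ (c≈c′ A)))

    step : ∀ z → S (term (contains (insert z B))) ≈ 0#
    step z = orthogonal-standard j m g P (insert z B) (ℕ.≤-<-trans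
      (ℕ.≤-trans (ℕ.+-monoˡ-≤ (length P) (∣insert∣≤ z B)) (ℕ.≤-reflexive (≡.sym (ℕ.+-suc ∣ B ∣ (length P)))))
      small)

  pairs-standard : (L : Pairs n) → Unique (points L) → ∃ λ m → n ≡ twice length L plus m
  pairs-standard L L! = twice-plus (length L) (subst (ℕ._≤ _) (length-points L) (Unique⇒length≤ (points L) L!))

  -- The longer configuration is moved to `standard`; `P` is carried along by the inverse
  -- permutation, enters only as a polynomial of smaller degree, and may overlap `L` in any way.
  orthogonal : (g : ℕ → Carrier) (P L : Pairs n) → Unique (points L) → length P ℕ.< length L →
               S (λ A → g ∣ A ∣ * (D P A * D L A)) ≈ 0#
  orthogonal g P L L! P<L = let m , n≡ = pairs-standard L L! in go (length L) m n≡ P L refl L! P<L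
    where
    go : ∀ j m {n} → n ≡ twice j plus m → (P L : Pairs n) → length L ≡ j → Unique (points L) →
         length P ℕ.< j → S (λ A → g ∣ A ∣ * (D P A * D L A)) ≈ 0#
    go j m refl P L len L! P<j
      with π , refl ← transitive (standard j m) L (≡.trans (length-standard j m) (≡.sym len))
                        (standard-Unique j m) L! = begin
      S (λ A → g ∣ A ∣ * (D P A * D L A))   ≈⟨ S-cong {twice j plus m} move ⟩
      S (F ∘ preimage π)                    ≈⟨ S-preimage π F ⟩
      S F                                   ≈⟨ orthogonal-standard j m g P′ ⊥ small ⟩
      0#                                    ∎
      where
      P′ = mapPairs (flip π ⟨$⟩ʳ_) P

      F : Subset (twice j plus m) → Carrier
      F A = g ∣ A ∣ * (D (standard j m) A * (contains ⊥ A * D P′ A))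

      small : ∣ ⊥ {twice j plus m} ∣ ℕ.+ length P′ ℕ.< j
      small = subst (ℕ._< j) (≡.sym (cong₂ ℕ._+_ (∣⊥∣≡0 (twice j plus m)) (List.length-map _ P))) P<j

      move : ∀ A → g ∣ A ∣ * (D P A * D L A) ≈ F (preimage π A)
      move A = *-cong (≈-reflexive (cong g (≡.sym (∣preimage∣ π A)))) (begin
        D P A * D L A
          ≈⟨ *-comm _ _ ⟩
        D L A * D P A
          ≈⟨ *-cong (≈-reflexive (≡.sym (D-preimage π (standard j m) A)))
               (≈-reflexive (≡.trans (cong (D P) (≡.sym (preimage-flipˡ π A)))
                 (D-preimage (flip π) P (preimage π A)))) ⟩
        D (standard j m) (preimage π A) * D P′ (preimage π A)
          ≈⟨ *-congˡ (≈-trans (≈-sym (*-identityˡ _)) (*-congʳ (≈-sym (contains-⊥ (preimage π A))))) ⟩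
        D (standard j m) (preimage π A) * (contains ⊥ (preimage π A) * D P′ (preimage π A)) ∎)

  -- Averages over permutations and uncorrelated functions

  Homogeneous : ℕ → (Subset n → Carrier) → Set
  Homogeneous r F = ∀ A → ∣ A ∣ ≢ r → F A ≈ 0#

  ⋆-0 : ∀ m {x} → x ≈ 0# → m ⋆ x ≈ 0#
  ⋆-0 zero      x≈0 = ≈-refl
  ⋆-0 (ℕ.suc m) x≈0 = ≈-trans (+-cong x≈0 (⋆-0 m x≈0)) (+-identityˡ 0#)

  sum-by-membership : ∀ {X Y : Carrier} {n} {Z : Set} (A : Subset n) (f : Fin n → Z) (g : Z → Carrier) →
    (∀ j → g (f j) ≈ (if lookup A j then X else Y)) →
    sum (tabulate f) g ≈ ∣ A ∣ ⋆ X + (n ℕ.∸ ∣ A ∣) ⋆ Y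
  sum-by-membership [] f g g≈ = ≈-sym (+-identityˡ 0#)
  sum-by-membership {X} {Y} {ℕ.suc n} (outside ∷ A) f g g≈ = begin
    g (f zero) + sum (tabulate (f ∘ Fin.suc)) g          ≈⟨ +-cong (g≈ zero) (sum-by-membership A (f ∘ Fin.suc) g (g≈ ∘ Fin.suc)) ⟩
    Y + (∣ A ∣ ⋆ X + (n ℕ.∸ ∣ A ∣) ⋆ Y)                  ≈⟨ solve 3 (λ a b c → a :+ (b :+ c) := b :+ (a :+ c)) ≈-refl _ _ _ ⟩
    ∣ A ∣ ⋆ X + ℕ.suc (n ℕ.∸ ∣ A ∣) ⋆ Y                  ≡⟨ cong (λ i → ∣ A ∣ ⋆ X + i ⋆ Y) (ℕ.+-∸-assoc 1 (∣p∣≤n A)) ⟨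
    ∣ A ∣ ⋆ X + (ℕ.suc n ℕ.∸ ∣ A ∣) ⋆ Y                  ∎
  sum-by-membership {X} {Y} {ℕ.suc n} (inside ∷ A) f g g≈ =
    ≈-trans (+-cong (g≈ zero) (sum-by-membership A (f ∘ Fin.suc) g (g≈ ∘ Fin.suc))) (≈-sym (+-assoc _ _ _))

  -- Each `r`-set is the preimage of `A` under the same number of permutations. The induction sorts
  -- them by the image `j` of zero: the choices of `j` in `A` produce the sets containing zero, the
  -- other choices those avoiding it.
  sum-permutations : ∀ r (F : Subset n → Carrier) → Homogeneous r F → (A : Subset n) → ∣ A ∣ ≡ r →
                     sum (permutations n) (λ π → F (preimage π A)) ≈ (r ! ℕ.* (n ℕ.∸ r) !) ⋆ S F
  sum-permutations {zero} r F hF [] refl = ≈-refl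
  sum-permutations {ℕ.suc n} r F hF A refl = begin
    sum (permutations (ℕ.suc n)) G
      ≈⟨ sum-concatMap (λ j → map (Perm.insert zero j) (permutations n)) (allFin (ℕ.suc n)) G ⟩
    sum (allFin (ℕ.suc n)) (λ j → sum (map (Perm.insert zero j) (permutations n)) G)
      ≈⟨ sum-by-membership A id _ image-of-zero ⟩
    ∣ A ∣ ⋆ X + (ℕ.suc n ℕ.∸ ∣ A ∣) ⋆ Y
      ≈⟨ +-cong (absorbX ∣ A ∣ hF) (absorbY (∣p∣≤n A)) ⟩
    c ⋆ S (F ∘ (inside ∷_)) + c ⋆ S (F ∘ (outside ∷_))
      ≈⟨ +-comm _ _ ⟩
    c ⋆ S (F ∘ (outside ∷_)) + c ⋆ S (F ∘ (inside ∷_))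
      ≈⟨ ⋆-+ c _ _ ⟨
    c ⋆ S F ∎
    where
    G : Permutation′ (ℕ.suc n) → Carrier
    G π = F (preimage π A)

    c = ∣ A ∣ ! ℕ.* (ℕ.suc n ℕ.∸ ∣ A ∣) !
    -- The truncated predecessor is harmless for an empty `A`, where this term is taken zero times;
    -- `absorbX` then compares it with a vanishing sum.
    X = (ℕ.pred ∣ A ∣ ! ℕ.* (n ℕ.∸ ℕ.pred ∣ A ∣) !) ⋆ S (F ∘ (inside ∷_))
    Y = (∣ A ∣ ! ℕ.* (n ℕ.∸ ∣ A ∣) !) ⋆ S (F ∘ (outside ∷_))

    ⋆-+ : ∀ m x y → m ⋆ (x + y) ≈ m ⋆ x + m ⋆ y
    ⋆-+ zero      x y = ≈-sym (+-identityˡ 0#)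
    ⋆-+ (ℕ.suc m) x y = ≈-trans (+-congˡ (⋆-+ m x y)) (interchange _ _ _ _)

    image-of-zero : ∀ j → sum (map (Perm.insert zero j) (permutations n)) G ≈ (if lookup A j then X else Y)
    image-of-zero j = ≈-trans (sum-map (Perm.insert zero j) (permutations n) G)
      (≈-trans (sum-cong (permutations n) λ π → ≈-reflexive (cong F (preimage-insert j π A)))
        (rest (lookup A j) (∣removeAt∣ A j)))
      where
      rest : ∀ a → ∣ A ∣ ≡ ∣ a ∷ removeAt A j ∣ →
             sum (permutations n) (λ π → F (a ∷ preimage π (removeAt A j))) ≈ (if a then X else Y)
      rest outside eq = sum-permutations ∣ A ∣ (F ∘ (outside ∷_)) (hF ∘ (outside ∷_)) (removeAt A j) (≡.sym eq)
      rest inside  eq = sum-permutations (ℕ.pred ∣ A ∣) (F ∘ (inside ∷_))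
        (λ B ∣B∣≢ → hF (inside ∷ B) (λ eq′ → ∣B∣≢ (cong ℕ.pred eq′)))
        (removeAt A j) (cong ℕ.pred (≡.sym eq))

    absorbX : ∀ r → Homogeneous r F →
              r ⋆ ((ℕ.pred r ! ℕ.* (n ℕ.∸ ℕ.pred r) !) ⋆ S (F ∘ (inside ∷_)))
              ≈ (r ! ℕ.* (ℕ.suc n ℕ.∸ r) !) ⋆ S (F ∘ (inside ∷_))
    absorbX zero      hF = ≈-sym (⋆-0 (0 ! ℕ.* ℕ.suc n !) (S-0 {n} λ B → hF (inside ∷ B) λ ()))
    absorbX (ℕ.suc r) hF = ≈-trans (×-assocˡ _ (ℕ.suc r) (r ! ℕ.* (n ℕ.∸ r) !))
      (≈-reflexive (cong (_⋆ S (F ∘ (inside ∷_))) (≡.sym (ℕ.*-assoc (ℕ.suc r) (r !) ((n ℕ.∸ r) !)))))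

    absorbY : ∣ A ∣ ℕ.≤ ℕ.suc n → (ℕ.suc n ℕ.∸ ∣ A ∣) ⋆ Y ≈ c ⋆ S (F ∘ (outside ∷_))
    absorbY A≤ with ℕ.m≤n⇒m<n∨m≡n A≤
    ... | inj₁ (s≤s A≤n) = ≈-trans (×-assocˡ _ (ℕ.suc n ℕ.∸ ∣ A ∣) (∣ A ∣ ! ℕ.* (n ℕ.∸ ∣ A ∣) !))
      (≈-reflexive (cong (_⋆ S (F ∘ (outside ∷_))) factorial))
      where
      factorial : (ℕ.suc n ℕ.∸ ∣ A ∣) ℕ.* (∣ A ∣ ! ℕ.* (n ℕ.∸ ∣ A ∣) !) ≡ c
      factorial rewrite ℕ.+-∸-assoc 1 A≤n =
        ≡.trans (≡.sym (ℕ.*-assoc (ℕ.suc (n ℕ.∸ ∣ A ∣)) (∣ A ∣ !) _))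
          (≡.trans (cong (ℕ._* (n ℕ.∸ ∣ A ∣) !) (ℕ.*-comm (ℕ.suc (n ℕ.∸ ∣ A ∣)) (∣ A ∣ !)))
            (ℕ.*-assoc (∣ A ∣ !) (ℕ.suc (n ℕ.∸ ∣ A ∣)) _))
    -- If `A` is everything, no `j` lies outside it, and no set avoiding zero has the required size.
    ... | inj₂ A≡ = ≈-trans (⋆-0 (ℕ.suc n ℕ.∸ ∣ A ∣) (⋆-0 (∣ A ∣ ! ℕ.* (n ℕ.∸ ∣ A ∣) !) empty)) (≈-sym (⋆-0 c empty))
      where
      empty : S (F ∘ (outside ∷_)) ≈ 0#
      empty = S-0 {n} λ B → hF (outside ∷ B) λ B≡ → ℕ.<-irrefl (≡.trans B≡ A≡) (s≤s (∣p∣≤n B))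

  -- The difference $w^{xy}$ for the two leading points, with their coordinates dropped.
  split : (Subset (ℕ.suc (ℕ.suc n)) → Carrier) → Subset n → Carrier
  split w A = w (inside ∷ outside ∷ A) - w (outside ∷ inside ∷ A)

  split-Homogeneous : ∀ {r} {w : Subset (ℕ.suc (ℕ.suc n)) → Carrier} →
                      Homogeneous (ℕ.suc r) w → Homogeneous r (split w)
  split-Homogeneous hw A ∣A∣≢r = ≈-trans
    (+-cong (hw _ (∣A∣≢r ∘ ℕ.suc-injective)) (-‿cong (hw _ (∣A∣≢r ∘ ℕ.suc-injective)))) (-‿inverseʳ 0#)

  1-0≈1 : 1# - 0# ≈ 1#
  1-0≈1 = ≈-trans (+-congˡ -0#≈0#) (+-identityʳ 1#)

  -- The factor of the leading pair is 0 on the blocks containing both or neither of its points, and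
  -- 1 or -1 on the two mixed blocks, which combine to `split w`.
  S-D-split : ∀ j m (w : Subset (twice ℕ.suc j plus m) → Carrier) →
              S (λ A → D (standard (ℕ.suc j) m) A * w A) ≈ S (λ A → D (standard j m) A * split w A)
  S-D-split j m w = begin
    _ ≈⟨ +-cong (+-cong (part outside outside) (part outside inside))
                (+-cong (part inside outside) (part inside inside)) ⟩
    ((0# - 0#) * X outside outside + (0# - 1#) * X outside inside)
      + ((1# - 0#) * X inside outside + (1# - 1#) * X inside inside)
      ≈⟨ solve 6 (λ z u a b c d → ((z :- z) :* a :+ (z :- u) :* b) :+ ((u :- z) :* c :+ (u :- u) :* d)
                   := (u :- z) :* (c :- b)) ≈-refl 0# 1# _ _ _ _ ⟩
    (1# - 0#) * (X inside outside - X outside inside)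
      ≈⟨ *-congʳ 1-0≈1 ⟩
    1# * (X inside outside - X outside inside)
      ≈⟨ *-identityˡ _ ⟩
    X inside outside - X outside inside
      ≈⟨ S-minus {twice j plus m} _ _ ⟨
    S (λ A → D (standard j m) A * w (inside ∷ outside ∷ A) - D (standard j m) A * w (outside ∷ inside ∷ A))
      ≈⟨ S-cong {twice j plus m} (λ A → solve 3 (λ a b c → a :* b :- a :* c := a :* (b :- c)) ≈-refl _ _ _) ⟩
    S (λ A → D (standard j m) A * split w A) ∎
    where
    X : Bool → Bool → Carrier
    X a b = S (λ A → D (standard j m) A * w (a ∷ b ∷ A))
    part : ∀ a b → S (λ A → D (standard (ℕ.suc j) m) (a ∷ b ∷ A) * w (a ∷ b ∷ A)) ≈ (𝟙 a - 𝟙 b) * X a b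
    part a b = ≈-trans
      (S-cong {twice j plus m} λ A → ≈-trans (*-congʳ (*-congˡ (≈-reflexive (D-suc² (standard j m) a b A)))) (*-assoc _ _ _))
      (S-* {twice j plus m} (𝟙 a - 𝟙 b) _)

  -- With q = d(w) d(w′) (n C k) this says disc(w, w′) = 0.
  Uncorrelated : Carrier → (w w′ : Subset n → Carrier) → Set
  Uncorrelated {n} q w w′ = (π : Permutation′ n) → S (λ A → w (preimage π A) * w′ A) ≈ q

  -- Both w ∘ π and its composite with the transposition of the first two points correlate
  -- equally with w′; the difference of the two correlations only sees the split parts.
  Uncorrelated-split : ∀ {q} (w w′ : Subset (ℕ.suc (ℕ.suc n)) → Carrier) →
                       Uncorrelated q w w′ → Uncorrelated 0# (split w) (split w′)
  Uncorrelated-split {n} {q} w w′ h π = begin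
    S (λ A → split w (preimage π A) * split w′ A)
      ≈⟨ S-cong {n} (λ A → solve 4 (λ p r s t → (p :- r) :* (s :- t) := (r :* t :+ p :* s) :- (p :* t :+ r :* s))
           ≈-refl _ _ _ _) ⟩
    S (λ A → (direct outside inside A + direct inside outside A) - (crossed outside inside A + crossed inside outside A))
      ≈⟨ S-minus {n} _ _ ⟩
    S (λ A → direct outside inside A + direct inside outside A) - S (λ A → crossed outside inside A + crossed inside outside A)
      ≈⟨ +-cong (S-+ {n} _ _) (-‿cong (S-+ {n} _ _)) ⟩
    (S (direct outside inside) + S (direct inside outside)) - (S (crossed outside inside) + S (crossed inside outside))
      -- The blocks with both or neither of the two points are the same for either permutation;
      -- added on both sides, they complete the two correlations.
      ≈⟨ solve 6 (λ a b c d e f → (b :+ c) :- (e :+ f) := ((a :+ b) :+ (c :+ d)) :- ((a :+ e) :+ (f :+ d)))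
           ≈-refl (S (direct outside outside)) _ _ (S (direct inside inside)) _ _ ⟩
    ((S (direct outside outside) + S (direct outside inside)) + (S (direct inside outside) + S (direct inside inside)))
      - ((S (direct outside outside) + S (crossed outside inside)) + (S (crossed inside outside) + S (direct inside inside)))
      ≈⟨ +-cong (h (Perm.lift₀ (Perm.lift₀ π))) (-‿cong (h (Perm.swap π))) ⟩
    q - q
      ≈⟨ -‿inverseʳ q ⟩
    0# ∎
    where
    direct crossed : Bool → Bool → Subset n → Carrier
    direct  a b A = w (a ∷ b ∷ preimage π A) * w′ (a ∷ b ∷ A)
    crossed a b A = w (b ∷ a ∷ preimage π A) * w′ (a ∷ b ∷ A)

  -- Summing the hypothesis over all permutations replaces `w`, on `r`-sets, by a constant multiple
  -- of its total, while `w′` vanishes on all other sets; what remains is the product of the totals.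
  Uncorrelated-total : ∀ r (w w′ : Subset n → Carrier) → Homogeneous r w → Homogeneous r w′ →
                       Uncorrelated 0# w w′ → (r ! ℕ.* (n ℕ.∸ r) !) ⋆ (S w * S w′) ≈ 0#
  Uncorrelated-total {n} r w w′ hw hw′ h = begin
    c ⋆ (S w * S w′)
      ≈⟨ ×-assoc-* c (S w) (S w′) ⟨
    (c ⋆ S w) * S w′
      ≈⟨ S-* {n} (c ⋆ S w) w′ ⟨
    S (λ A → (c ⋆ S w) * w′ A)
      ≈⟨ S-cong {n} average ⟨
    S (λ A → sum (permutations n) λ π → w (preimage π A) * w′ A)
      ≈⟨ S-sum (permutations n) (λ π A → w (preimage π A) * w′ A) ⟨
    sum (permutations n) (λ π → S (λ A → w (preimage π A) * w′ A))
      ≈⟨ sum-0 (permutations n) h ⟩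
    0# ∎
    where
    c = r ! ℕ.* (n ℕ.∸ r) !

    average : ∀ A → sum (permutations n) (λ π → w (preimage π A) * w′ A) ≈ (c ⋆ S w) * w′ A
    average A with ∣ A ∣ ℕ.≟ r
    ... | no ∣A∣≢r = ≈-trans
      (sum-0 (permutations n) (λ π → ≈-trans (*-congˡ (hw′ A ∣A∣≢r)) (zeroʳ _)))
      (≈-sym (≈-trans (*-congˡ (hw′ A ∣A∣≢r)) (zeroʳ _)))
    ... | yes ∣A∣≡r = begin
      sum (permutations n) (λ π → w (preimage π A) * w′ A)  ≈⟨ sum-cong (permutations n) (λ π → *-comm _ _) ⟩
      sum (permutations n) (λ π → w′ A * w (preimage π A))  ≈⟨ sum-* (permutations n) (w′ A) _ ⟩
      w′ A * sum (permutations n) (λ π → w (preimage π A))  ≈⟨ *-congˡ (sum-permutations r w hw A ∣A∣≡r) ⟩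
      w′ A * (c ⋆ S w)                                      ≈⟨ *-comm _ _ ⟩
      (c ⋆ S w) * w′ A                                      ∎

  -- Each split consumes one pair and lowers the cardinality by one, until only the totals over the
  -- `m` remaining points are compared.
  Uncorrelated-0 : ∀ j m r (w w′ : Subset (twice j plus m) → Carrier) →
    Homogeneous (j ℕ.+ r) w → Homogeneous (j ℕ.+ r) w′ → Uncorrelated 0# w w′ →
    (r ! ℕ.* (m ℕ.∸ r) !) ⋆ (S (λ A → D (standard j m) A * w A) * S (λ A → D (standard j m) A * w′ A)) ≈ 0#
  Uncorrelated-0 zero m r w w′ hw hw′ h = ≈-trans
    (×-congʳ (r ! ℕ.* (m ℕ.∸ r) !)
      (*-cong (S-cong {m} λ A → *-identityˡ (w A)) (S-cong {m} λ A → *-identityˡ (w′ A))))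
    (Uncorrelated-total r w w′ hw hw′ h)
  Uncorrelated-0 (ℕ.suc j) m r w w′ hw hw′ h = ≈-trans
    (×-congʳ (r ! ℕ.* (m ℕ.∸ r) !) (*-cong (S-D-split j m w) (S-D-split j m w′)))
    (Uncorrelated-0 j m r (split w) (split w′) (split-Homogeneous hw) (split-Homogeneous hw′)
      (Uncorrelated-split w w′ h))

  -- The first split stands apart because it replaces the unknown constant `q` by zero; this is
  -- where at least one pair is required.
  Uncorrelated-standard : ∀ {q} j m r (w w′ : Subset (twice ℕ.suc j plus m) → Carrier) →
    Homogeneous (ℕ.suc j ℕ.+ r) w → Homogeneous (ℕ.suc j ℕ.+ r) w′ → Uncorrelated q w w′ →
    (r ! ℕ.* (m ℕ.∸ r) !) ⋆
      (S (λ A → D (standard (ℕ.suc j) m) A * w A) * S (λ A → D (standard (ℕ.suc j) m) A * w′ A)) ≈ 0#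
  Uncorrelated-standard j m r w w′ hw hw′ h = ≈-trans
    (×-congʳ (r ! ℕ.* (m ℕ.∸ r) !) (*-cong (S-D-split j m w) (S-D-split j m w′)))
    (Uncorrelated-0 j m r (split w) (split w′) (split-Homogeneous hw) (split-Homogeneous hw′)
      (Uncorrelated-split w w′ h))

  -- The hypothesis ranges over all permutations, so `w` and `w′` may be moved independently; hence
  -- two different configurations can both be brought to `standard`.
  Uncorrelated-preimage : ∀ {q} (ρ σ : Permutation′ n) (w w′ : Subset n → Carrier) → Uncorrelated q w w′ →
                          Uncorrelated q (w ∘ preimage ρ) (w′ ∘ preimage σ)
  Uncorrelated-preimage {n} {q} ρ σ w w′ h π = begin
    S (λ A → w (preimage ρ (preimage π A)) * w′ (preimage σ A))
      ≈⟨ S-cong {n} (λ A → *-congʳ (≈-reflexive (cong w (≡.trans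
           (cong (preimage ρ ∘ preimage π) (≡.sym (preimage-flipˡ σ A)))
           (≡.trans (cong (preimage ρ) (preimage-∘ π (flip σ) (preimage σ A)))
             (preimage-∘ ρ (π ∘ₚ flip σ) (preimage σ A))))))) ⟩
    S (F ∘ preimage σ)
      ≈⟨ S-preimage σ F ⟩
    S F
      ≈⟨ h (ρ ∘ₚ (π ∘ₚ flip σ)) ⟩
    q ∎
    where
    F : Subset n → Carrier
    F A = w (preimage (ρ ∘ₚ (π ∘ₚ flip σ)) A) * w′ A

  D-transport : ∀ j m (π : Permutation′ (twice j plus m)) (L : Pairs (twice j plus m)) →
                mapPairs (π ⟨$⟩ʳ_) (standard j m) ≡ L → (w : Subset (twice j plus m) → Carrier) →
                S (λ A → D L A * w A) ≈ S (λ A → D (standard j m) A * w (preimage (flip π) A))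
  D-transport j m π L refl w = ≈-trans
    (S-cong {twice j plus m} λ A → *-cong (≈-reflexive (≡.sym (D-preimage π (standard j m) A)))
      (≈-reflexive (cong w (≡.sym (preimage-flipˡ π A)))))
    (S-preimage π (λ A → D (standard j m) A * w (preimage (flip π) A)))

  Homogeneous-preimage : ∀ {r} (π : Permutation′ n) {w : Subset n → Carrier} →
                         Homogeneous r w → Homogeneous r (w ∘ preimage π)
  Homogeneous-preimage π hw A ∣A∣≢r = hw (preimage π A) (∣A∣≢r ∘ ≡.trans (≡.sym (∣preimage∣ π A)))

  Uncorrelated-pairs : ∀ {q k} (w w′ : Subset n → Carrier) → Homogeneous k w → Homogeneous k w′ →
    Uncorrelated q w w′ → (L L′ : Pairs n) → Unique (points L) → Unique (points L′) →
    length L ≡ length L′ → 1 ℕ.≤ length L → length L ℕ.≤ k →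
    ∃ λ c → ℕ.NonZero c × c ⋆ (S (λ A → D L A * w A) * S (λ A → D L′ A * w′ A)) ≈ 0#
  Uncorrelated-pairs {q = q} {k} w w′ hw hw′ h L L′ L! L′! len 1≤ ≤k =
    let m , n≡ = pairs-standard L L! in go (length L) m n≡ w w′ hw hw′ h L L′ L! L′! refl len 1≤ ≤k
    where
    go : ∀ j m {n} → n ≡ twice j plus m → (w w′ : Subset n → Carrier) → Homogeneous k w → Homogeneous k w′ →
         Uncorrelated q w w′ → (L L′ : Pairs n) → Unique (points L) → Unique (points L′) →
         length L ≡ j → j ≡ length L′ → 1 ℕ.≤ j → j ℕ.≤ k →
         ∃ λ c → ℕ.NonZero c × c ⋆ (S (λ A → D L A * w A) * S (λ A → D L′ A * w′ A)) ≈ 0#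
    go (ℕ.suc j) m refl w w′ hw hw′ h L L′ L! L′! len len′ _ j≤k
      with r , refl ← ℕ.m≤n⇒∃[o]m+o≡n j≤k =
        -- For `r` at most `m`, this counts the permutations of the `m` points outside the pairs
        -- that carry one given `r`-set to another.
        r ! ℕ.* (m ℕ.∸ r) !
      , ℕ.m*n≢0 (r !) ((m ℕ.∸ r) !) {{r ℕ.!≢0}} {{(m ℕ.∸ r) ℕ.!≢0}}
      , ≈-trans
          (×-congʳ (r ! ℕ.* (m ℕ.∸ r) !)
            (*-cong (D-transport (ℕ.suc j) m π L πL w) (D-transport (ℕ.suc j) m π′ L′ π′L′ w′)))
          (Uncorrelated-standard j m r (w ∘ preimage (flip π)) (w′ ∘ preimage (flip π′))
            (Homogeneous-preimage (flip π) hw) (Homogeneous-preimage (flip π′) hw′)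
            (Uncorrelated-preimage (flip π) (flip π′) w w′ h))
      where
      std! = standard-Unique (ℕ.suc j) m
      length-std = length-standard (ℕ.suc j) m
      π = proj₁ (transitive (standard (ℕ.suc j) m) L (≡.trans length-std (≡.sym len)) std! L!)
      πL = proj₂ (transitive (standard (ℕ.suc j) m) L (≡.trans length-std (≡.sym len)) std! L!)
      π′ = proj₁ (transitive (standard (ℕ.suc j) m) L′ (≡.trans length-std len′) std! L′!)
      π′L′ = proj₂ (transitive (standard (ℕ.suc j) m) L′ (≡.trans length-std len′) std! L′!)

  -- Straightening monomials into products of differences

  reciprocal : ∀ m → ∃ λ c → ∀ x → c * (ℕ.suc m ⋆ x) ≈ x
  reciprocal m = ⟦ ℚ.1/ q ⟧ , λ x → begin
    ⟦ ℚ.1/ q ⟧ * (ℕ.suc m ⋆ x)   ≈⟨ *-congˡ (≈-sym (multiple (ℕ.suc m) x)) ⟩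
    ⟦ ℚ.1/ q ⟧ * (⟦ q ⟧ * x)     ≈⟨ *-assoc _ _ _ ⟨
    (⟦ ℚ.1/ q ⟧ * ⟦ q ⟧) * x     ≈⟨ *-congʳ (*-homo (ℚ.1/ q) q) ⟨
    ⟦ ℚ.1/ q ℚ.* q ⟧ * x         ≈⟨ *-congʳ (≈-reflexive (cong ⟦_⟧ (ℚ.*-inverseˡ q))) ⟩
    ⟦ 1ℚ ⟧ * x                   ≈⟨ *-congʳ 1-homo ⟩
    1# * x                       ≈⟨ *-identityˡ x ⟩
    x                            ∎
    where
    open _-Raw-AlmostCommutative⟶_ ι using (+-homo; *-homo; 0-homo; 1-homo)

    fromℕ : ℕ → ℚ
    fromℕ zero      = 0ℚ
    fromℕ (ℕ.suc i) = 1ℚ ℚ.+ fromℕ i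

    fromℕ-nonNeg : ∀ i → ℚ.NonNegative (fromℕ i)
    fromℕ-nonNeg zero      = _
    fromℕ-nonNeg (ℕ.suc i) = ℚ.nonNeg+nonNeg⇒nonNeg 1ℚ (fromℕ i) {{fromℕ-nonNeg i}}

    q = fromℕ (ℕ.suc m)

    instance
      q≢0 : ℚ.NonZero q
      q≢0 = ℚ.pos⇒nonZero q {{ℚ.pos+nonNeg⇒pos 1ℚ (fromℕ m) {{fromℕ-nonNeg m}}}}

    multiple : ∀ i x → ⟦ fromℕ i ⟧ * x ≈ i ⋆ x
    multiple zero      x = ≈-trans (*-congʳ 0-homo) (zeroˡ x)
    multiple (ℕ.suc i) x = begin
      ⟦ 1ℚ ℚ.+ fromℕ i ⟧ * x           ≈⟨ *-congʳ (+-homo 1ℚ (fromℕ i)) ⟩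
      (⟦ 1ℚ ⟧ + ⟦ fromℕ i ⟧) * x       ≈⟨ distribʳ x _ _ ⟩
      ⟦ 1ℚ ⟧ * x + ⟦ fromℕ i ⟧ * x     ≈⟨ +-cong (≈-trans (*-congʳ 1-homo) (*-identityˡ x)) (multiple i x) ⟩
      x + i ⋆ x                        ∎

  coordinates : Subset n → Fin n → Carrier
  coordinates A x = 𝟙 (lookup A x)

  sum-coordinates : (A : Subset n) → sum (allFin n) (coordinates A) ≈ ∣ A ∣ ⋆ 1#
  sum-coordinates {n} A = ≈-trans
    (sum-by-membership A id (coordinates A) (λ j → ≈-reflexive (𝟙≡if (lookup A j))))
    (≈-trans (+-congˡ (⋆-0 (n ℕ.∸ ∣ A ∣) ≈-refl)) (+-identityʳ _))
    where
    𝟙≡if : ∀ a → 𝟙 a ≡ (if a then 1# else 0#)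
    𝟙≡if true  = refl
    𝟙≡if false = refl

  -- Where the product does not vanish, `A` contains exactly one point of each pair, and so exactly
  -- `length L` of the points of `L`.
  D-sum-coordinates : (L : Pairs n) (A : Subset n) →
                      D L A * sum (points L) (coordinates A) ≈ (length L ⋆ 1#) * D L A
  D-sum-coordinates []            A = *-comm _ _
  D-sum-coordinates ((x , y) ∷ L) A = begin
    ((a - b) * d) * (a + (b + s))                ≈⟨ solve 4 (λ a b d s → ((a :- b) :* d) :* (a :+ (b :+ s))
                                                      := (a :* a :- b :* b) :* d :+ (a :- b) :* (d :* s)) ≈-refl a b d s ⟩
    (a * a - b * b) * d + (a - b) * (d * s)      ≈⟨ +-cong (*-congʳ (+-cong (𝟙-idem (lookup A x)) (-‿cong (𝟙-idem (lookup A y)))))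
                                                      (*-congˡ (D-sum-coordinates L A)) ⟩
    (a - b) * d + (a - b) * (l * d)              ≈⟨ +-congʳ (*-identityˡ _) ⟨
    1# * ((a - b) * d) + (a - b) * (l * d)       ≈⟨ solve 5 (λ a b d u l → u :* ((a :- b) :* d) :+ (a :- b) :* (l :* d)
                                                      := (u :+ l) :* ((a :- b) :* d)) ≈-refl a b d 1# l ⟩
    (1# + l) * ((a - b) * d)                     ∎
    where
    a = 𝟙 (lookup A x)
    b = 𝟙 (lookup A y)
    d = D L A
    s = sum (points L) (coordinates A)
    l = length L ⋆ 1#

  M-sum-coordinates : (zs : List (Fin n)) (A : Subset n) →
                      M zs A * sum zs (coordinates A) ≈ (length zs ⋆ 1#) * M zs A
  M-sum-coordinates []       A = *-comm _ _
  M-sum-coordinates (z ∷ zs) A = begin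
    (a * d) * (a + s)                  ≈⟨ solve 3 (λ a d s → (a :* d) :* (a :+ s) := (a :* a) :* d :+ a :* (d :* s)) ≈-refl a d s ⟩
    (a * a) * d + a * (d * s)          ≈⟨ +-cong (*-congʳ (𝟙-idem (lookup A z))) (*-congˡ (M-sum-coordinates zs A)) ⟩
    a * d + a * (l * d)                ≈⟨ +-congʳ (*-identityˡ _) ⟨
    1# * (a * d) + a * (l * d)         ≈⟨ solve 4 (λ a d u l → u :* (a :* d) :+ a :* (l :* d) := (u :+ l) :* (a :* d)) ≈-refl a d 1# l ⟩
    (1# + l) * (a * d)                 ∎
    where
    a = 𝟙 (lookup A z)
    d = M zs A
    s = sum zs (coordinates A)
    l = length zs ⋆ 1#

  sum-exchange : (z : Fin n) (L : Pairs n) (zs ys : List (Fin n)) (A : Subset n) →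
    sum ys (λ y → D ((z , y) ∷ L) A * M zs A)
    ≈ length ys ⋆ (D L A * M (z ∷ zs) A) - (D L A * M zs A) * sum ys (coordinates A)
  sum-exchange z L zs []       A = ≈-sym (≈-trans (+-congˡ (-‿cong (zeroʳ _))) (-‿inverseʳ 0#))
  sum-exchange z L zs (y ∷ ys) A = ≈-trans (+-congˡ (sum-exchange z L zs ys A))
    (solve 6 (λ a b d m r s → ((a :- b) :* d) :* m :+ (r :- (d :* m) :* s)
                              := (d :* (a :* m) :+ r) :- (d :* m) :* (b :+ s)) ≈-refl _ _ _ _ _ _)

  -- Exchanging z for each point y outside L, z and zs: the error terms Σ_y 1_y sum up to a constant
  -- because A has a fixed size, 1_x is idempotent and (1_x - 1_y)(1_x + 1_y) = 1_x - 1_y.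
  straightening : (z : Fin n) (L : Pairs n) (zs ys : List (Fin n)) → (points L ++ z ∷ zs) ++ ys ↭ allFin n →
    (A : Subset n) →
    ℕ.suc (length ys) ⋆ (D L A * M (z ∷ zs) A)
    ≈ sum ys (λ y → D ((z , y) ∷ L) A * M zs A)
      + (∣ A ∣ ⋆ 1# - (length L ⋆ 1# + length zs ⋆ 1#)) * (D L A * M zs A)
  straightening {n} z L zs ys ys↭ A = ≈-sym (begin
    sum ys (λ y → D ((z , y) ∷ L) A * M zs A) + (∣ A ∣ ⋆ 1# - (l + l′)) * (d * m)
      ≈⟨ +-cong (sum-exchange z L zs ys A) (*-congʳ (+-congʳ size)) ⟩
    (r - (d * m) * t) + (((s + (a + s′)) + t) - (l + l′)) * (d * m)
      ≈⟨ solve 9 (λ r d m t s a s′ l l′ →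
           (r :- (d :* m) :* t) :+ (((s :+ (a :+ s′)) :+ t) :- (l :+ l′)) :* (d :* m)
           := ((d :* (a :* m) :+ r) :+ (d :* s :* m :- l :* d :* m)) :+ (m :* s′ :* d :- l′ :* m :* d))
           ≈-refl r d m t s a s′ l l′ ⟩
    ((d * (a * m) + r) + (d * s * m - l * d * m)) + (m * s′ * d - l′ * m * d)
      ≈⟨ +-cong (+-congˡ (cancel (*-congʳ (D-sum-coordinates L A)))) (cancel (*-congʳ (M-sum-coordinates zs A))) ⟩
    ((d * (a * m) + r) + 0#) + 0#
      ≈⟨ ≈-trans (+-identityʳ _) (+-identityʳ _) ⟩
    d * (a * m) + r ∎)
    where
    d  = D L A
    m  = M zs A
    a  = 𝟙 (lookup A z)
    r  = length ys ⋆ (d * (a * m))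
    s  = sum (points L) (coordinates A)
    s′ = sum zs (coordinates A)
    t  = sum ys (coordinates A)
    l  = length L ⋆ 1#
    l′ = length zs ⋆ 1#

    cancel : ∀ {x y} → x ≈ y → x - y ≈ 0#
    cancel x≈y = ≈-trans (+-congʳ x≈y) (-‿inverseʳ _)

    size : ∣ A ∣ ⋆ 1# ≈ (s + (a + s′)) + t
    size = begin
      ∣ A ∣ ⋆ 1#                                          ≈⟨ sum-coordinates A ⟨
      sum (allFin n) (coordinates A)                      ≈⟨ sum-↭ ys↭ (coordinates A) ⟨
      sum ((points L ++ z ∷ zs) ++ ys) (coordinates A)    ≈⟨ sum-++ (points L ++ z ∷ zs) ys _ ⟩
      sum (points L ++ z ∷ zs) (coordinates A) + t        ≈⟨ +-congʳ (sum-++ (points L) (z ∷ zs) _) ⟩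
      (s + (a + s′)) + t                                  ∎

  -- `U` stands for membership in the sum of the spaces, judged by values on k-sets only; the
  -- reduction uses nothing but these closure properties.
  module Spanning (k : ℕ) (U : (Subset n → Carrier) → Set)
    (U-cong : ∀ {F G} → (∀ A → ∣ A ∣ ≡ k → F A ≈ G A) → U F → U G)
    (U-+ : ∀ {F G} → U F → U G → U (λ A → F A + G A))
    (U-* : ∀ c {F} → U F → U (λ A → c * F A))
    (U-D : ∀ L → Unique (points L) → length L ℕ.≤ k → U (D L))
    where

    U-0 : U (λ _ → 0#)
    U-0 = U-cong (λ A _ → zeroˡ 1#) (U-* 0# (U-D [] [] ℕ.z≤n))

    U-sum : {X : Set} {F : X → Subset n → Carrier} {xs : List X} → All (U ∘ F) xs →
            U (λ A → sum xs (λ x → F x A))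
    U-sum []       = U-0
    U-sum (u ∷ us) = U-+ u (U-sum us)

    U-S : ∀ {m} {F : Subset m → Subset n → Carrier} → (∀ B → U (F B)) → U (λ A → S (λ B → F B A))
    U-S {zero}    UF = UF []
    U-S {ℕ.suc m} UF = U-+ (U-S (UF ∘ (outside ∷_))) (U-S (UF ∘ (inside ∷_)))

    -- Induction on `zs`. An exchanged term trades a point of `zs` for a pair with a fresh second
    -- point, which keeps the total number of factors; the remaining term has one factor less. In
    -- the end only differences over at most `k` pairs are left.
    U-monomial : ∀ zs L → Unique (points L ++ zs) → length L ℕ.+ length zs ℕ.≤ k → U (λ A → D L A * M zs A)
    U-monomial [] L L! ≤k = U-cong (λ A _ → ≈-sym (*-identityʳ _))
      (U-D L (subst Unique (List.++-identityʳ (points L)) L!) (subst (ℕ._≤ k) (ℕ.+-identityʳ (length L)) ≤k))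
    U-monomial (z ∷ zs) L Lz! ≤k =
      let ys , ys↭ = complement-allFin (points L ++ z ∷ zs) Lz!
          c , c≈   = reciprocal (length ys)
      in U-cong (λ A ∣A∣≡k → begin
           c * _ ≈⟨ *-congˡ (+-congˡ (*-congʳ (+-congʳ (≈-reflexive (cong (_⋆ 1#) ∣A∣≡k))))) ⟨
           c * _ ≈⟨ *-congˡ (straightening z L zs ys ys↭ A) ⟨
           c * (ℕ.suc (length ys) ⋆ (D L A * M (z ∷ zs) A)) ≈⟨ c≈ _ ⟩
           D L A * M (z ∷ zs) A ∎)
         (U-* c (U-+
           (U-sum (All.tabulate λ {y} y∈ys → U-monomial zs ((z , y) ∷ L)
             (exchange-Unique (Unique-resp-↭ (↭-sym ys↭) (Unique.allFin⁺ n)) y∈ys)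
             (subst (ℕ._≤ k) (ℕ.+-suc (length L) (length zs)) ≤k)))
           (U-* (k ⋆ 1# - (length L ⋆ 1# + length zs ⋆ 1#))
             (U-monomial zs L (drop-z Lz!) (ℕ.≤-trans (ℕ.+-monoʳ-≤ (length L) (ℕ.n≤1+n _)) ≤k)))))
      where
      drop-z : Unique (points L ++ z ∷ zs) → Unique (points L ++ zs)
      drop-z Lz! with _ ∷ Lzs! ← Unique-resp-↭ (↭.shift z (points L) zs) Lz! = Lzs!

      fresh : ∀ xs {ys} {y : Fin n} → Unique (xs ++ ys) → y ∈ˡ ys → All (y ≢_) xs
      fresh []       _          y∈ = []
      fresh (x ∷ xs) (x∉ ∷ xs!) y∈ =
        (All.lookup x∉ (∈ˡ.∈-++⁺ʳ xs y∈) ∘ ≡.sym) ∷ fresh xs xs! y∈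

      exchange-Unique : ∀ {y ys} → Unique ((points L ++ z ∷ zs) ++ ys) → y ∈ˡ ys →
                        Unique (z ∷ y ∷ points L ++ zs)
      exchange-Unique all! y∈ys = Unique-resp-↭
        (↭-trans (prep _ (↭.shift z (points L) zs)) (_↭_.swap _ z ↭-refl))
        (fresh (points L ++ z ∷ zs) all! y∈ys ∷ Lz!)

    -- On k-sets, `F` is a combination of the monomials of k-sets, and these are straightened
    -- starting from no pairs.
    U-everything : ∀ F → U F
    U-everything F = U-cong expand (U-S term)
      where
      -- Coefficients off level `k` are set to zero: the sum runs over all subsets, but only the
      -- monomials of k-sets serve as indicator functions.
      F′ : Subset n → Carrier
      F′ B = if does (∣ B ∣ ℕ.≟ k) then F B else 0#

      F′-at : ∀ B → ∣ B ∣ ≡ k → F′ B ≡ F B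
      F′-at B ∣B∣≡k = cong (if_then F B else 0#) (dec-true (∣ B ∣ ℕ.≟ k) ∣B∣≡k)

      F′-off : ∀ B → ∣ B ∣ ≢ k → F′ B ≡ 0#
      F′-off B ∣B∣≢k = cong (if_then F B else 0#) (dec-false (∣ B ∣ ℕ.≟ k) ∣B∣≢k)

      term : ∀ B → U (λ A → F′ B * contains B A)
      term B with ∣ B ∣ ℕ.≟ k
      ... | no  ∣B∣≢k = U-cong (λ A _ → ≈-sym (≈-trans (*-congʳ (≈-reflexive (F′-off B ∣B∣≢k))) (zeroˡ _))) U-0
      ... | yes ∣B∣≡k = U-* (F′ B) (U-cong
        (λ A _ → ≈-trans (*-identityˡ _) (≈-sym (contains-elements B A)))
        (U-monomial (elements B) [] (elements-Unique B)
          (ℕ.≤-reflexive (≡.trans (length-elements B) ∣B∣≡k))))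

      expand : ∀ A → ∣ A ∣ ≡ k → S (λ B → F′ B * contains B A) ≈ F A
      expand A ∣A∣≡k = begin
        S (λ B → F′ B * contains B A)  ≈⟨ S-cong {n} pointwise ⟩
        S (λ B → δ A B * F B)          ≈⟨ S-δ A F ⟩
        F A                            ∎
        where
        pointwise : ∀ B → F′ B * contains B A ≈ δ A B * F B
        pointwise B with ∣ B ∣ ℕ.≟ k
        ... | yes ∣B∣≡k = ≈-trans (≈-trans (*-congʳ (≈-reflexive (F′-at B ∣B∣≡k))) (*-comm _ _))
          (*-congʳ (contains-δ B A (ℕ.≤-reflexive (≡.trans ∣A∣≡k (≡.sym ∣B∣≡k)))))
        ... | no  ∣B∣≢k = ≈-trans (≈-trans (*-congʳ (≈-reflexive (F′-off B ∣B∣≢k))) (zeroˡ _)) (≈-sym (≈-trans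
          (*-congʳ (≈-reflexive (cong 𝟙 (dec-false (Vec.≡-dec _≟ᵇ_ A B) λ { refl → ∣B∣≢k ∣A∣≡k })))) (zeroˡ _)))

  -- Removing a pair of points inside a fixed ground set

  difference-expand : ∀ a b z → (𝟙 a - 𝟙 b) * z ≈ (𝟙 a * 𝟙 (not b)) * z - (𝟙 b * 𝟙 (not a)) * z
  difference-expand a b z = ≈-trans (*-congʳ (coefficients a b))
    (solve 3 (λ p q z → (p :- q) :* z := p :* z :- q :* z) ≈-refl _ _ z)
    where
    coefficients : ∀ a b → 𝟙 a - 𝟙 b ≈ 𝟙 a * 𝟙 (not b) - 𝟙 b * 𝟙 (not a)
    coefficients true  true  = ≈-trans (-‿inverseʳ 1#) (≈-sym (-‿inverseʳ (1# * 0#)))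
    coefficients true  false = +-cong (≈-sym (*-identityˡ 1#)) (-‿cong (≈-sym (zeroˡ 0#)))
    coefficients false true  = +-cong (≈-sym (zeroˡ 0#)) (-‿cong (≈-sym (*-identityˡ 1#)))
    coefficients false false = ≈-trans (-‿inverseʳ 0#) (≈-sym (-‿inverseʳ (0# * 1#)))

  -- Reindexing by `toggle x`, which leaves `D L` unchanged because `x` is not a point of `L`.
  S-toggle-half : (x y : Fin n) → x ≢ y → (L : Pairs n) → All (x ≢_) (points L) → (F : Subset n → Carrier) →
    S (λ A → (𝟙 (lookup A x) * 𝟙 (not (lookup A y))) * (D L A * F A))
    ≈ S (λ A → (𝟙 (not (lookup A x)) * 𝟙 (not (lookup A y))) * (D L A * F (toggle x A)))
  S-toggle-half {n} x y x≢y L x∉L F = ≈-trans (≈-sym (S-toggle x _)) (S-cong {n} λ A →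
    *-cong
      (*-cong (≈-reflexive (cong 𝟙 (Vec.lookup∘updateAt x A)))
        (≈-reflexive (cong (𝟙 ∘ not) (Vec.lookup∘updateAt′ y x (x≢y ∘ ≡.sym) A))))
      (*-congʳ (≈-reflexive (D-local L
        (All.map (λ {z} x≢z → Vec.lookup∘updateAt′ z x (x≢z ∘ ≡.sym) A) x∉L)))))

  -- Only the sets meeting {x , y} in exactly one point contribute; deleting that point yields a set
  -- avoiding x and y.
  S-difference : (x y : Fin n) → x ≢ y → (L : Pairs n) → All (x ≢_) (points L) → All (y ≢_) (points L) →
    (F : Subset n → Carrier) →
    S (λ A → D ((x , y) ∷ L) A * F A)
    ≈ S (λ A → (𝟙 (not (lookup A x)) * 𝟙 (not (lookup A y))) * (D L A * (F (toggle x A) - F (toggle y A))))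
  S-difference {n} x y x≢y L x∉L y∉L F = begin
    S (λ A → D ((x , y) ∷ L) A * F A)
      ≈⟨ S-cong {n} (λ A → ≈-trans (*-assoc _ _ _) (difference-expand (lookup A x) (lookup A y) (D L A * F A))) ⟩
    S (λ A → (𝟙 (lookup A x) * 𝟙 (not (lookup A y))) * (D L A * F A)
           - (𝟙 (lookup A y) * 𝟙 (not (lookup A x))) * (D L A * F A))
      ≈⟨ S-minus {n} _ _ ⟩
    S (λ A → (𝟙 (lookup A x) * 𝟙 (not (lookup A y))) * (D L A * F A))
      - S (λ A → (𝟙 (lookup A y) * 𝟙 (not (lookup A x))) * (D L A * F A))
      ≈⟨ +-cong (S-toggle-half x y x≢y L x∉L F) (-‿cong (S-toggle-half y x (x≢y ∘ ≡.sym) L y∉L F)) ⟩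
    S (λ A → (𝟙 (not (lookup A x)) * 𝟙 (not (lookup A y))) * (D L A * F (toggle x A)))
      - S (λ A → (𝟙 (not (lookup A y)) * 𝟙 (not (lookup A x))) * (D L A * F (toggle y A)))
      ≈⟨ S-minus {n} _ _ ⟨
    S (λ A → (𝟙 (not (lookup A x)) * 𝟙 (not (lookup A y))) * (D L A * F (toggle x A))
           - (𝟙 (not (lookup A y)) * 𝟙 (not (lookup A x))) * (D L A * F (toggle y A)))
      ≈⟨ S-cong {n} (λ A → solve 5 (λ a b d p q → (a :* b) :* (d :* p) :- (b :* a) :* (d :* q)
                                    := (a :* b) :* (d :* (p :- q))) ≈-refl _ _ _ _ _) ⟩
    S (λ A → (𝟙 (not (lookup A x)) * 𝟙 (not (lookup A y))) * (D L A * (F (toggle x A) - F (toggle y A)))) ∎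

  ⋆-cancel : ∀ m → ℕ.NonZero m → ∀ x → m ⋆ x ≈ 0# → x ≈ 0#
  ⋆-cancel (ℕ.suc m) _ x mx≈0 = let c , c≈ = reciprocal m in
    ≈-trans (≈-sym (c≈ x)) (≈-trans (*-congˡ mx≈0) (zeroʳ c))

  cancel-difference : ∀ x y → x + - 1# * y ≈ 0# → x ≈ y
  cancel-difference x y h = begin
    x                    ≈⟨ solve 3 (λ x y u → x := (x :+ (:- u) :* y) :+ u :* y) ≈-refl x y 1# ⟩
    (x + - 1# * y) + 1# * y  ≈⟨ +-cong h (*-identityˡ y) ⟩
    0# + y               ≈⟨ +-identityˡ y ⟩
    y                    ∎

  difference-cancels : ∀ x y → x ≈ y → x + - 1# * y ≈ 0#
  difference-cancels x y x≈y = begin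
    x + - 1# * y         ≈⟨ +-congʳ (≈-trans x≈y (≈-sym (*-identityˡ y))) ⟩
    1# * y + - 1# * y    ≈⟨ distribʳ y 1# (- 1#) ⟨
    (1# + - 1#) * y      ≈⟨ *-congʳ (-‿inverseʳ 1#) ⟩
    0# * y               ≈⟨ zeroˡ y ⟩
    0#                   ∎

open import Defs

-- Cardinalities of finite sets and indexed families of pairs

C-NonZero : ∀ n k → k ℕ.≤ n → ℕ.NonZero (n C k)
C-NonZero n         ℕ.zero    _         = subst ℕ.NonZero (≡.sym (≡.trans (nCk≡nC[n∸k] {n = n} z≤n) (nCn≡1 n))) _
C-NonZero (ℕ.suc n) (ℕ.suc k) (s≤s k≤n) =
  subst ℕ.NonZero (nCk+nC[k+1]≡[n+1]C[k+1] n k) (ℕ.>-nonZero (ℕ.<-≤-trans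
    (ℕ.>-nonZero⁻¹ (n C k) {{C-NonZero n k k≤n}}) (ℕ.m≤m+n (n C k) (n C ℕ.suc k))))

select-complete : {A : Set} {P : A → Set} (P? : ∀ a → Dec (P a)) {xs : List A} {a : A} →
                  a ∈ˡ xs → (p : P a) → (a , Irrelevant.[ p ]) ∈ˡ select P? xs
select-complete P? {a ∷ xs} (here refl) p with P? a
... | yes _ = here refl
... | no ¬p = contradiction p ¬p
select-complete P? {a ∷ xs} (there b∈) p with P? a
... | yes _ = there (select-complete P? b∈ p)
... | no _  = select-complete P? b∈ p

size : Bool → ℕ
size true  = 1
size false = 0

lookup-∈ : {x : Fin n} {A : Subset n} → x ∈ A → lookup A x ≡ inside
lookup-∈ = Vec.[]=⇒lookup

∣∩⁅x⁆∪∣ : (A q : Subset n) (x : Fin n) → x ∉ q → ∣ A ∩ (⁅ x ⁆ ∪ q) ∣ ≡ size (lookup A x) ℕ.+ ∣ A ∩ q ∣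
∣∩⁅x⁆∪∣ A (inside ∷ q) zero x∉q = contradiction here x∉q
∣∩⁅x⁆∪∣ (outside ∷ A) (outside ∷ q) zero x∉q = cong (λ r → ∣ A ∩ r ∣) (∪-identityˡ q)
∣∩⁅x⁆∪∣ (inside ∷ A) (outside ∷ q) zero x∉q = cong (λ r → ℕ.suc ∣ A ∩ r ∣) (∪-identityˡ q)
∣∩⁅x⁆∪∣ (outside ∷ A) (b ∷ q) (suc x) x∉q = ∣∩⁅x⁆∪∣ A q x (x∉q ∘ there)
∣∩⁅x⁆∪∣ (inside ∷ A) (outside ∷ q) (suc x) x∉q = ∣∩⁅x⁆∪∣ A q x (x∉q ∘ there)
∣∩⁅x⁆∪∣ (inside ∷ A) (inside ∷ q) (suc x) x∉q =
  ≡.trans (cong ℕ.suc (∣∩⁅x⁆∪∣ A q x (x∉q ∘ there))) (≡.sym (ℕ.+-suc (size (lookup A x)) ∣ A ∩ q ∣))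

∣∩⊥∣ : (A : Subset n) → ∣ A ∩ ⊥ ∣ ≡ 0
∣∩⊥∣ {n} A = ℕ.n≤0⇒n≡0 (subst (∣ A ∩ ⊥ ∣ ℕ.≤_) (∣⊥∣≡0 n) (∣p∩q∣≤∣q∣ A ⊥))

∣∩pair∣ : (A : Subset n) (x y : Fin n) → x ≢ y →
          ∣ A ∩ (⁅ x ⁆ ∪ ⁅ y ⁆) ∣ ≡ size (lookup A x) ℕ.+ size (lookup A y)
∣∩pair∣ A x y x≢y = ≡.trans (∣∩⁅x⁆∪∣ A ⁅ y ⁆ x (x≢y ∘ x∈⁅y⁆⇒x≡y y)) (cong (size (lookup A x) ℕ.+_)
  (≡.trans (cong (λ q → ∣ A ∩ q ∣) (≡.sym (∪-identityʳ ⁅ y ⁆)))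
    (≡.trans (∣∩⁅x⁆∪∣ A ⊥ y ∉⊥) (≡.trans (cong (size (lookup A y) ℕ.+_) (∣∩⊥∣ A)) (ℕ.+-identityʳ _)))))

∉-⋃ : {K : Set} (y : K → Fin n) (js : List K) {z : Fin n} → All (λ j → z ≢ y j) js →
      z ∉ ⋃ (map (λ j → ⁅ y j ⁆) js)
∉-⋃ y []       []         z∈ = ∉⊥ z∈
∉-⋃ y (j ∷ js) (z≢ ∷ z≢s) z∈ with x∈p∪q⁻ ⁅ y j ⁆ _ z∈
... | inj₁ z∈y = z≢ (x∈⁅y⁆⇒x≡y (y j) z∈y)
... | inj₂ z∈⋃ = ∉-⋃ y js z≢s z∈⋃

below : ∀ k → ℕ → List (Fin k)
below k i = filter (λ j → toℕ j ℕ.<? i) (allFin k)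

length-below : ∀ k i → i ℕ.≤ k → length (below k i) ≡ i
length-below k ℕ.zero _ = cong length (List.filter-none (λ j → toℕ j ℕ.<? 0) {allFin k} (All.universal (λ _ ()) _))
length-below (ℕ.suc k) (ℕ.suc i) (s≤s i≤k) = cong ℕ.suc (≡.trans (shift id) (length-below k i i≤k))
  where
  shift : ∀ {m} (f : Fin m → Fin k) →
          length (filter (λ j → toℕ j ℕ.<? ℕ.suc i) (tabulate (suc ∘ f)))
          ≡ length (filter (λ j → toℕ j ℕ.<? i) (tabulate f))
  shift {ℕ.zero}  f = refl
  shift {ℕ.suc m} f with toℕ (f zero) ℕ.<? i
  ... | yes p = ≡.trans
    (cong length (List.filter-accept (λ j → toℕ j ℕ.<? ℕ.suc i) {suc (f zero)} {tabulate (suc ∘ f ∘ suc)} (s≤s p)))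
    (≡.trans (cong ℕ.suc (shift (f ∘ suc)))
      (cong length (≡.sym (List.filter-accept (λ j → toℕ j ℕ.<? i) {f zero} p))))
  ... | no ¬p = ≡.trans
    (cong length (List.filter-reject (λ j → toℕ j ℕ.<? ℕ.suc i) {suc (f zero)} {tabulate (suc ∘ f ∘ suc)} (¬p ∘ ℕ.s<s⁻¹)))
    (≡.trans (shift (f ∘ suc))
      (cong length (≡.sym (List.filter-reject (λ j → toℕ j ℕ.<? i) {f zero} ¬p))))

pairsAt : {K : Set} (x y : K → Fin n) → List K → Pairs n
pairsAt x y = map (λ j → x j , y j)

-- Follows the order of `points`, so that injectivity of `[ x , y ]` on the disjoint union makes all
-- points of a configuration distinct at once.
both : {K : Set} → List K → List (K ⊎ K)
both []       = []
both (j ∷ js) = inj₁ j ∷ inj₂ j ∷ both js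

points-pairsAt : {K : Set} (x y : K → Fin n) (js : List K) → points (pairsAt x y js) ≡ map [ x , y ] (both js)
points-pairsAt x y []       = refl
points-pairsAt x y (j ∷ js) = cong (λ zs → x j ∷ y j ∷ zs) (points-pairsAt x y js)

both-Unique : {K : Set} {js : List K} → Unique js → Unique (both js)
both-Unique []          = []
both-Unique {js = j ∷ js} (j∉ ∷ js!) = ((λ ()) ∷ fresh₁ j∉) ∷ fresh₂ j∉ ∷ both-Unique js!
  where
  fresh₁ : ∀ {js} → All (j ≢_) js → All (inj₁ j ≢_) (both js)
  fresh₁ []        = []
  fresh₁ (j≢ ∷ j≢s) = (λ { refl → j≢ refl }) ∷ (λ ()) ∷ fresh₁ j≢s
  fresh₂ : ∀ {js} → All (j ≢_) js → All (inj₂ j ≢_) (both js)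
  fresh₂ []        = []
  fresh₂ (j≢ ∷ j≢s) = (λ ()) ∷ (λ { refl → j≢ refl }) ∷ fresh₂ j≢s

pairsAt-Unique : {K : Set} {x y : K → Fin n} {js : List K} → Injective {A = K ⊎ K} _≡_ _≡_ [ x , y ] →
                 Unique js → Unique (points (pairsAt x y js))
pairsAt-Unique {x = x} {y} {js} inj js! =
  subst Unique (≡.sym (points-pairsAt x y js)) (Unique.map⁺ inj (both-Unique js!))

∉─ : (p q : Subset n) {x : Fin n} → x ∈ q → x ∉ p ─ q
∉─ (_ ∷ p) (outside ∷ q) (there x∈q) (there x∈) = ∉─ p q x∈q x∈
∉─ (_ ∷ p) (inside  ∷ q) (there x∈q) (there x∈) = ∉─ p q x∈q x∈

∣p∣≤∣p─q∣+∣q∣ : (p q : Subset n) → ∣ p ∣ ℕ.≤ ∣ p ─ q ∣ ℕ.+ ∣ q ∣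
∣p∣≤∣p─q∣+∣q∣ []            []            = z≤n
∣p∣≤∣p─q∣+∣q∣ (outside ∷ p) (outside ∷ q) = ∣p∣≤∣p─q∣+∣q∣ p q
∣p∣≤∣p─q∣+∣q∣ (inside ∷ p)  (outside ∷ q) = s≤s (∣p∣≤∣p─q∣+∣q∣ p q)
∣p∣≤∣p─q∣+∣q∣ (outside ∷ p) (inside ∷ q)  =
  ℕ.≤-trans (∣p∣≤∣p─q∣+∣q∣ p q) (ℕ.+-monoʳ-≤ ∣ p ─ q ∣ (ℕ.n≤1+n ∣ q ∣))
∣p∣≤∣p─q∣+∣q∣ (inside ∷ p)  (inside ∷ q)  =
  ℕ.≤-trans (s≤s (∣p∣≤∣p─q∣+∣q∣ p q)) (ℕ.≤-reflexive (≡.sym (ℕ.+-suc ∣ p ─ q ∣ ∣ q ∣)))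

∣p∪q∣≤ : (p q : Subset n) → ∣ p ∪ q ∣ ℕ.≤ ∣ p ∣ ℕ.+ ∣ q ∣
∣p∪q∣≤ []            []            = z≤n
∣p∪q∣≤ (outside ∷ p) (outside ∷ q) = ∣p∪q∣≤ p q
∣p∪q∣≤ (outside ∷ p) (inside ∷ q)  =
  ℕ.≤-trans (s≤s (∣p∪q∣≤ p q)) (ℕ.≤-reflexive (≡.sym (ℕ.+-suc ∣ p ∣ ∣ q ∣)))
∣p∪q∣≤ (inside ∷ p)  (outside ∷ q) = s≤s (∣p∪q∣≤ p q)
∣p∪q∣≤ (inside ∷ p)  (inside ∷ q)  =
  s≤s (ℕ.≤-trans (∣p∪q∣≤ p q) (ℕ.+-monoʳ-≤ ∣ p ∣ (ℕ.n≤1+n ∣ q ∣)))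

-- This bound carries the condition that a ground set has at least `2k` points from a weighting to
-- its differences.
∣∖∣ : (V : Subset n) (p : OrderedPair V) → ∣ V ∣ ℕ.≤ ∣ V ∖ p ∣ ℕ.+ 2
∣∖∣ V p@((x , y) , _) = ℕ.≤-trans (∣p∣≤∣p─q∣+∣q∣ V (⁅ x ⁆ ∪ ⁅ y ⁆)) (ℕ.+-monoʳ-≤ ∣ V ∖ p ∣
  (ℕ.≤-trans (∣p∪q∣≤ ⁅ x ⁆ ⁅ y ⁆) (ℕ.≤-reflexive (cong₂ ℕ._+_ (∣⁅x⁆∣≡1 x) (∣⁅x⁆∣≡1 y)))))

-- Sums are reindexed by the involution `toggle`, whereas `addFst` and `addSnd` form unions.
toggle-∪ : (A : Subset n) (x : Fin n) → lookup A x ≡ outside → toggle x A ≡ A ∪ ⁅ x ⁆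
toggle-∪ (outside ∷ A) zero    refl = cong (inside ∷_) (≡.sym (∪-identityʳ A))
toggle-∪ (outside ∷ A) (suc x) eq   = cong (outside ∷_) (toggle-∪ A x eq)
toggle-∪ (inside ∷ A)  (suc x) eq   = cong (inside ∷_) (toggle-∪ A x eq)

∣toggle∣ : (A : Subset n) (x : Fin n) → lookup A x ≡ outside → ∣ toggle x A ∣ ≡ ℕ.suc ∣ A ∣
∣toggle∣ (outside ∷ A) zero    refl = refl
∣toggle∣ (outside ∷ A) (suc x) eq   = ∣toggle∣ A x eq
∣toggle∣ (inside ∷ A)  (suc x) eq   = cong ℕ.suc (∣toggle∣ A x eq)

-- The reals as a commutative ring

-- `x ≈ y` unfolds to `Null` of the termwise differences, so that convergence estimates concern
-- rational sequences alone.
Null : (ℕ → ℚ) → Set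
Null s = ∀ ε → 0ℚ ℚ.< ε → ∃ λ N → ∀ n → N ℕ.≤ n → ℚ.∣ s n ∣ ℚ.< ε

Null-cong : ∀ {s t} → (∀ n → s n ≡ t n) → Null s → Null t
Null-cong s≡t s0 ε ε>0 with N , small ← s0 ε ε>0 =
  N , λ n n≥N → subst (λ q → ℚ.∣ q ∣ ℚ.< ε) (s≡t n) (small n n≥N)

Null-≤ : ∀ {s t} → (∀ n → ℚ.∣ s n ∣ ℚ.≤ ℚ.∣ t n ∣) → Null t → Null s
Null-≤ s≤t t0 ε ε>0 with N , small ← t0 ε ε>0 =
  N , λ n n≥N → ℚ.≤-<-trans (s≤t n) (small n n≥N)

Null-zero : Null (λ _ → 0ℚ)
Null-zero ε ε>0 = 0 , λ _ _ → ε>0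

½*-pos : ∀ {ε} → 0ℚ ℚ.< ε → 0ℚ ℚ.< ½ ℚ.* ε
½*-pos {ε} ε>0 = subst (ℚ._< ½ ℚ.* ε) (ℚ.*-zeroʳ ½) (ℚ.*-monoʳ-<-pos ½ ε>0)

½+½ : ∀ ε → ½ ℚ.* ε ℚ.+ ½ ℚ.* ε ≡ ε
½+½ ε = ≡.trans (≡.sym (ℚ.*-distribʳ-+ ε ½ ½)) (ℚ.*-identityˡ ε)

Null-+ : ∀ {s t} → Null s → Null t → Null (λ n → s n ℚ.+ t n)
Null-+ {s} {t} s0 t0 ε ε>0
  with M , small-s ← s0 _ (½*-pos ε>0) | N , small-t ← t0 _ (½*-pos ε>0) =
  M ℕ.⊔ N , λ n n≥ → ℚ.≤-<-trans (ℚ.∣p+q∣≤∣p∣+∣q∣ (s n) (t n))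
    (subst (ℚ.∣ s n ∣ ℚ.+ ℚ.∣ t n ∣ ℚ.<_) (½+½ ε)
      (ℚ.+-mono-< (small-s n (ℕ.m⊔n≤o⇒m≤o M N n≥)) (small-t n (ℕ.m⊔n≤o⇒n≤o M N n≥))))

Null-neg : ∀ {s} → Null s → Null (λ n → ℚ.- s n)
Null-neg {s} = Null-≤ λ n → ℚ.≤-reflexive (ℚ.∣-p∣≡∣p∣ (s n))

Null-* : ∀ {s} → Null s → (x : ℝ) → Null (λ n → s n ℚ.* seq x n)
Null-* {s} s0 x ε ε>0
  with K , close-K ← cauchy x 1ℚ (ℚ.positive⁻¹ 1ℚ) = go
  where
  -- From index `K` on, all terms stay within distance 1 of the `K`-th, so `B` bounds the tail of
  -- `x`.
  B = ℚ.∣ seq x K ∣ ℚ.+ 1ℚ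

  instance
    B>0 : ℚ.Positive B
    B>0 = ℚ.nonNeg+pos⇒pos ℚ.∣ seq x K ∣ {{ℚ.∣-∣-nonNeg (seq x K)}} 1ℚ
    B≢0 : ℚ.NonZero B
    B≢0 = ℚ.pos⇒nonZero B
    1/B>0 : ℚ.Positive (ℚ.1/ B)
    1/B>0 = ℚ.1/pos⇒pos B

  bound : ∀ n → K ℕ.≤ n → ℚ.∣ seq x n ∣ ℚ.≤ B
  bound n n≥K = ℚ.≤-trans
    (subst (λ q → ℚ.∣ q ∣ ℚ.≤ ℚ.∣ seq x K ∣ ℚ.+ ℚ.∣ seq x n ℚ.- seq x K ∣)
      (+-*-Solver.solve 2 (λ a c → c +-*-Solver.:+ (a +-*-Solver.:- c) +-*-Solver.:= a) refl (seq x n) (seq x K))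
      (ℚ.∣p+q∣≤∣p∣+∣q∣ (seq x K) (seq x n ℚ.- seq x K)))
    (ℚ.+-monoʳ-≤ ℚ.∣ seq x K ∣ (ℚ.<⇒≤ (close-K n K n≥K ℕ.≤-refl)))

  δ>0 : 0ℚ ℚ.< ε ℚ.* ℚ.1/ B
  δ>0 = subst (ℚ._< ε ℚ.* ℚ.1/ B) (ℚ.*-zeroˡ (ℚ.1/ B)) (ℚ.*-monoˡ-<-pos (ℚ.1/ B) ε>0)

  go : ∃ λ N → ∀ n → N ℕ.≤ n → ℚ.∣ s n ℚ.* seq x n ∣ ℚ.< ε
  go with N , small ← s0 _ δ>0 = K ℕ.⊔ N , λ n n≥ →
    subst (ℚ._< ε) (≡.sym (ℚ.∣p*q∣≡∣p∣*∣q∣ (s n) (seq x n))) (ℚ.≤-<-trans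
      (ℚ.*-monoˡ-≤-nonNeg ℚ.∣ s n ∣ {{ℚ.∣-∣-nonNeg (s n)}} (bound n (ℕ.m⊔n≤o⇒m≤o K N n≥)))
      (subst (ℚ.∣ s n ∣ ℚ.* B ℚ.<_)
        (≡.trans (ℚ.*-assoc ε (ℚ.1/ B) B) (≡.trans (cong (ε ℚ.*_) (ℚ.*-inverseˡ B)) (ℚ.*-identityʳ ε)))
        (ℚ.*-monoˡ-<-pos B (small n (ℕ.m⊔n≤o⇒n≤o K N n≥)))))

-- _≈_ unfolds to a function type, from which x and y cannot be inferred.
infix 4 _≃_
record _≃_ (x y : ℝ) : Set where
  constructor limit
  field difference-Null : x ≈ y
open _≃_

pointwise : ∀ {x y} → (∀ n → seq x n ≡ seq y n) → x ≃ y
pointwise {x} {y} x≡y = limit (Null-cong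
  (λ n → ≡.sym (≡.trans (cong (ℚ._- seq y n) (x≡y n)) (ℚ.+-inverseʳ (seq y n)))) Null-zero)

-- Sums and products of reals unfold to records containing convergence proofs; sealing them keeps
-- the unifier from comparing these.
infixl 6 _⊕_
infixl 7 _⊗_
infix  8 ⊝_
opaque
  _⊕_ _⊗_ : ℝ → ℝ → ℝ
  x ⊕ y = x + y
  x ⊗ y = x * y

  ⊝_ : ℝ → ℝ
  ⊝ x = - x

opaque
  unfolding _⊕_ _⊗_ ⊝_

  +≡⊕ : ∀ x y → x + y ≡ x ⊕ y
  +≡⊕ x y = refl

  *≡⊗ : ∀ x y → x * y ≡ x ⊗ y
  *≡⊗ x y = refl

  -≡⊝ : ∀ x → - x ≡ ⊝ x
  -≡⊝ x = refl

  -≃⊕⊝ : ∀ x y → x - y ≃ x ⊕ ⊝ y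
  -≃⊕⊝ x y = pointwise λ _ → refl

  ≃-sym : ∀ {x y} → x ≃ y → y ≃ x
  ≃-sym {x} {y} (limit d) = limit (Null-cong
    (λ n → solve 2 (λ a b → :- (a :- b) := b :- a) refl (seq x n) (seq y n)) (Null-neg d))
    where open +-*-Solver

  ≃-trans : ∀ {x y z} → x ≃ y → y ≃ z → x ≃ z
  ≃-trans {x} {y} {z} (limit d) (limit e) = limit (Null-cong
    (λ n → solve 3 (λ a b c → (a :- b) :+ (b :- c) := a :- c) refl (seq x n) (seq y n) (seq z n))
    (Null-+ d e))
    where open +-*-Solver

  ⊕-cong : ∀ {x x′ y y′} → x ≃ x′ → y ≃ y′ → x ⊕ y ≃ x′ ⊕ y′
  ⊕-cong {x} {x′} {y} {y′} (limit d) (limit e) = limit (Null-cong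
    (λ n → solve 4 (λ a a′ b b′ → (a :- a′) :+ (b :- b′) := (a :+ b) :- (a′ :+ b′)) refl
      (seq x n) (seq x′ n) (seq y n) (seq y′ n))
    (Null-+ d e))
    where open +-*-Solver

  ⊝-cong : ∀ {x x′} → x ≃ x′ → ⊝ x ≃ ⊝ x′
  ⊝-cong {x} {x′} (limit d) = limit (Null-cong
    (λ n → solve 2 (λ a b → :- (a :- b) := :- a :- (:- b)) refl (seq x n) (seq x′ n)) (Null-neg d))
    where open +-*-Solver

  ⊗-cong : ∀ {x x′ y y′} → x ≃ x′ → y ≃ y′ → x ⊗ y ≃ x′ ⊗ y′
  ⊗-cong {x} {x′} {y} {y′} (limit d) (limit e) = limit (Null-cong
    (λ n → solve 4 (λ a a′ b b′ → (a :- a′) :* b :+ (b :- b′) :* a′ := a :* b :- a′ :* b′) refl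
      (seq x n) (seq x′ n) (seq y n) (seq y′ n))
    (Null-+ (Null-* d y) (Null-* e x′)))
    where open +-*-Solver

  ℝ-isCommutativeRing : IsCommutativeRing _≃_ _⊕_ _⊗_ ⊝_ 0ℝ 1ℝ
  ℝ-isCommutativeRing = record
    { isRing = record
      { +-isAbelianGroup = record
        { isGroup = record
          { isMonoid = record
            { isSemigroup = record
              { isMagma = record
                { isEquivalence = record { refl = pointwise λ _ → refl ; sym = ≃-sym ; trans = ≃-trans }
                ; ∙-cong = ⊕-cong }
              ; assoc = λ x y z → pointwise λ n → ℚ.+-assoc (seq x n) (seq y n) (seq z n) }
            ; identity = (λ x → pointwise λ n → ℚ.+-identityˡ (seq x n))
                       , (λ x → pointwise λ n → ℚ.+-identityʳ (seq x n)) }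
          ; inverse = (λ x → pointwise λ n → ℚ.+-inverseˡ (seq x n))
                    , (λ x → pointwise λ n → ℚ.+-inverseʳ (seq x n))
          ; ⁻¹-cong = ⊝-cong }
        ; comm = λ x y → pointwise λ n → ℚ.+-comm (seq x n) (seq y n) }
      ; *-cong = ⊗-cong
      ; *-assoc = λ x y z → pointwise λ n → ℚ.*-assoc (seq x n) (seq y n) (seq z n)
      ; *-identity = (λ x → pointwise λ n → ℚ.*-identityˡ (seq x n))
                   , (λ x → pointwise λ n → ℚ.*-identityʳ (seq x n))
      ; distrib = (λ x y z → pointwise λ n → ℚ.*-distribˡ-+ (seq x n) (seq y n) (seq z n))
                , (λ x y z → pointwise λ n → ℚ.*-distribʳ-+ (seq x n) (seq y n) (seq z n)) }
    ; *-comm = λ x y → pointwise λ n → ℚ.*-comm (seq x n) (seq y n) }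

ℝ-commutativeRing : CommutativeRing 0ℓ 0ℓ
ℝ-commutativeRing = record { isCommutativeRing = ℝ-isCommutativeRing }

module ℝ-Ring = CommutativeRing ℝ-commutativeRing

opaque
  unfolding _⊕_ _⊗_ ⊝_

  fromℚ-* : ∀ p q → fromℚ (p ℚ.* q) ≃ fromℚ p ⊗ fromℚ q
  fromℚ-* p q = pointwise λ _ → refl

  fromℚ-homomorphism : ℚ.+-*-rawRing -Raw-AlmostCommutative⟶ fromCommutativeRing ℝ-commutativeRing
  fromℚ-homomorphism = record
    { ⟦_⟧ = fromℚ
    ; +-homo = λ _ _ → pointwise λ _ → refl
    ; *-homo = λ _ _ → pointwise λ _ → refl
    ; -‿homo = λ _ → pointwise λ _ → refl
    ; 0-homo = pointwise λ _ → refl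
    ; 1-homo = pointwise λ _ → refl }

-- Nonnegative sequences and zero products of reals

≈0⇒Null : ∀ {x} → x ≃ 0ℝ → Null (seq x)
≈0⇒Null {x} (limit d) = Null-cong (λ n → ℚ.+-identityʳ (seq x n)) d

Null⇒≈0 : ∀ {x} → Null (seq x) → x ≃ 0ℝ
Null⇒≈0 {x} d = limit (Null-cong (λ n → ≡.sym (ℚ.+-identityʳ (seq x n))) d)

-- Termwise, hence stronger than nonnegativity of the limit. Absolute values, squares and their sums
-- and maxima have it, and it makes comparison with a null sequence immediate.
NonNegative : ℝ → Set
NonNegative x = ∀ n → 0ℚ ℚ.≤ seq x n

squeeze : ∀ x y → NonNegative x → (∀ n → seq x n ℚ.≤ seq y n) → y ≃ 0ℝ → x ≃ 0ℝ
squeeze x y 0≤x x≤y y≃0 = Null⇒≈0 {x} (Null-≤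
  (λ n → ≡.subst₂ ℚ._≤_ (≡.sym (ℚ.0≤p⇒∣p∣≡p (0≤x n)))
    (≡.sym (ℚ.0≤p⇒∣p∣≡p (ℚ.≤-trans (0≤x n) (x≤y n)))) (x≤y n)) (≈0⇒Null {y} y≃0))

∑-NonNegative : {A : Set} (as : List A) (f : A → ℝ) → (∀ a → NonNegative (f a)) → NonNegative (∑ as f)
∑-NonNegative []       f 0≤f n = ℚ.≤-refl
∑-NonNegative (a ∷ as) f 0≤f n = ℚ.+-mono-≤ (0≤f a n) (∑-NonNegative as f 0≤f n)

-- Each summand is squeezed between zero and the whole sum.
∑≃0⇒≃0 : {A : Set} (as : List A) (f : A → ℝ) → (∀ a → NonNegative (f a)) → ∑ as f ≃ 0ℝ →
         ∀ a → a ∈ˡ as → f a ≃ 0ℝ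
∑≃0⇒≃0 (a ∷ as) f 0≤f ∑≃0 _ (here refl) = squeeze (f a) (∑ (a ∷ as) f) (0≤f a)
  (λ n → subst (ℚ._≤ seq (∑ (a ∷ as) f) n) (ℚ.+-identityʳ (seq (f a) n))
    (ℚ.+-monoʳ-≤ (seq (f a) n) (∑-NonNegative as f 0≤f n))) ∑≃0
∑≃0⇒≃0 (a ∷ as) f 0≤f ∑≃0 b (there b∈) = ∑≃0⇒≃0 as f 0≤f
  (squeeze (∑ as f) (∑ (a ∷ as) f) (∑-NonNegative as f 0≤f)
    (λ n → subst (ℚ._≤ seq (∑ (a ∷ as) f) n) (ℚ.+-identityˡ (seq (∑ as f) n))
      (ℚ.+-monoˡ-≤ (seq (∑ as f) n) (0≤f a n))) ∑≃0) b b∈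

p⊔-p-NonNegative : ∀ p → 0ℚ ℚ.≤ p ℚ.⊔ ℚ.- p
p⊔-p-NonNegative p with ℚ.≤-total 0ℚ p
... | inj₁ 0≤p = ℚ.≤-trans 0≤p (ℚ.p≤p⊔q p (ℚ.- p))
... | inj₂ p≤0 = ℚ.≤-trans (ℚ.neg-antimono-≤ p≤0) (ℚ.p≤q⊔p p (ℚ.- p))

∣p∣≤p⊔-p : ∀ p → ℚ.∣ p ∣ ℚ.≤ p ℚ.⊔ ℚ.- p
∣p∣≤p⊔-p p with ℚ.∣p∣≡p∨∣p∣≡-p p
... | inj₁ eq = subst (ℚ._≤ p ℚ.⊔ ℚ.- p) (≡.sym eq) (ℚ.p≤p⊔q p (ℚ.- p))
... | inj₂ eq = subst (ℚ._≤ p ℚ.⊔ ℚ.- p) (≡.sym eq) (ℚ.p≤q⊔p p (ℚ.- p))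

p*p-NonNegative : ∀ p → 0ℚ ℚ.≤ p ℚ.* p
p*p-NonNegative p with ℚ.≤-total 0ℚ p
... | inj₁ 0≤p = subst (ℚ._≤ p ℚ.* p) (ℚ.*-zeroʳ p) (ℚ.*-monoˡ-≤-nonNeg p {{ℚ.nonNegative 0≤p}} 0≤p)
... | inj₂ p≤0 = subst (ℚ._≤ p ℚ.* p) (ℚ.*-zeroʳ p) (ℚ.*-monoˡ-≤-nonPos p {{ℚ.nonPositive p≤0}} p≤0)

∣⊔∣< : ∀ p q {ε} → ℚ.∣ p ∣ ℚ.< ε → ℚ.∣ q ∣ ℚ.< ε → ℚ.∣ p ℚ.⊔ q ∣ ℚ.< ε
∣⊔∣< p q {ε} p< q< with ℚ.⊔-sel p q
... | inj₁ eq = subst (λ r → ℚ.∣ r ∣ ℚ.< ε) (≡.sym eq) p<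
... | inj₂ eq = subst (λ r → ℚ.∣ r ∣ ℚ.< ε) (≡.sym eq) q<

abs-NonNegative : ∀ x → NonNegative (abs x)
abs-NonNegative x n = p⊔-p-NonNegative (seq x n)

square-NonNegative : ∀ x → NonNegative (x * x)
square-NonNegative x n = p*p-NonNegative (seq x n)

abs≃0⇒≃0 : ∀ x → abs x ≃ 0ℝ → x ≃ 0ℝ
abs≃0⇒≃0 x h = Null⇒≈0 {x} (Null-≤
  (λ n → ℚ.≤-trans (∣p∣≤p⊔-p (seq x n)) (ℚ.≤-reflexive (≡.sym (ℚ.0≤p⇒∣p∣≡p (abs-NonNegative x n)))))
  (≈0⇒Null {abs x} h))

⊔≃0 : ∀ x y → x ≃ 0ℝ → y ≃ 0ℝ → x ⊔ y ≃ 0ℝ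
⊔≃0 x y x≃0 y≃0 = Null⇒≈0 {x ⊔ y} λ ε ε>0 →
  let M , small-x = ≈0⇒Null {x} x≃0 ε ε>0
      N , small-y = ≈0⇒Null {y} y≃0 ε ε>0
  in M ℕ.⊔ N , λ n n≥ → ∣⊔∣< (seq x n) (seq y n)
       (small-x n (ℕ.m⊔n≤o⇒m≤o M N n≥)) (small-y n (ℕ.m⊔n≤o⇒n≤o M N n≥))

≃0⇒abs≃0 : ∀ x → x ≃ 0ℝ → abs x ≃ 0ℝ
≃0⇒abs≃0 x x≃0 = ⊔≃0 x (- x) x≃0 (Null⇒≈0 { - x} (Null-neg (≈0⇒Null {x} x≃0)))

opaque
  unfolding _⊗_

  ⊗≃0⇒Null : ∀ x y → x ⊗ y ≃ 0ℝ → Null (λ n → seq x n ℚ.* seq y n)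
  ⊗≃0⇒Null x y (limit d) = Null-cong (λ n → ℚ.+-identityʳ (seq x n ℚ.* seq y n)) d

∣∣-far : ∀ p q ε → ε ℚ.≤ ℚ.∣ p ∣ → ℚ.∣ p ℚ.- q ∣ ℚ.< ½ ℚ.* ε → ½ ℚ.* ε ℚ.≤ ℚ.∣ q ∣
∣∣-far p q ε ε≤ d< = ℚ.≮⇒≥ λ q< → ℚ.<-irrefl refl (ℚ.≤-<-trans ε≤ (ℚ.≤-<-trans
  (subst (λ r → ℚ.∣ r ∣ ℚ.≤ ℚ.∣ q ∣ ℚ.+ ℚ.∣ p ℚ.- q ∣) (solve 2 (λ p q → q :+ (p :- q) := p) refl p q)
    (ℚ.∣p+q∣≤∣p∣+∣q∣ q (p ℚ.- q)))
  (subst (ℚ.∣ q ∣ ℚ.+ ℚ.∣ p ℚ.- q ∣ ℚ.<_) (½+½ ε) (ℚ.+-mono-< q< d<))))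
  where open +-*-Solver

∣∣-cancel : ∀ p q η ε → 0ℚ ℚ.< η → η ℚ.≤ ℚ.∣ p ∣ → ℚ.∣ p ℚ.* q ∣ ℚ.< η ℚ.* ε → ℚ.∣ q ∣ ℚ.< ε
∣∣-cancel p q η ε η>0 η≤ small = ℚ.*-cancelˡ-<-nonNeg η {{ℚ.nonNegative (ℚ.<⇒≤ η>0)}} (ℚ.≤-<-trans
  (subst (η ℚ.* ℚ.∣ q ∣ ℚ.≤_) (≡.sym (ℚ.∣p*q∣≡∣p∣*∣q∣ p q))
    (ℚ.*-monoʳ-≤-nonNeg ℚ.∣ q ∣ {{ℚ.∣-∣-nonNeg q}} η≤))
  small)

*-pos : ∀ p q → 0ℚ ℚ.< p → 0ℚ ℚ.< q → 0ℚ ℚ.< p ℚ.* q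
*-pos p q p>0 q>0 = subst (ℚ._< p ℚ.* q) (ℚ.*-zeroʳ p) (ℚ.*-monoʳ-<-pos p {{ℚ.positive p>0}} q>0)

module _ (em : ExcludedMiddle 0ℓ) where

  Apart : ℝ → Set
  Apart x = ∃ λ η → 0ℚ ℚ.< η × ∃ λ N → ∀ n → N ℕ.≤ n → η ℚ.≤ ℚ.∣ seq x n ∣

  -- If one late term has size at least `ε`, the Cauchy property keeps all late terms at size at
  -- least `½ ℚ.* ε`, which is apartness. So a real that is not apart from zero is a null sequence.
  ≃0-or-Apart : ∀ x → x ≃ 0ℝ ⊎ Apart x
  ≃0-or-Apart x with em {Apart x}
  ... | yes apart = inj₂ apart
  ... | no ¬apart = inj₁ (Null⇒≈0 {x} null)
    where
    null : Null (seq x)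
    null ε ε>0 with N , close-N ← cauchy x (½ ℚ.* ε) (½*-pos ε>0) =
      N , λ n n≥N → ℚ.≰⇒> λ ε≤∣x∣ → ¬apart
        (½ ℚ.* ε , ½*-pos ε>0 , N , λ m m≥N → ∣∣-far (seq x n) (seq x m) ε ε≤∣x∣ (close-N n m n≥N m≥N))

  -- Once `x` stays away from zero by `η`, the terms of `y` are bounded by those of the null product
  -- divided by `η`.
  ⊗≃0⇒≃0 : ∀ x y → x ⊗ y ≃ 0ℝ → x ≃ 0ℝ ⊎ y ≃ 0ℝ
  ⊗≃0⇒≃0 x y xy≃0 = cases (≃0-or-Apart x)
    where
    null : Apart x → Null (seq y)
    null (η , η>0 , N , η≤) ε ε>0
      with M , small ← ⊗≃0⇒Null x y xy≃0 (η ℚ.* ε) (*-pos η ε η>0 ε>0) =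
      N ℕ.⊔ M , λ n n≥ → ∣∣-cancel (seq x n) (seq y n) η ε η>0
        (η≤ n (ℕ.m⊔n≤o⇒m≤o N M n≥)) (small n (ℕ.m⊔n≤o⇒n≤o N M n≥))

    cases : x ≃ 0ℝ ⊎ Apart x → x ≃ 0ℝ ⊎ y ≃ 0ℝ
    cases (inj₁ x≃0)   = inj₁ x≃0
    cases (inj₂ apart) = inj₂ (Null⇒≈0 {y} (null apart))

  square≃0⇒≃0 : ∀ x → x ⊗ x ≃ 0ℝ → x ≃ 0ℝ
  square≃0⇒≃0 x xx≃0 with ⊗≃0⇒≃0 x x xx≃0
  ... | inj₁ x≃0 = x≃0
  ... | inj₂ x≃0 = x≃0

open SubsetSums ℝ-commutativeRing fromℚ-homomorphism
open Relation.Binary.Reasoning.Setoid ℝ-Ring.setoid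

-- Weightings

≡⇒≃ : ∀ {x y} → x ≡ y → x ≃ y
≡⇒≃ refl = ℝ-Ring.refl

-- The decision is an argument, so that proofs can match on it without unfolding the decision
-- procedure.
extendDec : {A : Set} {P : A → Set} → (Refinement A P → ℝ) → ∀ a → Dec (P a) → ℝ
extendDec f a (yes p) = f (a , Irrelevant.[ p ])
extendDec f a (no _)  = 0ℝ

extendDec-in : {A : Set} {P : A → Set} (f : Refinement A P → ℝ) {a : A} (d : Dec (P a)) (p : P a) →
               extendDec f a d ≡ f (a , Irrelevant.[ p ])
extendDec-in f (yes _) p = refl
extendDec-in f (no ¬p) p = contradiction p ¬p

extendDec-out : {A : Set} {P : A → Set} (f : Refinement A P → ℝ) {a : A} (d : Dec (P a)) → ¬ P a →
                extendDec f a d ≡ 0ℝ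
extendDec-out f (yes p) ¬p = contradiction p ¬p
extendDec-out f (no _)  ¬p = refl

+≃⊕ : ∀ x y → x + y ≃ x ⊕ y
+≃⊕ x y = ≡⇒≃ (+≡⊕ x y)

*≃⊗ : ∀ x y → x * y ≃ x ⊗ y
*≃⊗ x y = ≡⇒≃ (*≡⊗ x y)

module _ {A : Set} {P : A → Set} where

  extendDec-cong : (f g : Refinement A P → ℝ) → (∀ e → f e ≃ g e) → ∀ {a} (d : Dec (P a)) →
                   extendDec f a d ≃ extendDec g a d
  extendDec-cong f g f≃g (yes p) = f≃g (_ , Irrelevant.[ p ])
  extendDec-cong f g f≃g (no _)  = ℝ-Ring.refl

  extendDec-⊕ : (f g : Refinement A P → ℝ) → ∀ {a} (d : Dec (P a)) →
                extendDec (λ e → f e ⊕ g e) a d ≃ extendDec f a d ⊕ extendDec g a d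
  extendDec-⊕ f g (yes p) = ℝ-Ring.refl
  extendDec-⊕ f g (no _)  = ℝ-Ring.sym (ℝ-Ring.+-identityˡ 0ℝ)

  extendDec-⊗ : (f g : Refinement A P → ℝ) → ∀ {a} (d : Dec (P a)) →
                extendDec (λ e → f e ⊗ g e) a d ≃ extendDec f a d ⊗ extendDec g a d
  extendDec-⊗ f g (yes p) = ℝ-Ring.refl
  extendDec-⊗ f g (no _)  = ℝ-Ring.sym (ℝ-Ring.zeroˡ 0ℝ)

  extendDec-scale : (c : ℝ) (f : Refinement A P → ℝ) → ∀ {a} (d : Dec (P a)) →
                    extendDec (λ e → c ⊗ f e) a d ≃ c ⊗ extendDec f a d
  extendDec-scale c f (yes p) = ℝ-Ring.refl
  extendDec-scale c f (no _)  = ℝ-Ring.sym (ℝ-Ring.zeroʳ c)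

  extendDec-restrict : (F : A → ℝ) (f : Refinement A P → ℝ) → ∀ {a} (d : Dec (P a)) →
                       extendDec {P = P} (λ e → F (value e)) a d ⊗ extendDec f a d ≃ F a ⊗ extendDec f a d
  extendDec-restrict F f     (yes p) = ℝ-Ring.refl
  extendDec-restrict F f {a} (no _)  = ℝ-Ring.trans (ℝ-Ring.zeroʳ 0ℝ) (ℝ-Ring.sym (ℝ-Ring.zeroʳ (F a)))

∑≡sum : {A : Set} (xs : List A) (f : A → ℝ) → ∑ xs f ≡ sum xs f
∑≡sum xs f = List.foldr-cong (λ a s → +≡⊕ (f a) s) refl xs

sum-select : {A : Set} {P : A → Set} (P? : ∀ a → Dec (P a)) (xs : List A) (f : Refinement A P → ℝ) →
             sum (select P? xs) f ≃ sum xs (λ a → extendDec f a (P? a))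
sum-select P? []       f = ℝ-Ring.refl
sum-select P? (x ∷ xs) f with P? x
... | yes p = ℝ-Ring.+-congˡ (sum-select P? xs f)
... | no ¬p = ℝ-Ring.trans (sum-select P? xs f) (ℝ-Ring.sym (ℝ-Ring.+-identityˡ _))

sum-subsets : (F : Subset n → ℝ) → sum (subsets n) F ≃ S F
sum-subsets {ℕ.zero}  F = ℝ-Ring.+-identityʳ (F [])
sum-subsets {ℕ.suc n} F = begin
  sum (map (outside ∷_) (subsets n) ++ map (inside ∷_) (subsets n)) F
    ≈⟨ sum-++ (map (outside ∷_) (subsets n)) (map (inside ∷_) (subsets n)) F ⟩
  sum (map (outside ∷_) (subsets n)) F ⊕ sum (map (inside ∷_) (subsets n)) F
    ≈⟨ ℝ-Ring.+-cong (sum-map (outside ∷_) (subsets n) F) (sum-map (inside ∷_) (subsets n) F) ⟩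
  sum (subsets n) (F ∘ (outside ∷_)) ⊕ sum (subsets n) (F ∘ (inside ∷_))
    ≈⟨ ℝ-Ring.+-cong (sum-subsets (F ∘ (outside ∷_))) (sum-subsets (F ∘ (inside ∷_))) ⟩
  S (F ∘ (outside ∷_)) ⊕ S (F ∘ (inside ∷_)) ∎

foldr-homo : {X Y : Set} (_∙_ : Y → Y → Y) (ε : Y) (ℓ : Y → ℝ) →
             (∀ y z → ℓ (y ∙ z) ≃ ℓ y ⊕ ℓ z) → ℓ ε ≃ 0ℝ →
             (f : X → Y) (xs : List X) → ℓ (foldr (λ x y → f x ∙ y) ε xs) ≃ sum xs (λ x → ℓ (f x))
foldr-homo _∙_ ε ℓ additive ℓε≃0 f []       = ℓε≃0
foldr-homo _∙_ ε ℓ additive ℓε≃0 f (x ∷ xs) = ℝ-Ring.trans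
  (additive (f x) (foldr (λ x y → f x ∙ y) ε xs)) (ℝ-Ring.+-congˡ (foldr-homo _∙_ ε ℓ additive ℓε≃0 f xs))

kSubset? : (V : Subset n) (k : ℕ) (e : Subset n) → Dec (e ⊆ V × ∣ e ∣ ≡ k)
kSubset? V k e = (e ⊆? V) ×-dec (∣ e ∣ ℕ.≟ k)

⊗-swap : ∀ x y z → x ⊗ (y ⊗ z) ≃ y ⊗ (x ⊗ z)
⊗-swap x y z = ℝ-Ring.trans (ℝ-Ring.sym (ℝ-Ring.*-assoc x y z))
  (ℝ-Ring.trans (ℝ-Ring.*-congʳ (ℝ-Ring.*-comm x y)) (ℝ-Ring.*-assoc y x z))

module _ {V : Subset n} where

  ext : Weighting V k → Subset n → ℝ
  ext {k} w A = extendDec w A (kSubset? V k A)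

  ext-in : (w : Weighting V k) {A : Subset n} (p : A ⊆ V × ∣ A ∣ ≡ k) → ext w A ≡ w (A , Irrelevant.[ p ])
  ext-in {k} w {A} = extendDec-in w (kSubset? V k A)

  ext-out : (w : Weighting V k) {A : Subset n} → ¬ (A ⊆ V × ∣ A ∣ ≡ k) → ext w A ≡ 0ℝ
  ext-out {k} w {A} = extendDec-out w (kSubset? V k A)

  ext-cong : (w u : Weighting V k) → (∀ e → w e ≃ u e) → ∀ A → ext w A ≃ ext u A
  ext-cong {k} w u w≃u A = extendDec-cong w u w≃u (kSubset? V k A)

  ⊞-value : (w u : Weighting V k) (e : V ⁽ k ⁾) → (w ⊞ u) e ≃ w e ⊕ u e
  ⊞-value w u e = +≃⊕ (w e) (u e)

  •-value : (c : ℝ) (w : Weighting V k) (e : V ⁽ k ⁾) → (c • w) e ≃ c ⊗ w e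
  •-value c w e = *≃⊗ c (w e)

  ext-⊞ : (w u : Weighting V k) (A : Subset n) → ext (w ⊞ u) A ≃ ext w A ⊕ ext u A
  ext-⊞ {k} w u A = ℝ-Ring.trans
    (ext-cong (w ⊞ u) (λ e → w e ⊕ u e) (⊞-value w u) A)
    (extendDec-⊕ w u (kSubset? V k A))

  ext-• : (c : ℝ) (w : Weighting V k) (A : Subset n) → ext (c • w) A ≃ c ⊗ ext w A
  ext-• {k} c w A = ℝ-Ring.trans
    (ext-cong (c • w) (λ e → c ⊗ w e) (•-value c w) A)
    (extendDec-scale c w (kSubset? V k A))

  total-S : (w : Weighting V k) → total w ≃ S (ext w)
  total-S {k} w = ℝ-Ring.trans (≡⇒≃ (∑≡sum (kSubsets V k) w))
    (ℝ-Ring.trans (sum-select (kSubset? V k) (subsets n) w) (sum-subsets (ext w)))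

  inner-sum : (w u : Weighting V k) → ⟨ w , u ⟩ ≃ sum (kSubsets V k) (λ e → w e ⊗ u e)
  inner-sum {k} w u = ℝ-Ring.trans (≡⇒≃ (∑≡sum (kSubsets V k) (λ e → w e * u e)))
    (sum-cong (kSubsets V k) (λ e → (*≃⊗ (w e) (u e))))

  inner-S : (w u : Weighting V k) → ⟨ w , u ⟩ ≃ S (λ A → ext w A ⊗ ext u A)
  inner-S {k} w u = begin
    ⟨ w , u ⟩                                     ≈⟨ inner-sum w u ⟩
    sum (kSubsets V k) (λ e → w e ⊗ u e)          ≈⟨ sum-select (kSubset? V k) (subsets n) _ ⟩
    sum (subsets n) (ext (λ e → w e ⊗ u e))       ≈⟨ sum-subsets (ext (λ e → w e ⊗ u e)) ⟩
    S (ext (λ e → w e ⊗ u e))                     ≈⟨ S-cong {n} (λ A → extendDec-⊗ w u (kSubset? V k A)) ⟩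
    S (λ A → ext w A ⊗ ext u A)                   ∎

  opaque
    -- On the full ground set these are, up to `≃`, the generators of the `i`-th space, for `L`
    -- ranging over the configurations of `i` disjoint pairs.
    ψ : Pairs n → Weighting V k
    ψ L e = D L (value e)

    ψ-value : (L : Pairs n) (e : V ⁽ k ⁾) → ψ L e ≡ D L (value e)
    ψ-value L e = refl

    ext-ψ : (L : Pairs n) (w : Weighting V k) (A : Subset n) → ext {k} (ψ L) A ⊗ ext w A ≃ D L A ⊗ ext w A
    ext-ψ {k} L w A = extendDec-restrict (D L) w (kSubset? V k A)

  pairing : Pairs n → Weighting V k → ℝ
  pairing L w = S (λ A → D L A ⊗ ext w A)

  inner-ψ : (L : Pairs n) (w : Weighting V k) → ⟨ ψ L , w ⟩ ≃ pairing L w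
  inner-ψ L w = ℝ-Ring.trans (inner-S (ψ L) w) (S-cong {n} (ext-ψ L w))

  inner-comm : (w u : Weighting V k) → ⟨ w , u ⟩ ≃ ⟨ u , w ⟩
  inner-comm {k} w u = ℝ-Ring.trans (inner-sum w u)
    (ℝ-Ring.trans (sum-cong (kSubsets V k) (λ e → ℝ-Ring.*-comm (w e) (u e))) (ℝ-Ring.sym (inner-sum u w)))

  -- Collects what is needed to test a functional on a span by its values on generators.
  Linear : (Weighting V k → ℝ) → Set
  Linear {k} ℓ =
      ((w u : Weighting V k) → (∀ e → w e ≃ u e) → ℓ w ≃ ℓ u)
    × ((w u : Weighting V k) → ℓ (w ⊞ u) ≃ ℓ w ⊕ ℓ u)
    × ((c : ℝ) (w : Weighting V k) → ℓ (c • w) ≃ c ⊗ ℓ w)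

  module _ (ℓ : Weighting V k → ℝ) (ℓ-linear : Linear ℓ) where

    private
      respects = proj₁ ℓ-linear
      additive = proj₁ (proj₂ ℓ-linear)
      scalar   = proj₂ (proj₂ ℓ-linear)

    Linear-𝟎 : ℓ 𝟎 ≃ 0ℝ
    Linear-𝟎 = begin
      ℓ 𝟎            ≈⟨ respects 𝟎 (0ℝ • 𝟎) (λ e → ℝ-Ring.sym
                          (ℝ-Ring.trans (•-value 0ℝ 𝟎 e) (ℝ-Ring.zeroˡ (𝟎 e)))) ⟩
      ℓ (0ℝ • 𝟎)     ≈⟨ scalar 0ℝ 𝟎 ⟩
      0ℝ ⊗ ℓ 𝟎       ≈⟨ ℝ-Ring.zeroˡ (ℓ 𝟎) ⟩
      0ℝ             ∎

    Linear-sum : {X : Set} (xs : List X) (f : X → Weighting V k) → ℓ (⊞-sum xs f) ≃ sum xs (λ x → ℓ (f x))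
    Linear-sum xs f = foldr-homo _⊞_ 𝟎 ℓ additive Linear-𝟎 f xs

    Linear-Span : {I : Set} (f : I → Weighting V k) → (∀ i → ℓ (f i) ≃ 0ℝ) → ∀ u → Span f u → ℓ u ≃ 0ℝ
    Linear-Span f f≃0 u (cs , u≋) = begin
      ℓ u                                     ≈⟨ respects u (⊞-sum cs (λ (c , i) → c • f i)) (λ e → limit (u≋ e)) ⟩
      ℓ (⊞-sum cs (λ (c , i) → c • f i))      ≈⟨ Linear-sum cs (λ (c , i) → c • f i) ⟩
      sum cs (λ (c , i) → ℓ (c • f i))        ≈⟨ sum-0 cs (λ (c , i) → ℝ-Ring.trans (scalar c (f i))
                                                   (ℝ-Ring.trans (ℝ-Ring.*-congˡ (f≃0 i)) (ℝ-Ring.zeroʳ c))) ⟩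
      0ℝ                                      ∎

  pairing-Linear : (L : Pairs n) → Linear {k} (pairing L)
  pairing-Linear {k} L =
      (λ w u w≃u → S-cong {n} (λ A → ℝ-Ring.*-congˡ (ext-cong w u w≃u A)))
    , (λ w u → ℝ-Ring.trans
        (S-cong {n} (λ A → ℝ-Ring.trans (ℝ-Ring.*-congˡ (ext-⊞ w u A)) (ℝ-Ring.distribˡ (D L A) (ext w A) (ext u A))))
        (S-+ {n} (λ A → D L A ⊗ ext w A) (λ A → D L A ⊗ ext u A)))
    , (λ c w → ℝ-Ring.trans
        (S-cong {n} (λ A → ℝ-Ring.trans (ℝ-Ring.*-congˡ (ext-• c w A)) (⊗-swap (D L A) c (ext w A))))
        (S-* {n} c (λ A → D L A ⊗ ext w A)))

  inner-Linear : (w : Weighting V k) → Linear {k} (λ u → ⟨ w , u ⟩)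
  inner-Linear {k} w =
      (λ u v u≃v → via u v (sum-cong (kSubsets V k) (λ e → ℝ-Ring.*-congˡ (u≃v e))))
    , (λ u v → ℝ-Ring.trans (inner-sum w (u ⊞ v)) (ℝ-Ring.trans
        (sum-cong (kSubsets V k) (λ e → ℝ-Ring.trans (ℝ-Ring.*-congˡ (⊞-value u v e)) (ℝ-Ring.distribˡ (w e) (u e) (v e))))
        (ℝ-Ring.trans (sum-+ (kSubsets V k) (λ e → w e ⊗ u e) (λ e → w e ⊗ v e))
          (ℝ-Ring.sym (ℝ-Ring.+-cong (inner-sum w u) (inner-sum w v))))))
    , (λ c u → ℝ-Ring.trans (inner-sum w (c • u)) (ℝ-Ring.trans
        (sum-cong (kSubsets V k) (λ e → ℝ-Ring.trans (ℝ-Ring.*-congˡ (•-value c u e)) (⊗-swap (w e) c (u e))))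
        (ℝ-Ring.trans (sum-* (kSubsets V k) c (λ e → w e ⊗ u e))
          (ℝ-Ring.*-congˡ (ℝ-Ring.sym (inner-sum w u))))))
    where
    via : ∀ u v → sum (kSubsets V k) (λ e → w e ⊗ u e) ≃ sum (kSubsets V k) (λ e → w e ⊗ v e) →
          ⟨ w , u ⟩ ≃ ⟨ w , v ⟩
    via u v eq = ℝ-Ring.trans (inner-sum w u) (ℝ-Ring.trans eq (ℝ-Ring.sym (inner-sum w v)))

∈subsets : (A : Subset n) → A ∈ˡ subsets n
∈subsets []            = here refl
∈subsets (outside ∷ A) = ∈ˡ.∈-++⁺ˡ (∈ˡ.∈-map⁺ (outside ∷_) (∈subsets A))
∈subsets (inside ∷ A)  = ∈ˡ.∈-++⁺ʳ (map (outside ∷_) (subsets _)) (∈ˡ.∈-map⁺ (inside ∷_) (∈subsets A))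

-- The validity proof inside `e` is irrelevant and cannot be inspected, so a relevant one is
-- obtained by deciding the property again.
∈kSubsets : {V : Subset n} (e : V ⁽ k ⁾) → e ∈ˡ kSubsets V k
∈kSubsets {k = k} {V} (A , Irrelevant.[ p ]) with kSubset? V k A
... | yes p′ = select-complete (kSubset? V k) (∈subsets A) p′
... | no ¬p  = contradiction-irr p ¬p

-- Permuted weightings and zero discrepancy

ext-permute : (w : Weighting (⊤ {n}) k) (π : Permutation′ n) (A : Subset n) →
              ext (permute π w) A ≡ ext w (preimage π A)
ext-permute {n} {k} w π A = go (kSubset? ⊤ k A)
  where
  go : (d : Dec (A ⊆ ⊤ × ∣ A ∣ ≡ k)) → extendDec (permute π w) A d ≡ ext w (preimage π A)
  go (yes p) = ≡.sym (ext-in w {preimage π A} ((λ x∈ → ⊆-max _ x∈) , ≡.trans (∣preimage∣ π A) (proj₂ p)))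
  go (no ¬p) = ≡.sym (ext-out w {preimage π A} λ (_ , size) → ¬p ((λ x∈ → ⊆-max _ x∈) , ≡.trans (≡.sym (∣preimage∣ π A)) size))

pairing-permute : (L : Pairs n) (π : Permutation′ n) (w : Weighting (⊤ {n}) k) →
                  pairing L (permute π w) ≃ pairing (mapPairs (flip π ⟨$⟩ʳ_) L) w
pairing-permute {n} L π w = ℝ-Ring.trans
  (S-cong {n} (λ A → ℝ-Ring.*-cong
    (≡⇒≃ (≡.trans (cong (D L) (≡.sym (preimage-flipˡ π A))) (D-preimage (flip π) L (preimage π A))))
    (≡⇒≃ (ext-permute w π A))))
  (S-preimage π (λ A → D (mapPairs (flip π ⟨$⟩ʳ_) L) A ⊗ ext w A))

ext-Homogeneous : (w : Weighting (⊤ {n}) k) → Homogeneous k (ext w)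
ext-Homogeneous w A ∣A∣≢k = ≡⇒≃ (ext-out w {A} (∣A∣≢k ∘ proj₂))

inner-permute : (π : Permutation′ n) (w u : Weighting (⊤ {n}) k) →
                ⟨ permute π w , u ⟩ ≃ S (λ A → ext w (preimage π A) ⊗ ext u A)
inner-permute {n} π w u = ℝ-Ring.trans (inner-S (permute π w) u)
  (S-cong {n} (λ A → ℝ-Ring.*-congʳ (≡⇒≃ (ext-permute w π A))))

x-y≃0⇒x≃y : ∀ x y → x - y ≃ 0ℝ → x ≃ y
x-y≃0⇒x≃y x y h = begin
  x                ≈⟨ ℝ-Ring.+-identityʳ x ⟨
  x ⊕ 0ℝ           ≈⟨ ℝ-Ring.+-congˡ (ℝ-Ring.-‿inverseˡ y) ⟨
  x ⊕ (⊝ y ⊕ y)    ≈⟨ ℝ-Ring.+-assoc x (⊝ y) y ⟨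
  (x ⊕ ⊝ y) ⊕ y    ≈⟨ ℝ-Ring.+-congʳ (ℝ-Ring.trans (ℝ-Ring.sym (-≃⊕⊝ x y)) h) ⟩
  0ℝ ⊕ y           ≈⟨ ℝ-Ring.+-identityˡ y ⟩
  y                ∎

x≃y⇒x-y≃0 : ∀ x y → x ≃ y → x - y ≃ 0ℝ
x≃y⇒x-y≃0 x y x≃y = ℝ-Ring.trans (-≃⊕⊝ x y) (ℝ-Ring.trans (ℝ-Ring.+-congʳ x≃y) (ℝ-Ring.-‿inverseʳ y))

module _ {X Y : Set} (_∙_ : Y → Y → Y) (ε : Y) (f : X → Y) where

  foldr-map-preserves : (P : Y → Set) → P ε → (∀ y z → P y → P z → P (y ∙ z)) → (∀ x → P (f x)) →
                        ∀ xs → P (foldr _∙_ ε (map f xs))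
  foldr-map-preserves P Pε P∙ Pf []       = Pε
  foldr-map-preserves P Pε P∙ Pf (x ∷ xs) =
    P∙ (f x) (foldr _∙_ ε (map f xs)) (Pf x) (foldr-map-preserves P Pε P∙ Pf xs)

  foldr-map-reflects : (P Q : Y → Set) → P ε → (∀ y z → P y → P z → P (y ∙ z)) → (∀ x → P (f x)) →
                       (∀ y z → P y → P z → Q (y ∙ z) → Q y × Q z) →
                       ∀ xs → Q (foldr _∙_ ε (map f xs)) → ∀ {x} → x ∈ˡ xs → Q (f x)
  foldr-map-reflects P Q Pε P∙ Pf Q∙ (x ∷ xs) q x∈ =
    go x∈ (Q∙ (f x) (foldr _∙_ ε (map f xs)) (Pf x) (foldr-map-preserves P Pε P∙ Pf xs) q)
    where
    go : ∀ {y} → y ∈ˡ x ∷ xs → Q (f x) × Q (foldr _∙_ ε (map f xs)) → Q (f y)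
    go (here refl) (qx , _)  = qx
    go (there y∈)  (_ , qxs) = foldr-map-reflects P Q Pε P∙ Pf Q∙ xs qxs y∈

⊔-NonNegative : ∀ x y → NonNegative x → NonNegative y → NonNegative (x ⊔ y)
⊔-NonNegative x y 0≤x 0≤y i = ℚ.≤-trans (0≤x i) (ℚ.p≤p⊔q (seq x i) (seq y i))

⊔≃0⇒≃0 : ∀ x y → NonNegative x → NonNegative y → x ⊔ y ≃ 0ℝ → x ≃ 0ℝ × y ≃ 0ℝ
⊔≃0⇒≃0 x y 0≤x 0≤y h =
    squeeze x (x ⊔ y) 0≤x (λ i → ℚ.p≤p⊔q (seq x i) (seq y i)) h
  , squeeze y (x ⊔ y) 0≤y (λ i → ℚ.p≤q⊔p (seq x i) (seq y i)) h

module _ {A : Set} (f : A → ℝ) (0≤f : ∀ a → NonNegative (f a)) where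

  maximum≃0⇒≃0 : ∀ xs → foldr _⊔_ 0ℝ (map f xs) ≃ 0ℝ → ∀ a → a ∈ˡ xs → f a ≃ 0ℝ
  maximum≃0⇒≃0 xs max≃0 a a∈ =
    foldr-map-reflects _⊔_ 0ℝ f NonNegative (_≃ 0ℝ) (λ _ → ℚ.≤-refl) ⊔-NonNegative 0≤f ⊔≃0⇒≃0 xs max≃0 {a} a∈

  ≃0⇒maximum≃0 : ∀ xs → (∀ a → f a ≃ 0ℝ) → foldr _⊔_ 0ℝ (map f xs) ≃ 0ℝ
  ≃0⇒maximum≃0 xs f≃0 = foldr-map-preserves _⊔_ 0ℝ f (_≃ 0ℝ) ℝ-Ring.refl ⊔≃0 f≃0 xs

-- Leads from an arbitrary permutation to its representative in the list over which `disc` takes the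
-- maximum.
correlation-cong : (w u : Weighting (⊤ {n}) k) (ρ π : Permutation′ n) → ρ Perm.≈ π →
  S (λ A → ext w (preimage π A) ⊗ ext u A) ≃ S (λ A → ext w (preimage ρ A) ⊗ ext u A)
correlation-cong {n} w u ρ π ρ≈π =
  S-cong {n} (λ A → ℝ-Ring.*-congʳ (≡⇒≃ (cong (ext w) (≡.sym (preimage-cong {π = ρ} {π} ρ≈π A)))))

deviation≃0⇒≃ : ∀ x q → abs (x - q) ≃ 0ℝ → x ≃ q
deviation≃0⇒≃ x q h = x-y≃0⇒x≃y x q (abs≃0⇒≃0 (x - q) h)

≃⇒deviation≃0 : ∀ x q → x ≃ q → abs (x - q) ≃ 0ℝ
≃⇒deviation≃0 x q x≃q = ≃0⇒abs≃0 (x - q) (x≃y⇒x-y≃0 x q x≃q)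

deviations≃0⇒Uncorrelated : (q : ℝ) (w u : Weighting (⊤ {n}) k) →
  (∀ ρ → ρ ∈ˡ permutations n → abs (⟨ permute ρ w , u ⟩ - q) ≃ 0ℝ) → Uncorrelated q (ext w) (ext u)
deviations≃0⇒Uncorrelated {n} q w u zero-at π = go (permutations-complete π)
  where
  go : (∃ λ ρ → ρ ∈ˡ permutations n × ρ Perm.≈ π) → S (λ A → ext w (preimage π A) ⊗ ext u A) ≃ q
  go (ρ , ρ∈ , ρ≈π) = ℝ-Ring.trans (correlation-cong w u ρ π ρ≈π)
    (ℝ-Ring.trans (ℝ-Ring.sym (inner-permute ρ w u)) (deviation≃0⇒≃ ⟨ permute ρ w , u ⟩ q (zero-at ρ ρ∈)))

Uncorrelated⇒deviation≃0 : (q : ℝ) (w u : Weighting (⊤ {n}) k) → Uncorrelated q (ext w) (ext u) →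
                           ∀ ρ → abs (⟨ permute ρ w , u ⟩ - q) ≃ 0ℝ
Uncorrelated⇒deviation≃0 q w u h ρ =
  ≃⇒deviation≃0 ⟨ permute ρ w , u ⟩ q (ℝ-Ring.trans (inner-permute ρ w u) (h ρ))

disc≃0⇒Uncorrelated : (w u : Weighting (⊤ {n}) k) → disc w u ≃ 0ℝ →
                      Uncorrelated (density w * density u * fromℕ (n C k)) (ext w) (ext u)
disc≃0⇒Uncorrelated {n} {k} w u disc≃0 =
  deviations≃0⇒Uncorrelated (density w * density u * fromℕ (n C k)) w u
    (maximum≃0⇒≃0 (λ σ → abs (⟨ permute σ w , u ⟩ - density w * density u * fromℕ (n C k)))
      (λ σ → abs-NonNegative (⟨ permute σ w , u ⟩ - density w * density u * fromℕ (n C k)))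
      (permutations n) disc≃0)

Uncorrelated⇒disc≃0 : (w u : Weighting (⊤ {n}) k) →
                      Uncorrelated (density w * density u * fromℕ (n C k)) (ext w) (ext u) → disc w u ≃ 0ℝ
Uncorrelated⇒disc≃0 {n} {k} w u h = ≃0⇒maximum≃0
  (λ σ → abs (⟨ permute σ w , u ⟩ - density w * density u * fromℕ (n C k)))
  (λ σ → abs-NonNegative (⟨ permute σ w , u ⟩ - density w * density u * fromℕ (n C k)))
  (permutations n)
  (Uncorrelated⇒deviation≃0 (density w * density u * fromℕ (n C k)) w u h)

÷-≃0 : ∀ x m → x ≃ 0ℝ → x ÷ m ≃ 0ℝ
÷-≃0 x ℕ.zero    x≃0 = ℝ-Ring.refl
÷-≃0 x (ℕ.suc m) x≃0 = ℝ-Ring.trans (*≃⊗ x (fromℚ (ℤ.+ 1 ℚ./ ℕ.suc m)))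
  (ℝ-Ring.trans (ℝ-Ring.*-congʳ x≃0) (ℝ-Ring.zeroˡ (fromℚ (ℤ.+ 1 ℚ./ ℕ.suc m))))

*-≃0ˡ : ∀ x y → x ≃ 0ℝ → x * y ≃ 0ℝ
*-≃0ˡ x y x≃0 = ℝ-Ring.trans (*≃⊗ x y) (ℝ-Ring.trans (ℝ-Ring.*-congʳ x≃0) (ℝ-Ring.zeroˡ y))

*-≃0ʳ : ∀ x y → y ≃ 0ℝ → x * y ≃ 0ℝ
*-≃0ʳ x y y≃0 = ℝ-Ring.trans (*≃⊗ x y) (ℝ-Ring.trans (ℝ-Ring.*-congˡ y≃0) (ℝ-Ring.zeroʳ x))

density-≃0 : (w : Weighting (⊤ {n}) k) → pairing [] w ≃ 0ℝ → density w ≃ 0ℝ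
density-≃0 {n} {k} w h = ÷-≃0 (total w) (∣ ⊤ {n} ∣ C k)
  (ℝ-Ring.trans (total-S w) (ℝ-Ring.trans (S-cong {n} (λ A → ℝ-Ring.sym (ℝ-Ring.*-identityˡ (ext w A)))) h))

density-product-≃0ˡ : (w u : Weighting (⊤ {n}) k) → pairing [] w ≃ 0ℝ → density w * density u * fromℕ (n C k) ≃ 0ℝ
density-product-≃0ˡ {n} {k} w u h = *-≃0ˡ (density w * density u) (fromℕ (n C k))
  (*-≃0ˡ (density w) (density u) (density-≃0 w h))

density-product-≃0ʳ : (w u : Weighting (⊤ {n}) k) → pairing [] u ≃ 0ℝ → density w * density u * fromℕ (n C k) ≃ 0ℝ
density-product-≃0ʳ {n} {k} w u h = *-≃0ˡ (density w * density u) (fromℕ (n C k))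
  (*-≃0ʳ (density w) (density u) (density-≃0 u h))

-- The functions `φ` and the spaces they span

sign-step : ∀ a b m d → size a ℕ.+ size b ≡ 1 → [-1]^ m ≃ d → [-1]^ (size b ℕ.+ m) ≃ (𝟙 a ⊕ ⊝ 𝟙 b) ⊗ d
sign-step true false m d _ h =
  ℝ-Ring.trans h (ℝ-Ring.sym (ℝ-Ring.trans (ℝ-Ring.*-congʳ 1-0≈1) (ℝ-Ring.*-identityˡ d)))
sign-step false true m d _ h = ℝ-Ring.trans (*≃⊗ (- 1ℝ) ([-1]^ m))
  (ℝ-Ring.*-cong (ℝ-Ring.trans (≡⇒≃ (-≡⊝ 1ℝ)) (ℝ-Ring.sym (ℝ-Ring.+-identityˡ (⊝ 1ℝ)))) h)

vanish-step : ∀ a b d → size a ℕ.+ size b ≢ 1 → (𝟙 a ⊕ ⊝ 𝟙 b) ⊗ d ≃ 0ℝ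
vanish-step true  true  d _ = ℝ-Ring.trans (ℝ-Ring.*-congʳ (ℝ-Ring.-‿inverseʳ 1ℝ)) (ℝ-Ring.zeroˡ d)
vanish-step false false d _ = ℝ-Ring.trans (ℝ-Ring.*-congʳ (ℝ-Ring.-‿inverseʳ 0ℝ)) (ℝ-Ring.zeroˡ d)
vanish-step true  false d ≢1 = contradiction refl ≢1
vanish-step false true  d ≢1 = contradiction refl ≢1

module _ {K : Set} (x y : K → Fin n) (inj : Injective {A = K ⊎ K} _≡_ _≡_ [ x , y ]) (A : Subset n) where

  SplitBy : K → Set
  SplitBy j = ∣ A ∩ (⁅ x j ⁆ ∪ ⁅ y j ⁆) ∣ ≡ 1

  x≢y : ∀ j → x j ≢ y j
  x≢y j eq with () ← inj {inj₁ j} {inj₂ j} eq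

  -- A split pair contributes 1 or -1 to the product according to which of its points lies in `A`.
  -- As the points `y j` are distinct, the exponent counts the pairs contributing -1.
  sign≃D : ∀ js → Unique js → All SplitBy js →
           [-1]^ ∣ A ∩ ⋃ (map (λ j → ⁅ y j ⁆) js) ∣ ≃ D (pairsAt x y js) A
  sign≃D []       []          []            = ≡⇒≃ (cong [-1]^_ (∣∩⊥∣ A))
  sign≃D (j ∷ js) (j∉ ∷ js!) (split ∷ splits) = ℝ-Ring.trans
    (≡⇒≃ (cong [-1]^_ (∣∩⁅x⁆∪∣ A (⋃ (map (λ j → ⁅ y j ⁆) js)) (y j) (∉-⋃ y js (All.map y-distinct j∉)))))
    (sign-step (lookup A (x j)) (lookup A (y j)) ∣ A ∩ ⋃ (map (λ j → ⁅ y j ⁆) js) ∣ (D (pairsAt x y js) A)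
      (≡.trans (≡.sym (∣∩pair∣ A (x j) (y j) (x≢y j))) split) (sign≃D js js! splits))
    where
    y-distinct : ∀ {i} → j ≢ i → y j ≢ y i
    y-distinct {i} j≢i eq with refl ← inj {inj₂ j} {inj₂ i} eq = j≢i refl

  -- Some pair has both or neither of its points in `A`, and its factor vanishes.
  D≃0 : ∀ js → ¬ All SplitBy js → D (pairsAt x y js) A ≃ 0ℝ
  D≃0 []       ¬splits = contradiction [] ¬splits
  D≃0 (j ∷ js) ¬splits = go (∣ A ∩ (⁅ x j ⁆ ∪ ⁅ y j ⁆) ∣ ℕ.≟ 1)
    where
    go : Dec (SplitBy j) → D (pairsAt x y (j ∷ js)) A ≃ 0ℝ
    go (yes split) = ℝ-Ring.trans
      (ℝ-Ring.*-congˡ {𝟙 (lookup A (x j)) ⊕ ⊝ 𝟙 (lookup A (y j))} (D≃0 js (λ splits → ¬splits (split ∷ splits))))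
      (ℝ-Ring.zeroʳ (𝟙 (lookup A (x j)) ⊕ ⊝ 𝟙 (lookup A (y j))))
    go (no ¬split) = vanish-step (lookup A (x j)) (lookup A (y j)) (D (pairsAt x y js) A)
      (¬split ∘ ≡.trans (∣∩pair∣ A (x j) (y j) (x≢y j)))

Vanishes : ℕ → Weighting (⊤ {n}) k → Set
Vanishes {n} i w = (L : Pairs n) → Unique (points L) → length L ≡ i → pairing L w ≃ 0ℝ

firstPairs : (x y : Fin k → Fin n) → Fin (ℕ.suc k) → Pairs n
firstPairs {k} x y i = pairsAt x y (below k (toℕ i))

length-firstPairs : (x y : Fin k → Fin n) (i : Fin (ℕ.suc k)) → length (firstPairs x y i) ≡ toℕ i
length-firstPairs {k} x y i = ≡.trans (List.length-map _ (below k (toℕ i)))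
  (length-below k (toℕ i) (ℕ.s≤s⁻¹ (Fin.toℕ<n i)))

module _ {V : Subset n} where

  ⊞-sum-value : {X : Set} (xs : List X) (f : X → Weighting V k) (e : V ⁽ k ⁾) →
                (⊞-sum xs f) e ≃ sum xs (λ x → f x e)
  ⊞-sum-value xs f e = foldr-homo _⊞_ 𝟎 (λ w → w e) (λ w u → ⊞-value w u e) ℝ-Ring.refl f xs

  module _ {I : Set} (f : I → Weighting V k) where

    combination : List (ℝ × I) → V ⁽ k ⁾ → ℝ
    combination cs e = sum cs (λ ci → proj₁ ci ⊗ f (proj₂ ci) e)

    combination-value : (cs : List (ℝ × I)) (e : V ⁽ k ⁾) →
                        (⊞-sum cs (λ (c , i) → c • f i)) e ≃ combination cs e
    combination-value cs e = ℝ-Ring.trans (⊞-sum-value cs (λ (c , i) → c • f i) e)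
      (sum-cong cs (λ (c , i) → •-value c (f i) e))

    Span-intro : (cs : List (ℝ × I)) (u : Weighting V k) → (∀ e → u e ≃ combination cs e) → Span f u
    Span-intro cs u h = cs , λ e → _≃_.difference-Null (ℝ-Ring.trans (h e) (ℝ-Ring.sym (combination-value cs e)))

    Span-elim : (u : Weighting V k) (s : Span f u) (e : V ⁽ k ⁾) → u e ≃ combination (proj₁ s) e
    Span-elim u (cs , u≋) e = ℝ-Ring.trans (limit (u≋ e)) (combination-value cs e)

    Span-generator : (i : I) (u : Weighting V k) → (∀ e → u e ≃ f i e) → Span f u
    Span-generator i u u≃ = Span-intro ((1ℝ , i) ∷ []) u λ e → ℝ-Ring.trans (u≃ e)
      (ℝ-Ring.sym (ℝ-Ring.trans (ℝ-Ring.+-identityʳ (1ℝ ⊗ f i e)) (ℝ-Ring.*-identityˡ (f i e))))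

    Span-⊞ : (u v : Weighting V k) → Span f u → Span f v → Span f (u ⊞ v)
    Span-⊞ u v s t = Span-intro (proj₁ s ++ proj₁ t) (u ⊞ v) λ e → ℝ-Ring.trans (⊞-value u v e)
      (ℝ-Ring.trans (ℝ-Ring.+-cong (Span-elim u s e) (Span-elim v t e))
        (ℝ-Ring.sym (sum-++ (proj₁ s) (proj₁ t) (λ ci → proj₁ ci ⊗ f (proj₂ ci) e))))

    scale : ℝ → ℝ × I → ℝ × I
    scale c (d , i) = c ⊗ d , i

    combination-scale : ∀ c cs e → c ⊗ combination cs e ≃ combination (map (scale c) cs) e
    combination-scale c []             e = ℝ-Ring.zeroʳ c
    combination-scale c ((d , i) ∷ cs) e = ℝ-Ring.trans
      (ℝ-Ring.distribˡ c (d ⊗ f i e) (combination cs e))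
      (ℝ-Ring.+-cong (ℝ-Ring.sym (ℝ-Ring.*-assoc c d (f i e))) (combination-scale c cs e))

    Span-• : (c : ℝ) (u : Weighting V k) → Span f u → Span f (c • u)
    Span-• c u s = Span-intro (map (scale c) (proj₁ s)) (c • u) λ e → ℝ-Ring.trans (•-value c u e)
      (ℝ-Ring.trans (ℝ-Ring.*-congˡ (Span-elim u s e)) (combination-scale c (proj₁ s) e))

module _ (x y : Fin k → Fin n) (inj : Injective {A = Fin k ⊎ Fin k} _≡_ _≡_ [ x , y ]) where

  below-Unique : (i : Fin (ℕ.suc k)) → Unique (below k (toℕ i))
  below-Unique i = Unique.filter⁺ (λ j → toℕ j ℕ.<? toℕ i) (Unique.allFin⁺ k)

  firstPairs-Unique : (i : Fin (ℕ.suc k)) → Unique (points (firstPairs x y i))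
  firstPairs-Unique i = pairsAt-Unique inj (below-Unique i)

  φ-value : (i : Fin (ℕ.suc k)) (e : ⊤ {n} ⁽ k ⁾) → φ x y i e ≃ D (firstPairs x y i) (value e)
  φ-value i e = go (splits? x y i A)
    where
    A = value e
    go : (d : Dec (Splits x y i A)) →
         (if does d then [-1]^ ∣ A ∩ firstYs x y i ∣ else 0ℝ) ≃ D (firstPairs x y i) A
    go (yes splits) = sign≃D x y inj A (below k (toℕ i)) (below-Unique i)
      (All.tabulate λ {j} j∈ → splits j (proj₂ (∈ˡ.∈-filter⁻ (λ j → toℕ j ℕ.<? toℕ i) {xs = allFin k} j∈)))
    go (no ¬splits) = ℝ-Ring.sym (D≃0 x y inj A (below k (toℕ i)) λ splits → ¬splits λ j j<i →
      All.lookup splits (∈ˡ.∈-filter⁺ (λ j → toℕ j ℕ.<? toℕ i) (∈ˡ.∈-allFin j) j<i))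

  permute-φ : (π : Permutation′ n) (i : Fin (ℕ.suc k)) (e : ⊤ {n} ⁽ k ⁾) →
              permute π (φ x y i) e ≃ ψ (mapPairs (π ⟨$⟩ʳ_) (firstPairs x y i)) e
  permute-φ π i e = ℝ-Ring.trans (φ-value i (π ⁻¹⟨ e ⟩))
    (≡⇒≃ (≡.trans (D-preimage π (firstPairs x y i) (value e))
      (≡.sym (ψ-value (mapPairs (π ⟨$⟩ʳ_) (firstPairs x y i)) e))))

  -- By transitivity, every configuration of `i` disjoint pairs is a permuted copy of
  -- `firstPairs x y i`.
  𝕍-ψ : (i : Fin (ℕ.suc k)) (L : Pairs n) → Unique (points L) → length L ≡ toℕ i → 𝕍 x y i (ψ L)
  𝕍-ψ i L L! len = go (transitive (firstPairs x y i) L (≡.trans (length-firstPairs x y i) (≡.sym len))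
                        (firstPairs-Unique i) L!)
    where
    go : (∃ λ (π : Permutation′ n) → mapPairs (π ⟨$⟩ʳ_) (firstPairs x y i) ≡ L) → 𝕍 x y i (ψ L)
    go (π , refl) = Span-generator (λ π → permute π (φ x y i)) π (ψ L) (λ e → ℝ-Ring.sym (permute-φ π i e))

  𝕍-Linear : (i : Fin (ℕ.suc k)) (ℓ : Weighting (⊤ {n}) k → ℝ) → Linear ℓ →
             (∀ L → Unique (points L) → length L ≡ toℕ i → ℓ (ψ L) ≃ 0ℝ) →
             ∀ u → 𝕍 x y i u → ℓ u ≃ 0ℝ
  𝕍-Linear i ℓ ℓ-linear ℓψ≃0 = Linear-Span ℓ ℓ-linear (λ π → permute π (φ x y i)) λ π →
    ℝ-Ring.trans
      (proj₁ ℓ-linear (permute π (φ x y i)) (ψ (mapPairs (π ⟨$⟩ʳ_) (firstPairs x y i))) (permute-φ π i))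
      (ℓψ≃0 (mapPairs (π ⟨$⟩ʳ_) (firstPairs x y i))
        (Unique-mapPairs (Injection.injective (↔⇒↣ π)) (firstPairs x y i) (firstPairs-Unique i))
        (≡.trans (List.length-map _ (firstPairs x y i)) (length-firstPairs x y i)))

ext-ψ-level : (P : Pairs n) (A : Subset n) →
              ext {V = ⊤ {n}} {k} (ψ P) A ≃ 𝟙 (does (∣ A ∣ ℕ.≟ k)) ⊗ D P A
ext-ψ-level {n} {k} P A = go (kSubset? ⊤ k A) (∣ A ∣ ℕ.≟ k)
  where
  go : (d : Dec (A ⊆ ⊤ × ∣ A ∣ ≡ k)) (d′ : Dec (∣ A ∣ ≡ k)) → extendDec {P = λ e → e ⊆ ⊤ × ∣ e ∣ ≡ k} (ψ P) A d ≃ 𝟙 (does d′) ⊗ D P A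
  go (yes p) (yes _) = ℝ-Ring.trans (≡⇒≃ (ψ-value P (A , Irrelevant.[ p ]))) (ℝ-Ring.sym (ℝ-Ring.*-identityˡ (D P A)))
  go (no _)  (no _)  = ℝ-Ring.sym (ℝ-Ring.zeroˡ (D P A))
  go (yes p) (no ¬q) = contradiction (proj₂ p) ¬q
  go (no ¬p) (yes q) = contradiction {A = A ⊆ ⊤ × ∣ A ∣ ≡ k} ((λ x∈ → ⊆-max _ x∈) , q) ¬p

-- The restriction to k-sets is a function of the cardinality, hence an admissible weight in
-- `orthogonal`; whichever configuration is longer plays the antisymmetric part.
pairing-ψ : (L P : Pairs n) → Unique (points L) → Unique (points P) → length P ≢ length L →
            pairing {V = ⊤ {n}} {k} L (ψ P) ≃ 0ℝ
pairing-ψ {n} {k} L P L! P! P≢L = ℝ-Ring.trans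
  (S-cong {n} (λ A → ℝ-Ring.trans (ℝ-Ring.*-congˡ (ext-ψ-level P A)) (⊗-swap (D L A) (level ∣ A ∣) (D P A))))
  (cases (ℕ.<-cmp (length P) (length L)))
  where
  level : ℕ → ℝ
  level s = 𝟙 (does (s ℕ.≟ k))

  cases : Tri (length P ℕ.< length L) (length P ≡ length L) (length L ℕ.< length P) →
          S (λ A → level ∣ A ∣ ⊗ (D L A ⊗ D P A)) ≃ 0ℝ
  cases (tri< P<L _ _) = ℝ-Ring.trans
    (S-cong {n} (λ A → ℝ-Ring.*-congˡ (ℝ-Ring.*-comm (D L A) (D P A)))) (orthogonal level P L L! P<L)
  cases (tri≈ _ P≡L _) = contradiction P≡L P≢L
  cases (tri> _ _ L<P) = orthogonal level L P P! L<P

÷-NonNegative : ∀ x m → NonNegative x → NonNegative (x ÷ m)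
÷-NonNegative x ℕ.zero    0≤x i = ℚ.≤-refl
÷-NonNegative x (ℕ.suc m) 0≤x i = *-NonNegative (seq x i) (ℤ.+ 1 ℚ./ ℕ.suc m) (0≤x i)
  (ℚ.nonNegative⁻¹ (ℤ.+ 1 ℚ./ ℕ.suc m) {{ℚ.normalize-nonNeg 1 (ℕ.suc m)}})
  where
  *-NonNegative : ∀ p q → 0ℚ ℚ.≤ p → 0ℚ ℚ.≤ q → 0ℚ ℚ.≤ p ℚ.* q
  *-NonNegative p q 0≤p 0≤q = subst (ℚ._≤ p ℚ.* q) (ℚ.*-zeroʳ p) (ℚ.*-monoˡ-≤-nonNeg p {{ℚ.nonNegative 0≤p}} 0≤q)

÷≃0⇒≃0 : ∀ x m → ℕ.NonZero m → x ÷ m ≃ 0ℝ → x ≃ 0ℝ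
÷≃0⇒≃0 x (ℕ.suc m) _ h = cancel (ℤ.+ 1 ℚ./ ℕ.suc m) {{ℚ.pos⇒nonZero (ℤ.+ 1 ℚ./ ℕ.suc m) {{ℚ.normalize-pos 1 (ℕ.suc m)}}}} h
  where
  cancel : ∀ q → .{{_ : ℚ.NonZero q}} → x * fromℚ q ≃ 0ℝ → x ≃ 0ℝ
  cancel q xq≃0 = begin
    x                                    ≈⟨ ℝ-Ring.*-identityʳ x ⟨
    x ⊗ 1ℝ                               ≈⟨ ℝ-Ring.*-congˡ (≡⇒≃ (cong fromℚ (ℚ.*-inverseʳ q))) ⟨
    x ⊗ fromℚ (q ℚ.* ℚ.1/ q)             ≈⟨ ℝ-Ring.*-congˡ (fromℚ-* q (ℚ.1/ q)) ⟩
    x ⊗ (fromℚ q ⊗ fromℚ (ℚ.1/ q))       ≈⟨ ℝ-Ring.*-assoc x (fromℚ q) (fromℚ (ℚ.1/ q)) ⟨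
    (x ⊗ fromℚ q) ⊗ fromℚ (ℚ.1/ q)       ≈⟨ ℝ-Ring.*-congʳ (ℝ-Ring.trans (ℝ-Ring.sym (*≃⊗ x (fromℚ q))) xq≃0) ⟩
    0ℝ ⊗ fromℚ (ℚ.1/ q)                  ≈⟨ ℝ-Ring.zeroˡ (fromℚ (ℚ.1/ q)) ⟩
    0ℝ                                   ∎

W-NonNegative : {V : Subset n} (w : Weighting V k) (i : Fin (ℕ.suc k)) → NonNegative (W w i)
W-NonNegative {k = k} {V} w zero = ÷-NonNegative (abs (total w)) (∣ V ∣ C k) (abs-NonNegative (total w))
W-NonNegative {k = ℕ.suc k} {V} w (suc i) =
  ÷-NonNegative (∑ (orderedPairs V) (λ p → W (difference w p) i)) (∣ V ∣ ℕ.* (∣ V ∣ ℕ.∸ 1))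
    (∑-NonNegative (orderedPairs V) (λ p → W (difference w p) i) (λ p → W-NonNegative (difference w p) i))

-- Differences of weightings over an ordered pair

orderedPair? : (V : Subset n) (p : Fin n × Fin n) → Dec (proj₁ p ∈ V × proj₂ p ∈ V × proj₁ p ≢ proj₂ p)
orderedPair? V p = (proj₁ p ∈? V) ×-dec (proj₂ p ∈? V) ×-dec ¬? (proj₁ p Fin.≟ proj₂ p)

∈orderedPairs : {V : Subset n} (p : OrderedPair V) → p ∈ˡ orderedPairs V
∈orderedPairs {n} {V} ((x , y) , Irrelevant.[ h ]) with orderedPair? V (x , y)
... | yes h′ = select-complete (orderedPair? V) (∈ˡ.∈-cartesianProduct⁺ (∈ˡ.∈-allFin x) (∈ˡ.∈-allFin y)) h′
... | no ¬h  = contradiction-irr h ¬h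

difference-value : {V : Subset n} (w : Weighting V (ℕ.suc k)) (p : OrderedPair V) (e : (V ∖ p) ⁽ k ⁾) →
                   difference w p e ≃ w (addFst p e) ⊕ ⊝ w (addSnd p e)
difference-value w p e = -≃⊕⊝ (w (addFst p e)) (w (addSnd p e))

module _ {V : Subset n} (x y : Fin n) (x∈V : x ∈ V) (y∈V : y ∈ V) (x≢y : x ≢ y) where

  pair : OrderedPair V
  pair = (x , y) , Irrelevant.[ x∈V , y∈V , x≢y ]

  ∈∖⇒≢ : ∀ {z} → z ∈ V ∖ pair → x ≢ z × y ≢ z
  ∈∖⇒≢ z∈ =
      (λ { refl → ∉─ V (⁅ x ⁆ ∪ ⁅ y ⁆) (x∈p∪q⁺ (inj₁ (x∈⁅x⁆ x))) z∈ })
    , (λ { refl → ∉─ V (⁅ x ⁆ ∪ ⁅ y ⁆) (x∈p∪q⁺ {p = ⁅ x ⁆} (inj₂ (x∈⁅x⁆ y))) z∈ })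

  IsSubset : (V : Subset n) → ℕ → Subset n → Set
  IsSubset V k A = A ⊆ V × ∣ A ∣ ≡ k

  grow : ∀ {A z} → z ∈ V → lookup A z ≡ outside → IsSubset (V ∖ pair) k A → IsSubset V (ℕ.suc k) (A ∪ ⁅ z ⁆)
  grow {A = A} {z} z∈V z∉A (A⊆ , ∣A∣≡k) = sub
    , ≡.trans (cong ∣_∣ (≡.sym (toggle-∪ A z z∉A))) (≡.trans (∣toggle∣ A z z∉A) (cong ℕ.suc ∣A∣≡k))
    where
    sub : A ∪ ⁅ z ⁆ ⊆ V
    sub u∈ with x∈p∪q⁻ A ⁅ z ⁆ u∈
    ... | inj₁ u∈A = p─q⊆p V (⁅ x ⁆ ∪ ⁅ y ⁆) (A⊆ u∈A)
    ... | inj₂ u∈z = subst (_∈ V) (≡.sym (x∈⁅y⁆⇒x≡y z u∈z)) z∈V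

  shrink : ∀ {A z} → lookup A z ≡ outside → lookup A x ≡ outside → lookup A y ≡ outside →
           IsSubset V (ℕ.suc k) (A ∪ ⁅ z ⁆) → IsSubset (V ∖ pair) k A
  shrink {A = A} {z} z∉A x∉A y∉A (sub , size≡) =
      (λ {u} u∈A → x∈p∧x∉q⇒x∈p─q (sub (x∈p∪q⁺ (inj₁ u∈A))) (avoid u∈A))
    , ℕ.suc-injective (≡.trans (≡.sym (∣toggle∣ A z z∉A)) (≡.trans (cong ∣_∣ (toggle-∪ A z z∉A)) size≡))
    where
    absent : ∀ {u v} → lookup A v ≡ outside → u ∈ A → u ≢ v
    absent v∉A u∈A refl with () ← ≡.trans (≡.sym (lookup-∈ u∈A)) v∉A

    avoid : ∀ {u} → u ∈ A → u ∉ ⁅ x ⁆ ∪ ⁅ y ⁆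
    avoid u∈A u∈xy with x∈p∪q⁻ ⁅ x ⁆ ⁅ y ⁆ u∈xy
    ... | inj₁ u∈x = absent x∉A u∈A (x∈⁅y⁆⇒x≡y x u∈x)
    ... | inj₂ u∈y = absent y∉A u∈A (x∈⁅y⁆⇒x≡y y u∈y)

  module _ (w : Weighting V (ℕ.suc k)) where

    ext-difference-out : (A : Subset n) → x ∈ A ⊎ y ∈ A → ext (difference w pair) A ≡ 0ℝ
    ext-difference-out A meets = ext-out (difference w pair) {A} λ (A⊆ , _) → impossible meets A⊆
      where
      impossible : x ∈ A ⊎ y ∈ A → ¬ A ⊆ V ∖ pair
      impossible (inj₁ x∈A) A⊆ = proj₁ (∈∖⇒≢ (A⊆ x∈A)) refl
      impossible (inj₂ y∈A) A⊆ = proj₂ (∈∖⇒≢ (A⊆ y∈A)) refl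

    addFst-value : (A : Subset n) (q : IsSubset (V ∖ pair) k A) (qx : IsSubset V (ℕ.suc k) (A ∪ ⁅ x ⁆)) →
                   w (addFst pair (A , Irrelevant.[ q ])) ≡ w (A ∪ ⁅ x ⁆ , Irrelevant.[ qx ])
    addFst-value A q qx = refl

    addSnd-value : (A : Subset n) (q : IsSubset (V ∖ pair) k A) (qy : IsSubset V (ℕ.suc k) (A ∪ ⁅ y ⁆)) →
                   w (addSnd pair (A , Irrelevant.[ q ])) ≡ w (A ∪ ⁅ y ⁆ , Irrelevant.[ qy ])
    addSnd-value A q qy = refl

    -- With `x` and `y` outside `A`, being a k-subset of the smaller ground set is equivalent to
    -- either enlarged set being a (k+1)-subset of `V`; so the extensions by zero on the two sides
    -- agree.
    ext-difference : (A : Subset n) → lookup A x ≡ outside → lookup A y ≡ outside →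
                     ext (difference w pair) A ≃ ext w (toggle x A) ⊕ ⊝ ext w (toggle y A)
    ext-difference A x∉A y∉A = go (kSubset? (V ∖ pair) k A)
      where
      at-toggle : ∀ z {r} → lookup A z ≡ outside → ext w (A ∪ ⁅ z ⁆) ≡ r → ext w (toggle z A) ≡ r
      at-toggle z z∉A eq = ≡.trans (cong (ext w) (toggle-∪ A z z∉A)) eq

      go : Dec (IsSubset (V ∖ pair) k A) →
           ext (difference w pair) A ≃ ext w (toggle x A) ⊕ ⊝ ext w (toggle y A)
      go (yes q) = ℝ-Ring.trans (≡⇒≃ (ext-in (difference w pair) {A} q))
        (ℝ-Ring.trans (difference-value w pair (A , Irrelevant.[ q ]))
          (ℝ-Ring.sym (ℝ-Ring.+-cong
            (≡⇒≃ (at-toggle x x∉A (≡.trans (ext-in w {A ∪ ⁅ x ⁆} (grow x∈V x∉A q))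
              (≡.sym (addFst-value A q (grow x∈V x∉A q))))))
            (ℝ-Ring.-‿cong (≡⇒≃ (at-toggle y y∉A (≡.trans (ext-in w {A ∪ ⁅ y ⁆} (grow y∈V y∉A q))
              (≡.sym (addSnd-value A q (grow y∈V y∉A q))))))))))
      go (no ¬q) = ℝ-Ring.trans (≡⇒≃ (ext-out (difference w pair) {A} ¬q))
        (ℝ-Ring.sym (ℝ-Ring.trans (ℝ-Ring.+-cong
            (≡⇒≃ (at-toggle x x∉A (ext-out w {A ∪ ⁅ x ⁆} (¬q ∘ shrink x∉A x∉A y∉A))))
            (ℝ-Ring.-‿cong (≡⇒≃ (at-toggle y y∉A (ext-out w {A ∪ ⁅ y ⁆} (¬q ∘ shrink y∉A x∉A y∉A))))))
          (ℝ-Ring.-‿inverseʳ 0ℝ)))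

    -- The inductive step for the W-vector: a difference of `w` is traded for one more pair. Sets
    -- containing `x` or `y` contribute nothing to either side, by the factor left over from
    -- `S-difference` on one and by the extension by zero on the other.
    pairing-difference : (L : Pairs n) → All (_∈ V ∖ pair) (points L) →
                         pairing L (difference w pair) ≃ pairing ((x , y) ∷ L) w
    pairing-difference L L⊆ = ℝ-Ring.sym (ℝ-Ring.trans
      (S-difference x y x≢y L (All.map (λ z∈ → proj₁ (∈∖⇒≢ z∈)) L⊆) (All.map (λ z∈ → proj₂ (∈∖⇒≢ z∈)) L⊆) (ext w))
      (S-cong {n} (λ A → go A (lookup A x) (lookup A y) refl refl)))
      where
      vanish : ∀ s d r e → s ≃ 0ℝ → e ≡ 0ℝ → s ⊗ (d ⊗ r) ≃ d ⊗ e
      vanish s d r e s≃0 refl = ℝ-Ring.trans (ℝ-Ring.*-congʳ s≃0)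
        (ℝ-Ring.trans (ℝ-Ring.zeroˡ (d ⊗ r)) (ℝ-Ring.sym (ℝ-Ring.zeroʳ d)))

      go : ∀ A a b → lookup A x ≡ a → lookup A y ≡ b →
           (𝟙 (not a) ⊗ 𝟙 (not b)) ⊗ (D L A ⊗ (ext w (toggle x A) ⊕ ⊝ ext w (toggle y A)))
           ≃ D L A ⊗ ext (difference w pair) A
      go A outside outside x∉A y∉A = ℝ-Ring.trans
        (ℝ-Ring.trans (ℝ-Ring.*-congʳ (ℝ-Ring.*-identityˡ 1ℝ))
          (ℝ-Ring.*-identityˡ (D L A ⊗ (ext w (toggle x A) ⊕ ⊝ ext w (toggle y A)))))
        (ℝ-Ring.*-congˡ (ℝ-Ring.sym (ext-difference A x∉A y∉A)))
      go A inside b x∈A _ = vanish (0ℝ ⊗ 𝟙 (not b)) (D L A)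
        (ext w (toggle x A) ⊕ ⊝ ext w (toggle y A)) (ext (difference w pair) A)
        (ℝ-Ring.zeroˡ (𝟙 (not b))) (ext-difference-out A (inj₁ (Vec.lookup⇒[]= x A x∈A)))
      go A outside inside _ y∈A = vanish (1ℝ ⊗ 0ℝ) (D L A)
        (ext w (toggle x A) ⊕ ⊝ ext w (toggle y A)) (ext (difference w pair) A)
        (ℝ-Ring.zeroʳ 1ℝ) (ext-difference-out A (inj₂ (Vec.lookup⇒[]= y A y∈A)))

-- The W-vector

-- The configurations are confined to `V`, which will be the ground set of an iterated difference.
VanishesOn : (V : Subset n) → ℕ → Weighting V k → Set
VanishesOn {n} V i w = (L : Pairs n) → Unique (points L) → All (_∈ V) (points L) → length L ≡ i → pairing L w ≃ 0ℝ

pairing-[] : {V : Subset n} (w : Weighting V k) → pairing [] w ≃ total w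
pairing-[] {n} w = ℝ-Ring.trans (S-cong {n} (λ A → ℝ-Ring.*-identityˡ (ext w A))) (ℝ-Ring.sym (total-S w))

square-NonZero : ∀ k m → ℕ.suc k ℕ.* 2 ℕ.≤ m → ℕ.NonZero (m ℕ.* (m ℕ.∸ 1))
square-NonZero k (ℕ.suc (ℕ.suc m)) _ = _
square-NonZero k (ℕ.suc ℕ.zero) (s≤s ())

∣∖∣-bound : (V : Subset n) (p : OrderedPair V) → ∀ k → ℕ.suc k ℕ.* 2 ℕ.≤ ∣ V ∣ → k ℕ.* 2 ℕ.≤ ∣ V ∖ p ∣
∣∖∣-bound V p k h = ℕ.+-cancelʳ-≤ 2 (k ℕ.* 2) ∣ V ∖ p ∣
  (ℕ.≤-trans (ℕ.≤-reflexive (ℕ.+-comm (k ℕ.* 2) 2)) (ℕ.≤-trans h (∣∖∣ V p)))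

k≤2k : ∀ {m} k → k ℕ.* 2 ℕ.≤ m → k ℕ.≤ m
k≤2k k = ℕ.≤-trans (ℕ.m≤m*n k 2)

-- An average of nonnegative entries is zero only if all of them are. The bound on `∣ V ∣` makes the
-- divisor nonzero; division by zero yields `0ℝ` by convention and would say nothing about the
-- entries.
W-suc≃0⇒ : {V : Subset n} (w : Weighting V (ℕ.suc k)) → ℕ.suc k ℕ.* 2 ℕ.≤ ∣ V ∣ → (i : Fin (ℕ.suc k)) →
           W w (suc i) ≃ 0ℝ → ∀ p → W (difference w p) i ≃ 0ℝ
W-suc≃0⇒ {k = k} {V} w 2k≤ i h p =
  ∑≃0⇒≃0 (orderedPairs V) (λ p → W (difference w p) i) (λ p → W-NonNegative (difference w p) i)
    (÷≃0⇒≃0 (∑ (orderedPairs V) (λ p → W (difference w p) i)) (∣ V ∣ ℕ.* (∣ V ∣ ℕ.∸ 1))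
      (square-NonZero k ∣ V ∣ 2k≤) h)
    p (∈orderedPairs p)

W-suc≃0⇐ : {V : Subset n} (w : Weighting V (ℕ.suc k)) (i : Fin (ℕ.suc k)) →
           (∀ p → W (difference w p) i ≃ 0ℝ) → W w (suc i) ≃ 0ℝ
W-suc≃0⇐ {V = V} w i h =
  ÷-≃0 (∑ (orderedPairs V) (λ p → W (difference w p) i)) (∣ V ∣ ℕ.* (∣ V ∣ ℕ.∸ 1))
    (ℝ-Ring.trans (≡⇒≃ (∑≡sum (orderedPairs V) (λ p → W (difference w p) i))) (sum-0 (orderedPairs V) h))

avoid-pair : {V : Subset n} (x y : Fin n) (x∈V : x ∈ V) (y∈V : y ∈ V) (x≢y : x ≢ y) (L : Pairs n) →
             All (x ≢_) (points L) → All (y ≢_) (points L) → All (_∈ V) (points L) →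
             All (_∈ V ∖ pair x y x∈V y∈V x≢y) (points L)
avoid-pair x y x∈V y∈V x≢y L x∉L y∉L L⊆V = All.zipWith
  (λ (z∈V , x≢z , y≢z) → x∈p∧x∉q⇒x∈p─q z∈V (outside-pair x≢z y≢z)) (L⊆V , All.zip (x∉L , y∉L))
  where
  outside-pair : ∀ {z} → x ≢ z → y ≢ z → z ∉ ⁅ x ⁆ ∪ ⁅ y ⁆
  outside-pair x≢z y≢z z∈ with x∈p∪q⁻ ⁅ x ⁆ ⁅ y ⁆ z∈
  ... | inj₁ z∈x = x≢z (≡.sym (x∈⁅y⁆⇒x≡y x z∈x))
  ... | inj₂ z∈y = y≢z (≡.sym (x∈⁅y⁆⇒x≡y y z∈y))

module _ {V : Subset n} (x y : Fin n) (x∈V : x ∈ V) (y∈V : y ∈ V) (x≢y : x ≢ y) (i : ℕ) (w : Weighting V (ℕ.suc k)) where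

  VanishesOn-difference⇒ : VanishesOn (V ∖ pair x y x∈V y∈V x≢y) i (difference w (pair x y x∈V y∈V x≢y)) →
    (L : Pairs n) → Unique (points L) → All (_∈ V ∖ pair x y x∈V y∈V x≢y) (points L) →
    length L ≡ i → pairing ((x , y) ∷ L) w ≃ 0ℝ
  VanishesOn-difference⇒ h L L! L⊆ len = transfer (h L L! L⊆ len)
    where
    transfer : pairing L (difference w (pair x y x∈V y∈V x≢y)) ≃ 0ℝ → pairing ((x , y) ∷ L) w ≃ 0ℝ
    transfer h = ℝ-Ring.trans (ℝ-Ring.sym (pairing-difference x y x∈V y∈V x≢y w L L⊆)) h

  VanishesOn-difference⇐ : VanishesOn V (ℕ.suc i) w →
    VanishesOn (V ∖ pair x y x∈V y∈V x≢y) i (difference w (pair x y x∈V y∈V x≢y))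
  VanishesOn-difference⇐ h L L! L⊆ len = ℝ-Ring.trans (pairing-difference x y x∈V y∈V x≢y w L L⊆)
    (h ((x , y) ∷ L)
      ((x≢y ∷ All.map (λ z∈ → proj₁ (∈∖⇒≢ x y x∈V y∈V x≢y z∈)) L⊆)
        ∷ All.map (λ z∈ → proj₂ (∈∖⇒≢ x y x∈V y∈V x≢y z∈)) L⊆ ∷ L!)
      (x∈V ∷ y∈V ∷ All.map (p─q⊆p V (⁅ x ⁆ ∪ ⁅ y ⁆)) L⊆)
      (cong ℕ.suc len))

-- Removing the first pair of `L` passes to the corresponding difference, whose entry vanishes along
-- with the average. When no pair is left, entry 0 is the absolute value of the total over a nonzero
-- binomial coefficient.
W≃0⇒VanishesOn : {V : Subset n} (w : Weighting V k) → k ℕ.* 2 ℕ.≤ ∣ V ∣ → (i : Fin (ℕ.suc k)) →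
                 W w i ≃ 0ℝ → VanishesOn V (toℕ i) w
W≃0⇒VanishesOn {k = k} {V} w 2k≤ zero h [] _ _ _ = ℝ-Ring.trans (pairing-[] w)
  (abs≃0⇒≃0 (total w) (÷≃0⇒≃0 (abs (total w)) (∣ V ∣ C k) (C-NonZero ∣ V ∣ k (k≤2k k 2k≤)) h))
W≃0⇒VanishesOn {k = ℕ.suc k} {V} w 2k≤ (suc i) h ((x , y) ∷ L)
  ((x≢y ∷ x∉L) ∷ y∉L ∷ L!) (x∈V ∷ y∈V ∷ L⊆V) len =
  VanishesOn-difference⇒ x y x∈V y∈V x≢y (toℕ i) w
    (W≃0⇒VanishesOn (difference w (pair x y x∈V y∈V x≢y)) (∣∖∣-bound V (pair x y x∈V y∈V x≢y) k 2k≤) i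
      (W-suc≃0⇒ w 2k≤ i h (pair x y x∈V y∈V x≢y)))
    L L! (avoid-pair x y x∈V y∈V x≢y L x∉L y∉L L⊆V) (ℕ.suc-injective len)

VanishesOn⇒W≃0 : {V : Subset n} (w : Weighting V k) → k ℕ.* 2 ℕ.≤ ∣ V ∣ → (i : Fin (ℕ.suc k)) →
                 VanishesOn V (toℕ i) w → W w i ≃ 0ℝ
VanishesOn⇒W≃0 {k = k} {V} w 2k≤ zero h = ÷-≃0 (abs (total w)) (∣ V ∣ C k)
  (≃0⇒abs≃0 (total w) (ℝ-Ring.trans (ℝ-Ring.sym (pairing-[] w)) (h [] [] [] refl)))
VanishesOn⇒W≃0 {k = ℕ.suc k} {V} w 2k≤ (suc i) h =
  W-suc≃0⇐ w i (λ p → each p (orderedPair? V (value p)))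
  where
  each : ∀ p → Dec (proj₁ (value p) ∈ V × proj₂ (value p) ∈ V × proj₁ (value p) ≢ proj₂ (value p)) →
         W (difference w p) i ≃ 0ℝ
  each (_ , Irrelevant.[ g ]) (no ¬g) = contradiction-irr g ¬g
  -- Ordered pairs with the same endpoints coincide, as their validity proofs are irrelevant; so the
  -- freshly decided proofs may be used.
  each ((x , y) , g) (yes (x∈V , y∈V , x≢y)) = transport (pair x y x∈V y∈V x≢y) ((x , y) , g) refl
    (VanishesOn⇒W≃0 (difference w (pair x y x∈V y∈V x≢y)) (∣∖∣-bound V (pair x y x∈V y∈V x≢y) k 2k≤) i
      (VanishesOn-difference⇐ x y x∈V y∈V x≢y (toℕ i) w h))
    where
    transport : ∀ p q → p ≡ q → W (difference w p) i ≃ 0ℝ → W (difference w q) i ≃ 0ℝ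
    transport p q refl h = h

-- Orthogonality, discrepancy and existence of the decomposition

open _≃_ using (difference-Null)

extendDec-value : {A : Set} {P : A → Set} (f : Refinement A P → ℝ) (e : Refinement A P) (d : Dec (P (value e))) →
                  extendDec f (value e) d ≡ f e
extendDec-value f e                       (yes _) = refl
extendDec-value f (_ , Irrelevant.[ p ]) (no ¬p) = contradiction-irr p ¬p

ext-value : {V : Subset n} (w : Weighting V k) (e : V ⁽ k ⁾) → ext w (value e) ≡ w e
ext-value {k = k} {V} w e = extendDec-value w e (kSubset? V k (value e))

-- A vanishing sum of squares; excluded middle enters in passing from a zero square to a zero value.
inner-self≃0⇒≃0 : ExcludedMiddle 0ℓ → {V : Subset n} (w : Weighting V k) → ⟨ w , w ⟩ ≃ 0ℝ → ∀ e → w e ≃ 0ℝ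
inner-self≃0⇒≃0 {k = k} em {V} w h e = square≃0⇒≃0 em (w e) (ℝ-Ring.trans (ℝ-Ring.sym (*≃⊗ (w e) (w e)))
  (∑≃0⇒≃0 (kSubsets V k) (λ e → w e * w e) (λ e → square-NonNegative (w e)) h e (∈kSubsets e)))

Vanishes-permute : (i : ℕ) (w : Weighting (⊤ {n}) k) (π : Permutation′ n) → Vanishes i w → Vanishes i (permute π w)
Vanishes-permute i w π h L L! len = ℝ-Ring.trans (pairing-permute L π w)
  (h (mapPairs (flip π ⟨$⟩ʳ_) L) (Unique-mapPairs (Injection.injective (↔⇒↣ (flip π))) L L!)
    (≡.trans (List.length-map _ L) len))

Vanishes-≃0 : (i : ℕ) (w : Weighting (⊤ {n}) k) → (∀ e → w e ≃ 0ℝ) → Vanishes i w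
Vanishes-≃0 i w w≃0 L _ _ = ℝ-Ring.trans (proj₁ (pairing-Linear L) w 𝟎 w≃0)
  (Linear-𝟎 (pairing L) (pairing-Linear L))

module _ (x y : Fin k → Fin n) (inj : Injective {A = Fin k ⊎ Fin k} _≡_ _≡_ [ x , y ]) where

  φ-ψ : (i : Fin (ℕ.suc k)) (e : ⊤ {n} ⁽ k ⁾) → φ x y i e ≃ ψ (firstPairs x y i) e
  φ-ψ i e = ℝ-Ring.trans (φ-value x y inj i e) (≡⇒≃ (≡.sym (ψ-value (firstPairs x y i) e)))

  correlation-φ : (ρ : Permutation′ n) (w : Weighting (⊤ {n}) k) (i : Fin (ℕ.suc k)) →
    S (λ A → ext w (preimage ρ A) ⊗ ext (φ x y i) A) ≃ pairing (mapPairs (flip ρ ⟨$⟩ʳ_) (firstPairs x y i)) w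
  correlation-φ ρ w i = ℝ-Ring.trans (ℝ-Ring.sym (inner-permute ρ w (φ x y i)))
    (ℝ-Ring.trans (proj₁ (inner-Linear (permute ρ w)) (φ x y i) (ψ (firstPairs x y i)) (φ-ψ i))
      (ℝ-Ring.trans (inner-comm (permute ρ w) (ψ (firstPairs x y i)))
        (ℝ-Ring.trans (inner-ψ (firstPairs x y i) (permute ρ w)) (pairing-permute (firstPairs x y i) ρ w))))

  pairing-[]-φ : (i : Fin (ℕ.suc k)) → 1 ℕ.≤ toℕ i → pairing [] (φ x y i) ≃ 0ℝ
  pairing-[]-φ i 1≤i = ℝ-Ring.trans (proj₁ (pairing-Linear []) (φ x y i) (ψ (firstPairs x y i)) (φ-ψ i))
    (pairing-ψ [] (firstPairs x y i) [] (firstPairs-Unique x y inj i) λ len →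
      ℕ.<⇒≢ 1≤i (≡.sym (≡.trans (≡.sym (length-firstPairs x y i)) len)))

  Vanishes⇒⊥ : (i : Fin (ℕ.suc k)) (w : Weighting (⊤ {n}) k) → Vanishes (toℕ i) w →
               ∀ u → 𝕍 x y i u → ⟨ w , u ⟩ ≃ 0ℝ
  Vanishes⇒⊥ i w h = 𝕍-Linear x y inj i (λ u → ⟨ w , u ⟩) (inner-Linear w) λ L L! len →
    ℝ-Ring.trans (inner-comm w (ψ L)) (ℝ-Ring.trans (inner-ψ L w) (h L L! len))

  ⊥⇒Vanishes : (i : Fin (ℕ.suc k)) (w : Weighting (⊤ {n}) k) →
               (∀ u → 𝕍 x y i u → ⟨ w , u ⟩ ≃ 0ℝ) → Vanishes (toℕ i) w
  ⊥⇒Vanishes i w h L L! len = ℝ-Ring.trans (ℝ-Ring.sym (inner-ψ L w))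
    (ℝ-Ring.trans (inner-comm (ψ L) w) (h (ψ L) (𝕍-ψ x y inj i L L! len)))

  𝕍-Vanishes : (i : Fin (ℕ.suc k)) (u : Weighting (⊤ {n}) k) → 𝕍 x y i u → ∀ j → toℕ i ≢ j → Vanishes j u
  𝕍-Vanishes i u u∈ j i≢j L L! len = 𝕍-Linear x y inj i (pairing L) (pairing-Linear L)
    (λ P P! P-len → pairing-ψ L P L! P! λ eq → i≢j (≡.trans (≡.sym P-len) (≡.trans eq len))) u u∈

  -- Such a `u` lies in the space and is orthogonal to it, hence to itself.
  𝕍-≃0 : ExcludedMiddle 0ℓ → (i : Fin (ℕ.suc k)) (u : Weighting (⊤ {n}) k) → 𝕍 x y i u →
         Vanishes (toℕ i) u → ∀ e → u e ≃ 0ℝ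
  𝕍-≃0 em i u u∈ h = inner-self≃0⇒≃0 em u (Vanishes⇒⊥ i u h u u∈)

  -- For positive `i` the function `φ x y i` has total zero, so the constant subtracted in the
  -- discrepancy is zero, and the correlations are the pairings with all configurations of `i`
  -- disjoint pairs.
  disc-φ⇒Vanishes : (i : Fin (ℕ.suc k)) → 1 ℕ.≤ toℕ i → (w : Weighting (⊤ {n}) k) →
                    disc w (φ x y i) ≃ 0ℝ → Vanishes (toℕ i) w
  disc-φ⇒Vanishes i 1≤i w h L L! len =
    go (transitive (firstPairs x y i) L (≡.trans (length-firstPairs x y i) (≡.sym len)) (firstPairs-Unique x y inj i) L!)
    where
    go : (∃ λ (π : Permutation′ n) → mapPairs (π ⟨$⟩ʳ_) (firstPairs x y i) ≡ L) → pairing L w ≃ 0ℝ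
    go (π , refl) = ℝ-Ring.trans (ℝ-Ring.sym (correlation-φ (flip π) w i))
      (ℝ-Ring.trans (disc≃0⇒Uncorrelated w (φ x y i) h (flip π)) (density-product-≃0ʳ w (φ x y i) (pairing-[]-φ i 1≤i)))

  Vanishes⇒disc-φ : (i : Fin (ℕ.suc k)) → 1 ℕ.≤ toℕ i → (w : Weighting (⊤ {n}) k) →
                    Vanishes (toℕ i) w → disc w (φ x y i) ≃ 0ℝ
  Vanishes⇒disc-φ i 1≤i w h = Uncorrelated⇒disc≃0 w (φ x y i) λ π →
    ℝ-Ring.trans (correlation-φ π w i)
      (ℝ-Ring.trans
        (h (mapPairs (flip π ⟨$⟩ʳ_) (firstPairs x y i))
          (Unique-mapPairs (Injection.injective (↔⇒↣ (flip π))) (firstPairs x y i) (firstPairs-Unique x y inj i))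
          (≡.trans (List.length-map _ (firstPairs x y i)) (length-firstPairs x y i)))
        (ℝ-Ring.sym (density-product-≃0ʳ w (φ x y i) (pairing-[]-φ i 1≤i))))

  -- Orthogonality to a level is preserved by permutations, so all correlations vanish. The
  -- subtracted constant vanishes as well, since one of two distinct indices is positive and the
  -- density at that index is zero.
  disc-𝕍 : (i j : Fin (ℕ.suc k)) → i ≢ j → (u w : Weighting (⊤ {n}) k) → 𝕍 x y i u → 𝕍 x y j w → disc u w ≃ 0ℝ
  disc-𝕍 i j i≢j u w u∈ w∈ = Uncorrelated⇒disc≃0 u w λ π →
    ℝ-Ring.trans (ℝ-Ring.sym (inner-permute π u w))
      (ℝ-Ring.trans
        (Vanishes⇒⊥ j (permute π u)
          (Vanishes-permute (toℕ j) u π (𝕍-Vanishes i u u∈ (toℕ j) (i≢j ∘ Fin.toℕ-injective))) w w∈)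
        (ℝ-Ring.sym (density-product≃0 i j i≢j u∈ w∈)))
    where
    density-product≃0 : ∀ i j → i ≢ j → 𝕍 x y i u → 𝕍 x y j w → density u * density w * fromℕ (n C k) ≃ 0ℝ
    density-product≃0 zero    zero    i≢j _  _  = contradiction refl i≢j
    density-product≃0 (suc i) _       _   u∈ _  = density-product-≃0ˡ u w (𝕍-Vanishes (suc i) u u∈ 0 (λ ()) [] [] refl)
    density-product≃0 zero    (suc j) _   _  w∈ = density-product-≃0ʳ u w (𝕍-Vanishes (suc j) w w∈ 0 (λ ()) [] [] refl)

  Decomposes : Weighting (⊤ {n}) k → Set
  Decomposes w = Σ (Fin (ℕ.suc k) → Weighting (⊤ {n}) k) λ v →
    (∀ h → 𝕍 x y h (v h)) × (∀ e → w e ≃ sum (allFin (ℕ.suc k)) (λ h → v h e))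

  Decomposes-≃ : (w u : Weighting (⊤ {n}) k) → (∀ e → u e ≃ w e) → Decomposes w → Decomposes u
  Decomposes-≃ w u u≃w (v , v∈ , w≃) = v , v∈ , λ e → ℝ-Ring.trans (u≃w e) (w≃ e)

  Decomposes-⊕ : (w u : Weighting (⊤ {n}) k) → Decomposes w → Decomposes u → Decomposes (λ e → w e ⊕ u e)
  Decomposes-⊕ w u (v , v∈ , w≃) (v′ , v′∈ , u≃) =
      (λ h → v h ⊞ v′ h)
    , (λ h → Span-⊞ (λ π → permute π (φ x y h)) (v h) (v′ h) (v∈ h) (v′∈ h))
    , λ e → ℝ-Ring.trans (ℝ-Ring.+-cong (w≃ e) (u≃ e))
        (ℝ-Ring.trans (ℝ-Ring.sym (sum-+ (allFin (ℕ.suc k)) (λ h → v h e) (λ h → v′ h e)))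
          (sum-cong (allFin (ℕ.suc k)) (λ h → ℝ-Ring.sym (⊞-value (v h) (v′ h) e))))

  Decomposes-⊗ : (c : ℝ) (w : Weighting (⊤ {n}) k) → Decomposes w → Decomposes (λ e → c ⊗ w e)
  Decomposes-⊗ c w (v , v∈ , w≃) =
      (λ h → c • v h)
    , (λ h → Span-• (λ π → permute π (φ x y h)) c (v h) (v∈ h))
    , λ e → ℝ-Ring.trans (ℝ-Ring.*-congˡ (w≃ e))
        (ℝ-Ring.trans (ℝ-Ring.sym (sum-* (allFin (ℕ.suc k)) c (λ h → v h e)))
          (sum-cong (allFin (ℕ.suc k)) (λ h → ℝ-Ring.sym (•-value c (v h) e))))

  Decomposes-D : (L : Pairs n) → Unique (points L) → length L ℕ.≤ k → Decomposes (λ e → D L (value e))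
  Decomposes-D L L! len = (λ h → v h (h Fin.≟ i)) , (λ h → v∈ h (h Fin.≟ i)) , λ e → ℝ-Ring.sym
    (ℝ-Ring.trans (sum-single id (λ h → v h (h Fin.≟ i) e) i (λ h h≢i → off h (h Fin.≟ i) h≢i e))
      (ℝ-Ring.trans (at i (i Fin.≟ i) refl e) (≡⇒≃ (ψ-value L e))))
    where
    i : Fin (ℕ.suc k)
    i = Fin.fromℕ< (s≤s len)

    v : ∀ h → Dec (h ≡ i) → Weighting (⊤ {n}) k
    v h (yes _) = ψ L
    v h (no _)  = 𝟎

    v∈ : ∀ h (d : Dec (h ≡ i)) → 𝕍 x y h (v h d)
    v∈ h (yes refl) = 𝕍-ψ x y inj h L L! (≡.sym (Fin.toℕ-fromℕ< (s≤s len)))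
    v∈ h (no _)     = Span-intro (λ π → permute π (φ x y h)) [] 𝟎 (λ e → ℝ-Ring.refl)

    off : ∀ h (d : Dec (h ≡ i)) → h ≢ i → ∀ e → v h d e ≃ 0ℝ
    off h (yes h≡i) h≢i e = contradiction h≡i h≢i
    off h (no _)    _   e = ℝ-Ring.refl

    at : ∀ h (d : Dec (h ≡ i)) → h ≡ i → ∀ e → v h d e ≃ ψ L e
    at h (yes _)   _   e = ℝ-Ring.refl
    at h (no h≢i) h≡i e = contradiction h≡i h≢i

  decompose : (w : Weighting (⊤ {n}) k) → Decomposes w
  decompose w = Decomposes-≃ (λ e → ext w (value e)) w (λ e → ≡⇒≃ (≡.sym (ext-value w e)))
    (Spanning.U-everything k (λ F → Decomposes (λ e → F (value e)))
      (λ {F} {G} F≃G → Decomposes-≃ (λ e → F (value e)) (λ e → G (value e))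
        (λ e → ℝ-Ring.sym (at-level F G F≃G e)))
      (λ {F} {G} → Decomposes-⊕ (λ e → F (value e)) (λ e → G (value e)))
      (λ c {F} → Decomposes-⊗ c (λ e → F (value e)))
      Decomposes-D
      (ext w))
    where
    at-level : (F G : Subset n → ℝ) → (∀ A → ∣ A ∣ ≡ k → F A ≃ G A) → ∀ (e : ⊤ {n} ⁽ k ⁾) → F (value e) ≃ G (value e)
    -- The cardinality of `A` is known only irrelevantly; decidable equality of natural numbers
    -- recovers a usable proof.
    at-level F G F≃G (A , Irrelevant.[ p ]) = F≃G A (recompute (∣ A ∣ ℕ.≟ k) (proj₂ p))

open Algebra.Properties.Semiring.Mult ℝ-Ring.semiring using () renaming (_×_ to _⋆_)
-- Components

≃⇒≈ : ∀ x y → x ≃ y → x ≈ y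
≃⇒≈ x y (limit d) = d

module _ (x y : Fin k → Fin n) (inj : Injective {A = Fin k ⊎ Fin k} _≡_ _≡_ [ x , y ]) where

  -- Pairing with `i` disjoint pairs annihilates all components but the `i`-th.
  pairing-component : (w : Weighting (⊤ {n}) k) (v : Fin (ℕ.suc k) → Weighting (⊤ {n}) k) →
    (∀ h → 𝕍 x y h (v h)) → (∀ e → w e ≃ (⊞-sum (allFin (ℕ.suc k)) v) e) → (i : Fin (ℕ.suc k)) →
    (L : Pairs n) → Unique (points L) → length L ≡ toℕ i → pairing L w ≃ pairing L (v i)
  pairing-component w v v∈ w≃ i L L! len = ℝ-Ring.trans
    (proj₁ (pairing-Linear L) w (⊞-sum (allFin (ℕ.suc k)) v) w≃)
    (ℝ-Ring.trans (Linear-sum (pairing L) (pairing-Linear L) (allFin (ℕ.suc k)) v)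
      (sum-single id (λ h → pairing L (v h)) i λ h h≢i →
        𝕍-Vanishes x y inj h (v h) (v∈ h) (toℕ i) (h≢i ∘ Fin.toℕ-injective) L L! len))

  module _ (em : ExcludedMiddle 0ℓ) where

    component-≃0 : (w : Weighting (⊤ {n}) k) (v : Fin (ℕ.suc k) → Weighting (⊤ {n}) k) →
      (∀ h → 𝕍 x y h (v h)) → (∀ e → w e ≃ (⊞-sum (allFin (ℕ.suc k)) v) e) → (i : Fin (ℕ.suc k)) →
      Vanishes (toℕ i) w → ∀ e → v i e ≃ 0ℝ
    component-≃0 w v v∈ w≃ i h = 𝕍-≃0 x y inj em i (v i) (v∈ i) λ L L! len →
      ℝ-Ring.trans (ℝ-Ring.sym (pairing-component w v v∈ w≃ i L L! len)) (h L L! len)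

    -- The difference of the two `i`-th components lies in the `i`-th space, and its pairings at
    -- that level vanish because both components have the same pairings as `w`.
    component-unique : (w : Weighting (⊤ {n}) k) (v v′ : Fin (ℕ.suc k) → Weighting (⊤ {n}) k) →
      (∀ h → 𝕍 x y h (v h)) → (∀ h → 𝕍 x y h (v′ h)) →
      (∀ e → w e ≃ (⊞-sum (allFin (ℕ.suc k)) v) e) → (∀ e → w e ≃ (⊞-sum (allFin (ℕ.suc k)) v′) e) →
      ∀ i e → v i e ≃ v′ i e
    component-unique w v v′ v∈ v′∈ w≃ w≃′ i e = cancel-difference (v i e) (v′ i e)
      (ℝ-Ring.trans (ℝ-Ring.+-congˡ (ℝ-Ring.sym (•-value (⊝ 1ℝ) (v′ i) e)))
        (ℝ-Ring.trans (ℝ-Ring.sym (⊞-value (v i) ((⊝ 1ℝ) • v′ i) e))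
          (𝕍-≃0 x y inj em i d d∈ d-Vanishes e)))
      where
      d : Weighting (⊤ {n}) k
      d = v i ⊞ ((⊝ 1ℝ) • v′ i)

      d∈ : 𝕍 x y i d
      d∈ = Span-⊞ (λ π → permute π (φ x y i)) (v i) ((⊝ 1ℝ) • v′ i) (v∈ i)
        (Span-• (λ π → permute π (φ x y i)) (⊝ 1ℝ) (v′ i) (v′∈ i))

      d-Vanishes : Vanishes (toℕ i) d
      d-Vanishes L L! len = ℝ-Ring.trans (proj₁ (proj₂ (pairing-Linear L)) (v i) ((⊝ 1ℝ) • v′ i))
        (ℝ-Ring.trans (ℝ-Ring.+-congˡ (proj₂ (proj₂ (pairing-Linear L)) (⊝ 1ℝ) (v′ i)))
          (difference-cancels (pairing L (v i)) (pairing L (v′ i))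
            (ℝ-Ring.trans (ℝ-Ring.sym (pairing-component w v v∈ w≃ i L L! len))
              (pairing-component w v′ v′∈ w≃′ i L L! len))))

    module _ (k2≤n : k ℕ.* 2 ℕ.≤ n) where

      k2≤∣⊤∣ : k ℕ.* 2 ℕ.≤ ∣ ⊤ {n} ∣
      k2≤∣⊤∣ = subst (k ℕ.* 2 ℕ.≤_) (≡.sym (∣⊤∣≡n n)) k2≤n

      W≃0⇒component≃0 : (w : Weighting (⊤ {n}) k) (v : Fin (ℕ.suc k) → Weighting (⊤ {n}) k) →
        (∀ h → 𝕍 x y h (v h)) → (∀ e → w e ≃ (⊞-sum (allFin (ℕ.suc k)) v) e) → (i : Fin (ℕ.suc k)) →
        W w i ≃ 0ℝ → ∀ e → v i e ≃ 0ℝ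
      W≃0⇒component≃0 w v v∈ w≃ i h = component-≃0 w v v∈ w≃ i λ L L! len →
        W≃0⇒VanishesOn w k2≤∣⊤∣ i h L L! (All.universal (λ _ → ∈⊤) (points L)) len

      component≃0⇒W≃0 : (w : Weighting (⊤ {n}) k) (v : Fin (ℕ.suc k) → Weighting (⊤ {n}) k) →
        (∀ h → 𝕍 x y h (v h)) → (∀ e → w e ≃ (⊞-sum (allFin (ℕ.suc k)) v) e) → (i : Fin (ℕ.suc k)) →
        (∀ e → v i e ≃ 0ℝ) → W w i ≃ 0ℝ
      component≃0⇒W≃0 w v v∈ w≃ i v≃0 = VanishesOn⇒W≃0 w k2≤∣⊤∣ i λ L L! _ len →
        ℝ-Ring.trans (pairing-component w v v∈ w≃ i L L! len) (Vanishes-≃0 (toℕ i) (v i) v≃0 L L! len)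

-- Distributing the levels among uncorrelated weightings

module _ (em : ExcludedMiddle 0ℓ) where

  -- For any two configurations one of the pairings is zero, but which one may depend on them. If
  -- some pairing of `u` is nonzero, keeping its configuration fixed as `L′` forces every pairing of
  -- `w` to vanish.
  disc≃0⇒Vanishes : (w u : Weighting (⊤ {n}) k) → disc w u ≃ 0ℝ → ∀ h → 1 ℕ.≤ h → h ℕ.≤ k →
                    Vanishes h w ⊎ Vanishes h u
  disc≃0⇒Vanishes {n} {k} w u disc≃0 h 1≤h h≤k = decide em
    where
    product≃0 : (L L′ : Pairs n) → Unique (points L) → Unique (points L′) → length L ≡ h → length L′ ≡ h →
                pairing L w ⊗ pairing L′ u ≃ 0ℝ
    product≃0 L L′ L! L′! len len′ = go (Uncorrelated-pairs (ext w) (ext u) (ext-Homogeneous w) (ext-Homogeneous u)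
      (disc≃0⇒Uncorrelated w u disc≃0) L L′ L! L′! (≡.trans len (≡.sym len′))
      (subst (1 ℕ.≤_) (≡.sym len) 1≤h) (subst (ℕ._≤ k) (≡.sym len) h≤k))
      where
      go : (∃ λ c → ℕ.NonZero c × c ⋆ (pairing L w ⊗ pairing L′ u) ≃ 0ℝ) → pairing L w ⊗ pairing L′ u ≃ 0ℝ
      go (c , c≢0 , h) = ⋆-cancel c c≢0 (pairing L w ⊗ pairing L′ u) h

    decide : Dec (Vanishes h w) → Vanishes h w ⊎ Vanishes h u
    decide (yes w-Vanishes)  = inj₁ w-Vanishes
    decide (no ¬w-Vanishes) = inj₂ λ L′ L′! len′ → witness L′ L′! len′ em
      where
      witness : ∀ L′ → Unique (points L′) → length L′ ≡ h → Dec (pairing L′ u ≃ 0ℝ) → pairing L′ u ≃ 0ℝ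
      witness L′ L′! len′ (yes u≃0) = u≃0
      witness L′ L′! len′ (no u≄0)  = contradiction
        (λ L L! len → left L (⊗≃0⇒≃0 em (pairing L w) (pairing L′ u) (product≃0 L L′ L! L′! len len′)))
        ¬w-Vanishes
        where
        left : ∀ L → pairing L w ≃ 0ℝ ⊎ pairing L′ u ≃ 0ℝ → pairing L w ≃ 0ℝ
        left L (inj₁ w≃0) = w≃0
        left L (inj₂ u≃0) = contradiction u≃0 u≄0

  -- At most one `w i` fails to be orthogonal to a given space, and it receives that level. The
  -- level is `ℕ.suc (toℕ h)`, because `Fin k` indexes the levels from 1 on.
  owner : ∀ {t} → 1 ℕ.≤ t → (w : Fin t → Weighting (⊤ {n}) k) →
          (∀ i j → i ≢ j → disc (w i) (w j) ≃ 0ℝ) → (h : Fin k) →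
          ∃ λ i → ∀ j → j ≢ i → Vanishes (ℕ.suc (toℕ h)) (w j)
  owner {t = t} 1≤t w disc≃0 h = decide em
    where
    decide : Dec (∃ λ i → ¬ Vanishes (ℕ.suc (toℕ h)) (w i)) → ∃ λ i → ∀ j → j ≢ i → Vanishes (ℕ.suc (toℕ h)) (w j)
    decide (yes (i , ¬Vi)) = i , λ j j≢i → other j
      (disc≃0⇒Vanishes (w j) (w i) (disc≃0 j i j≢i) (ℕ.suc (toℕ h)) (s≤s z≤n) (Fin.toℕ<n h))
      where
      other : ∀ j → Vanishes (ℕ.suc (toℕ h)) (w j) ⊎ Vanishes (ℕ.suc (toℕ h)) (w i) → Vanishes (ℕ.suc (toℕ h)) (w j)
      other j (inj₁ Vj) = Vj
      other j (inj₂ Vi) = contradiction Vi ¬Vi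
    -- If all of them are orthogonal, any index will do, and `1≤t` provides one.
    decide (no none) = Fin.fromℕ< 1≤t , λ j _ → stable j em
      where
      stable : ∀ j → Dec (Vanishes (ℕ.suc (toℕ h)) (w j)) → Vanishes (ℕ.suc (toℕ h)) (w j)
      stable j (yes Vj) = Vj
      stable j (no ¬Vj) = contradiction (j , ¬Vj) none

-- As fibres of a map from levels to indices, the parts cover all levels and are disjoint.
fibre : ∀ {t} → (Fin k → Fin t) → Fin t → Subset k
fibre f i = Vec.tabulate (λ h → does (f h Fin.≟ i))

∈fibre⁺ : ∀ {t} (f : Fin k → Fin t) (h : Fin k) → h ∈ fibre f (f h)
∈fibre⁺ f h = Vec.lookup⇒[]= h (fibre f (f h)) (≡.trans (Vec.lookup∘tabulate _ h) (dec-true (f h Fin.≟ f h) refl))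

∈fibre⁻ : ∀ {t} (f : Fin k → Fin t) (i : Fin t) (h : Fin k) → h ∈ fibre f i → f h ≡ i
∈fibre⁻ f i h h∈ = from-does (f h Fin.≟ i) (≡.trans (≡.sym (Vec.lookup∘tabulate _ h)) (lookup-∈ h∈))
  where
  from-does : ∀ {P : Set} (d : Dec P) → does d ≡ true → P
  from-does (yes p) _ = p

fibre-IsPartition : ∀ {t} (f : Fin k → Fin t) → IsPartition (fibre f)
fibre-IsPartition f =
    (λ h → f h , ∈fibre⁺ f h)
  , λ i j i≢j (h , h∈) → let h∈i , h∈j = x∈p∩q⁻ (fibre f i) (fibre f j) h∈
                         in i≢j (≡.trans (≡.sym (∈fibre⁻ f i h h∈i)) (∈fibre⁻ f j h h∈j))

theorem6p1 : ExcludedMiddle 0ℓ →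
    (n k : ℕ) → 1 ≤ 2 *ℕ k → 2 *ℕ k ≤ n →
    (x y : Fin k → Fin n) → Injective {A = Fin k ⊎ Fin k} _≡_ _≡_ [ x , y ] →
    ((i : Fin (ℕ.suc k)) → 1 ≤ toℕ i → (w : Weighting (⊤ {n}) k) →
    disc w (φ x y i) ≈ 0ℝ ⇔ (𝕍 x y i ⊥ˢ) w)
    × ((i j : Fin (ℕ.suc k)) → i ≢ j → (u w : Weighting (⊤ {n}) k) →
    𝕍 x y i u → 𝕍 x y j w → disc u w ≈ 0ℝ)
    × IsDirectSum (𝕍 x y)
    × ((u : Weighting (⊤ {n}) k) (v : Fin (ℕ.suc k) → Weighting (⊤ {n}) k) →
    ((i : Fin (ℕ.suc k)) → 𝕍 x y i (v i)) → u ≋ ⊞-sum (allFin (ℕ.suc k)) v →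
    (i : Fin (ℕ.suc k)) → W u i ≈ 0ℝ ⇔ v i ≋ 𝟎)
    × ((t : ℕ) → 1 ≤ t → (w : Fin t → Weighting (⊤ {n}) k) →
    ((i : Fin t) → ¬ (w i ≋ 𝟎)) →
    ((i j : Fin t) → i ≢ j → disc (w i) (w j) ≈ 0ℝ) →
    Σ (Fin t → Subset k) λ I → IsPartition I ×
    ((i : Fin t) → ⨁[ inside ∷ I i ] (𝕍 x y) (w i)))
theorem6p1 em n k _ 2k≤n x y inj = part-a , part-b , (part-c , part-c-unique) , part-d , part-e
  where
  part-a : (i : Fin (ℕ.suc k)) → 1 ≤ toℕ i → (w : Weighting (⊤ {n}) k) →
           disc w (φ x y i) ≈ 0ℝ ⇔ (𝕍 x y i ⊥ˢ) w
  part-a i 1≤i w = mk⇔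
    (λ h u u∈ → ≃⇒≈ ⟨ w , u ⟩ 0ℝ
      (Vanishes⇒⊥ x y inj i w (disc-φ⇒Vanishes x y inj i 1≤i w (limit h)) u u∈))
    (λ h → ≃⇒≈ (disc w (φ x y i)) 0ℝ
      (Vanishes⇒disc-φ x y inj i 1≤i w (⊥⇒Vanishes x y inj i w (λ u u∈ → limit (h u u∈)))))

  part-b : (i j : Fin (ℕ.suc k)) → i ≢ j → (u w : Weighting (⊤ {n}) k) →
           𝕍 x y i u → 𝕍 x y j w → disc u w ≈ 0ℝ
  part-b i j i≢j u w u∈ w∈ = ≃⇒≈ (disc u w) 0ℝ (disc-𝕍 x y inj i j i≢j u w u∈ w∈)

  part-c : (w : Weighting (⊤ {n}) k) → Σ (Fin (ℕ.suc k) → Weighting (⊤ {n}) k) λ v →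
           (∀ h → 𝕍 x y h (v h)) × w ≋ ⊞-sum (allFin (ℕ.suc k)) v
  part-c w = let v , v∈ , w≃ = decompose x y inj w in v , v∈ , λ e →
    ≃⇒≈ (w e) ((⊞-sum (allFin (ℕ.suc k)) v) e)
      (ℝ-Ring.trans (w≃ e) (ℝ-Ring.sym (⊞-sum-value (allFin (ℕ.suc k)) v e)))

  part-c-unique : (v v′ : Fin (ℕ.suc k) → Weighting (⊤ {n}) k) → (∀ h → 𝕍 x y h (v h)) → (∀ h → 𝕍 x y h (v′ h)) →
                  ⊞-sum (allFin (ℕ.suc k)) v ≋ ⊞-sum (allFin (ℕ.suc k)) v′ → ∀ h → v h ≋ v′ h
  part-c-unique v v′ v∈ v′∈ v≋v′ h e = ≃⇒≈ (v h e) (v′ h e)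
    (component-unique x y inj em (⊞-sum (allFin (ℕ.suc k)) v) v v′ v∈ v′∈
      (λ _ → ℝ-Ring.refl) (λ e → limit (v≋v′ e)) h e)

  k2≤n : k ℕ.* 2 ≤ n
  k2≤n = subst (_≤ n) (ℕ.*-comm 2 k) 2k≤n

  part-d : (u : Weighting (⊤ {n}) k) (v : Fin (ℕ.suc k) → Weighting (⊤ {n}) k) →
           ((i : Fin (ℕ.suc k)) → 𝕍 x y i (v i)) → u ≋ ⊞-sum (allFin (ℕ.suc k)) v →
           (i : Fin (ℕ.suc k)) → W u i ≈ 0ℝ ⇔ v i ≋ 𝟎
  part-d u v v∈ u≋ i = mk⇔
    (λ h e → ≃⇒≈ (v i e) 0ℝ
      (W≃0⇒component≃0 x y inj em k2≤n u v v∈ (λ e → limit (u≋ e)) i (limit h) e))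
    (λ h → ≃⇒≈ (W u i) 0ℝ
      (component≃0⇒W≃0 x y inj em k2≤n u v v∈ (λ e → limit (u≋ e)) i (λ e → limit (h e))))

  part-e : (t : ℕ) → 1 ≤ t → (w : Fin t → Weighting (⊤ {n}) k) → ((i : Fin t) → ¬ (w i ≋ 𝟎)) →
           ((i j : Fin t) → i ≢ j → disc (w i) (w j) ≈ 0ℝ) →
           Σ (Fin t → Subset k) λ I → IsPartition I × ((i : Fin t) → ⨁[ inside ∷ I i ] (𝕍 x y) (w i))
  -- Every `w i` keeps its full decomposition; it remains to see that the components outside its
  -- part are zero.
  part-e t 1≤t w _ disc≈0 = fibre f , fibre-IsPartition f , λ i →
    proj₁ (part-c (w i)) , (λ h _ → proj₁ (proj₂ (part-c (w i))) h) , off i , proj₂ (proj₂ (part-c (w i)))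
    where
    owners : (h : Fin k) → ∃ λ i → ∀ j → j ≢ i → Vanishes (ℕ.suc (toℕ h)) (w j)
    owners = owner em 1≤t w (λ i j i≢j → limit (disc≈0 i j i≢j))

    f : Fin k → Fin t
    f h = proj₁ (owners h)

    off : ∀ i h → h ∉ inside ∷ fibre f i → proj₁ (part-c (w i)) h ≋ 𝟎
    -- Level 0 is adjoined to every part, so it is never outside.
    off i zero    h∉ = contradiction here h∉
    off i (suc h) h∉ e = ≃⇒≈ (proj₁ (part-c (w i)) (suc h) e) 0ℝ
      (component-≃0 x y inj em (w i) (proj₁ (part-c (w i))) (proj₁ (proj₂ (part-c (w i))))
        (λ e → limit (proj₂ (proj₂ (part-c (w i))) e)) (suc h)
        (proj₂ (owners h) i λ { refl → h∉ (there (∈fibre⁺ f h)) }) e)
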